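{- There exist positive constants $C_1,C_2$ such that for all $T\ge2$, $$C_1<\frac{\sum_{1\le n\le T}f(n)}{T\log^3T}<C_2.$$
   Context: For a positive integer $n$, consider the equation $$n=\left(X+\frac1x\right)\left(Y+\frac1y\right)$$ in positive integers $X,x,Y,y$ with $x>1$ and $y>1$. Two solutions obtained from each other by transposing the pairs $(X,x)$ and $(Y,y)$ are identified, and $f(n)$ denotes the number of solutions up to this identification (so $f(1)=0$). Since $x\neq y$ in every solution, $f(n)$ is equivalently the number of quadruples $(X,x,Y,y)$ of positive integers satisfying the equation with $1<x<y$. $\log$ is the natural logarithm and $\log^3T=(\log T)^3$. -}

module Defs where

open import Data.Nat.Base as ℕ using (ℕ; zero; suc; z≤n; s≤s)
import Data.Nat.Properties as ℕₚ
open import Data.Nat.Divisibility using (_∣_; divides; ∣⇒≤)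
import Data.Nat.Solver as ℕ-Solver
open import Data.Integer.Base as ℤ using (ℤ; +_; +[1+_]; -[1+_])
import Data.Integer.Properties as ℤₚ
open import Data.Rational.Base
open import Data.Rational.Properties
open import Data.Rational.Unnormalised.Base as ℚᵘ using (ℚᵘ; mkℚᵘ)
import Data.Rational.Unnormalised.Properties as ℚᵘₚ
open import Data.Rational.Solver using (module +-*-Solver)
open import Data.List.Base using (List; filter; length; upTo; cartesianProduct)
open import Data.List.Membership.Propositional using (_∈_)
open import Data.List.Membership.Propositional.Properties
  using (∈-filter⁺; ∈-filter⁻; ∈-cartesianProduct⁺; ∈-upTo⁺)
open import Data.List.Relation.Unary.Unique.Propositional using (Unique)
import Data.List.Relation.Unary.Unique.Propositional.Properties as Uniqueₚ
open import Data.Product.Base using (_×_; _,_; ∃-syntax; proj₁; proj₂)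
open import Data.Sum.Base using (inj₁; inj₂)
open import Relation.Nullary.Decidable using (_×-dec_)
open import Relation.Unary using (Decidable)
open import Relation.Binary.PropositionalEquality
  using (_≡_; refl; sym; trans; cong; cong₂; subst; subst₂)

ι : ℕ → ℚ
ι n = + n / 1

infix 9 _⁻¹

-- Total reciprocal; the value 0⁻¹ = 0 is never relevant below.
_⁻¹ : ℚ → ℚ
p@(mkℚ (+ 0)    _ _) ⁻¹ = 0ℚ
p@(mkℚ +[1+ _ ] _ _) ⁻¹ = 1/ p
p@(mkℚ -[1+ _ ] _ _) ⁻¹ = 1/ p

p*p⁻¹≡1 : ∀ {p} → 0ℚ < p → p * p ⁻¹ ≡ 1ℚ
p*p⁻¹≡1 {mkℚ (+ 0) _ _} (*<* (ℤ.+<+ ()))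
p*p⁻¹≡1 {p@(mkℚ +[1+ _ ] _ _)} _ = *-inverseʳ p
p*p⁻¹≡1 {mkℚ -[1+ _ ] _ _} (*<* ())

0<p⁻¹ : ∀ {p} → 0ℚ < p → 0ℚ < p ⁻¹
0<p⁻¹ {mkℚ (+ 0) _ _} (*<* (ℤ.+<+ ()))
0<p⁻¹ {p@(mkℚ +[1+ _ ] _ _)} _ = positive⁻¹ (1/ p) {{1/pos⇒pos p}}
0<p⁻¹ {mkℚ -[1+ _ ] _ _} (*<* ())

ι-toℚᵘ : ∀ n → toℚᵘ (ι n) ℚᵘ.≃ mkℚᵘ (+ n) 0
ι-toℚᵘ n = toℚᵘ-fromℚᵘ (mkℚᵘ (+ n) 0)

ι-injective : ∀ {m n} → ι m ≡ ι n → m ≡ n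
ι-injective {m} {n} eq with fromℚᵘ-injective {mkℚᵘ (+ m) 0} {mkℚᵘ (+ n) 0} eq
... | ℚᵘ.*≡* e = ℤₚ.+-injective (trans (sym (ℤₚ.*-identityʳ (+ m))) (trans e (ℤₚ.*-identityʳ (+ n))))

ι-+ : ∀ m n → ι (m ℕ.+ n) ≡ ι m + ι n
ι-+ m n = toℚᵘ-injective (begin
  toℚᵘ (ι (m ℕ.+ n))               ≈⟨ ι-toℚᵘ (m ℕ.+ n) ⟩
  mkℚᵘ (+ (m ℕ.+ n)) 0             ≈⟨ ℚᵘ.*≡* (cong (ℤ._* (+ 1)) (sym (cong₂ ℤ._+_ (ℤₚ.*-identityʳ (+ m)) (ℤₚ.*-identityʳ (+ n))))) ⟩
  mkℚᵘ (+ m) 0 ℚᵘ.+ mkℚᵘ (+ n) 0   ≈⟨ ℚᵘₚ.+-cong (ℚᵘₚ.≃-sym (ι-toℚᵘ m)) (ℚᵘₚ.≃-sym (ι-toℚᵘ n)) ⟩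
  toℚᵘ (ι m) ℚᵘ.+ toℚᵘ (ι n)       ≈⟨ ℚᵘₚ.≃-sym (toℚᵘ-homo-+ (ι m) (ι n)) ⟩
  toℚᵘ (ι m + ι n)                 ∎)
  where open ℚᵘₚ.≃-Reasoning

ι-* : ∀ m n → ι (m ℕ.* n) ≡ ι m * ι n
ι-* m n = toℚᵘ-injective (begin
  toℚᵘ (ι (m ℕ.* n))               ≈⟨ ι-toℚᵘ (m ℕ.* n) ⟩
  mkℚᵘ (+ (m ℕ.* n)) 0             ≈⟨ ℚᵘ.*≡* (cong (ℤ._* (+ 1)) (ℤₚ.pos-* m n)) ⟩
  mkℚᵘ (+ m) 0 ℚᵘ.* mkℚᵘ (+ n) 0   ≈⟨ ℚᵘₚ.*-cong (ℚᵘₚ.≃-sym (ι-toℚᵘ m)) (ℚᵘₚ.≃-sym (ι-toℚᵘ n)) ⟩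
  toℚᵘ (ι m) ℚᵘ.* toℚᵘ (ι n)       ≈⟨ ℚᵘₚ.≃-sym (toℚᵘ-homo-* (ι m) (ι n)) ⟩
  toℚᵘ (ι m * ι n)                 ∎)
  where open ℚᵘₚ.≃-Reasoning

0<ι : ∀ {n} → 0 ℕ.< n → 0ℚ < ι n
0<ι {suc n} _ = positive⁻¹ (ι (suc n)) {{normalize-pos (suc n) 1}}

archimedean : ∀ {ε} → 0ℚ < ε → ∃[ d ] 1ℚ ≤ ι (suc d) * ε
archimedean {mkℚ (+ 0) _ _} (*<* (ℤ.+<+ ()))
archimedean {mkℚ -[1+ _ ] _ _} (*<* ())
archimedean {ε@(mkℚ +[1+ k ] d _)} _ = d , toℚᵘ-cancel-≤ (begin
  mkℚᵘ (+ 1) 0                              ≤⟨ ℚᵘ.*≤* (ℤ.+≤+ le) ⟩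
  mkℚᵘ (+ suc d) 0 ℚᵘ.* mkℚᵘ +[1+ k ] d     ≃⟨ ℚᵘₚ.*-congʳ {mkℚᵘ +[1+ k ] d} (ℚᵘₚ.≃-sym (ι-toℚᵘ (suc d))) ⟩
  toℚᵘ (ι (suc d)) ℚᵘ.* toℚᵘ ε              ≃⟨ ℚᵘₚ.≃-sym (toℚᵘ-homo-* (ι (suc d)) ε) ⟩
  toℚᵘ (ι (suc d) * ε)                      ∎)
  where
  open ℚᵘₚ.≤-Reasoning
  le : 1 ℕ.* (1 ℕ.* suc d) ℕ.≤ (suc d ℕ.* suc k) ℕ.* 1
  le = subst₂ ℕ._≤_ (sym (trans (ℕₚ.*-identityˡ _) (ℕₚ.*-identityˡ _)))
                    (sym (ℕₚ.*-identityʳ _)) (ℕₚ.m≤m*n (suc d) (suc k))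

0≤* : ∀ {p q} → 0ℚ ≤ p → 0ℚ ≤ q → 0ℚ ≤ p * q
0≤* {p} {q} 0≤p 0≤q =
  nonNegative⁻¹ (p * q) {{nonNeg*nonNeg⇒nonNeg p {{nonNegative 0≤p}} q {{nonNegative 0≤q}}}}

0<* : ∀ {p q} → 0ℚ < p → 0ℚ < q → 0ℚ < p * q
0<* {p} {q} 0<p 0<q =
  positive⁻¹ (p * q) {{pos*pos⇒pos p {{positive 0<p}} q {{positive 0<q}}}}

*-mono : ∀ {p p′ q q′} → 0ℚ ≤ p → 0ℚ ≤ q′ → p ≤ p′ → q ≤ q′ → p * q ≤ p′ * q′
*-mono {p} {p′} {q} {q′} 0≤p 0≤q′ p≤p′ q≤q′ = ≤-trans
  (*-monoˡ-≤-nonNeg p {{nonNegative 0≤p}} q≤q′)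
  (*-monoʳ-≤-nonNeg q′ {{nonNegative 0≤q′}} p≤p′)

0≤p*p : ∀ p → 0ℚ ≤ p * p
0≤p*p p with ≤-total 0ℚ p
... | inj₁ 0≤p = 0≤* 0≤p 0≤p
... | inj₂ p≤0 =
  nonNegative⁻¹ (p * p) {{nonPos*nonPos⇒nonPos p {{nonPositive p≤0}} p {{nonPositive p≤0}}}}

∣p∣∣p∣≡pp : ∀ p → ∣ p ∣ * ∣ p ∣ ≡ p * p
∣p∣∣p∣≡pp p = trans (sym (∣p*q∣≡∣p∣*∣q∣ p p)) (0≤p⇒∣p∣≡p (0≤p*p p))

p≤∣p∣ : ∀ p → p ≤ ∣ p ∣
p≤∣p∣ p with ≤-total 0ℚ p
... | inj₁ 0≤p = ≤-reflexive (sym (0≤p⇒∣p∣≡p 0≤p))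
... | inj₂ p≤0 = ≤-trans p≤0 (0≤∣p∣ p)

triangle : ∀ p q r → ∣ p - r ∣ ≤ ∣ p - q ∣ + ∣ q - r ∣
triangle p q r = subst (λ s → ∣ s ∣ ≤ ∣ p - q ∣ + ∣ q - r ∣)
  (solve 3 (λ p q r → (p :- q) :+ (q :- r) := p :- r) refl p q r)
  (∣p+q∣≤∣p∣+∣q∣ (p - q) (q - r))
  where open +-*-Solver

∣p-q∣≡∣q-p∣ : ∀ p q → ∣ p - q ∣ ≡ ∣ q - p ∣
∣p-q∣≡∣q-p∣ p q = trans (sym (∣-p∣≡∣p∣ (p - q)))
  (cong ∣_∣ (solve 2 (λ p q → :- (p :- q) := q :- p) refl p q))
  where open +-*-Solver

⁻¹-diff : ∀ {p q} → 0ℚ < p → 0ℚ < q → p ⁻¹ - q ⁻¹ ≡ (q - p) * (p ⁻¹ * q ⁻¹)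
⁻¹-diff {p} {q} 0<p 0<q = sym (begin
  (q - p) * (p ⁻¹ * q ⁻¹)                    ≡⟨ solve 4 (λ p q i j → (q :- p) :* (i :* j) := (q :* j) :* i :- (p :* i) :* j) refl p q (p ⁻¹) (q ⁻¹) ⟩
  (q * q ⁻¹) * p ⁻¹ - (p * p ⁻¹) * q ⁻¹      ≡⟨ cong₂ (λ u v → u * p ⁻¹ - v * q ⁻¹) (p*p⁻¹≡1 0<q) (p*p⁻¹≡1 0<p) ⟩
  1ℚ * p ⁻¹ - 1ℚ * q ⁻¹                      ≡⟨ cong₂ _-_ (*-identityˡ (p ⁻¹)) (*-identityˡ (q ⁻¹)) ⟩
  p ⁻¹ - q ⁻¹                                ∎)
  where open +-*-Solver ; open Relation.Binary.PropositionalEquality.≡-Reasoning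

⁻¹-anti : ∀ {c p} → 0ℚ < c → c ≤ p → p ⁻¹ ≤ c ⁻¹
⁻¹-anti {c} {p} 0<c c≤p = begin
  p ⁻¹                          ≡⟨ sym (*-identityˡ (p ⁻¹)) ⟩
  1ℚ * p ⁻¹                     ≡⟨ cong (_* p ⁻¹) (sym (p*p⁻¹≡1 0<c)) ⟩
  (c * c ⁻¹) * p ⁻¹             ≡⟨ solve 3 (λ c i j → (c :* i) :* j := i :* (c :* j)) refl c (c ⁻¹) (p ⁻¹) ⟩
  c ⁻¹ * (c * p ⁻¹)             ≤⟨ *-monoˡ-≤-nonNeg (c ⁻¹) {{nonNegative (<⇒≤ (0<p⁻¹ 0<c))}}
                                    (*-monoʳ-≤-nonNeg (p ⁻¹) {{nonNegative (<⇒≤ (0<p⁻¹ 0<p))}} c≤p) ⟩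
  c ⁻¹ * (p * p ⁻¹)             ≡⟨ cong (c ⁻¹ *_) (p*p⁻¹≡1 0<p) ⟩
  c ⁻¹ * 1ℚ                     ≡⟨ *-identityʳ (c ⁻¹) ⟩
  c ⁻¹                          ∎
  where
  0<p : 0ℚ < p
  0<p = <-≤-trans 0<c c≤p
  open ≤-Reasoning
  open +-*-Solver

⁻¹*⁻¹≤ : ∀ {c p q} → 0ℚ < c → c ≤ p → c ≤ q → p ⁻¹ * q ⁻¹ ≤ c ⁻¹ * c ⁻¹
⁻¹*⁻¹≤ 0<c c≤p c≤q = *-mono (<⇒≤ (0<p⁻¹ (<-≤-trans 0<c c≤p))) (<⇒≤ (0<p⁻¹ 0<c))
  (⁻¹-anti 0<c c≤p) (⁻¹-anti 0<c c≤q)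

Quadruple : Set
Quadruple = ℕ × ℕ × ℕ × ℕ

-- The requirement x < y selects one solution from each pair of
-- transposed ones: x = y never occurs, as it would give x ∣ 1.
IsSolution : ℕ → Quadruple → Set
IsSolution n (X , x , Y , y) =
  (1 ℕ.≤ X) × (1 ℕ.≤ Y) × (1 ℕ.< x) × (x ℕ.< y) ×
  ι n ≡ (ι X + ι x ⁻¹) * (ι Y + ι y ⁻¹)

isSolution? : ∀ n → Decidable (IsSolution n)
isSolution? n (X , x , Y , y) =
  (1 ℕₚ.≤? X) ×-dec (1 ℕₚ.≤? Y) ×-dec (1 ℕₚ.<? x) ×-dec (x ℕₚ.<? y) ×-dec
  (ι n ≟ (ι X + ι x ⁻¹) * (ι Y + ι y ⁻¹))

-- Large enough to contain every solution: see ∈-solutions⁺.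
box : ℕ → List Quadruple
box n = cartesianProduct (upTo (suc n)) (cartesianProduct (upTo (suc n))
          (cartesianProduct (upTo (suc n)) (upTo (2 ℕ.+ n ℕ.* n))))

solutions : ℕ → List Quadruple
solutions n = filter (isSolution? n) (box n)

f : ℕ → ℕ
f n = length (solutions n)

clear-denominators : ∀ {n X x Y y} → 1 ℕ.< x → x ℕ.< y →
  ι n ≡ (ι X + ι x ⁻¹) * (ι Y + ι y ⁻¹) →
  n ℕ.* (x ℕ.* y) ≡ (X ℕ.* x ℕ.+ 1) ℕ.* (Y ℕ.* y ℕ.+ 1)
clear-denominators {n} {X} {x} {Y} {y} 1<x x<y eq = ι-injective (begin
  ι (n ℕ.* (x ℕ.* y))                                ≡⟨ trans (ι-* n (x ℕ.* y)) (cong (ι n *_) (ι-* x y)) ⟩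
  ι n * (ι x * ι y)                                  ≡⟨ cong (_* (ι x * ι y)) eq ⟩
  (ι X + ι x ⁻¹) * (ι Y + ι y ⁻¹) * (ι x * ι y)      ≡⟨ solve 6 (λ X x i Y y j → (X :+ i) :* (Y :+ j) :* (x :* y) := (X :* x :+ x :* i) :* (Y :* y :+ y :* j)) refl (ι X) (ι x) (ι x ⁻¹) (ι Y) (ι y) (ι y ⁻¹) ⟩
  (ι X * ι x + ι x * ι x ⁻¹) * (ι Y * ι y + ι y * ι y ⁻¹)
    ≡⟨ cong₂ (λ u v → (ι X * ι x + u) * (ι Y * ι y + v)) (p*p⁻¹≡1 (0<ι 0<x)) (p*p⁻¹≡1 (0<ι (ℕₚ.<-trans 0<x x<y))) ⟩
  (ι X * ι x + ι 1) * (ι Y * ι y + ι 1)              ≡⟨ cong₂ _*_ (fold X x) (fold Y y) ⟩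
  ι (X ℕ.* x ℕ.+ 1) * ι (Y ℕ.* y ℕ.+ 1)              ≡⟨ sym (ι-* (X ℕ.* x ℕ.+ 1) (Y ℕ.* y ℕ.+ 1)) ⟩
  ι ((X ℕ.* x ℕ.+ 1) ℕ.* (Y ℕ.* y ℕ.+ 1))            ∎)
  where
  open +-*-Solver
  open Relation.Binary.PropositionalEquality.≡-Reasoning
  0<x : 0 ℕ.< x
  0<x = ℕₚ.<-trans (s≤s z≤n) 1<x
  fold : ∀ A a → ι A * ι a + ι 1 ≡ ι (A ℕ.* a ℕ.+ 1)
  fold A a = sym (trans (ι-+ (A ℕ.* a) 1) (cong (_+ ι 1) (ι-* A a)))

solution-bounds : ∀ {n X x Y y} → 1 ℕ.≤ X → 1 ℕ.≤ Y → 1 ℕ.< x → x ℕ.< y →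
  n ℕ.* (x ℕ.* y) ≡ (X ℕ.* x ℕ.+ 1) ℕ.* (Y ℕ.* y ℕ.+ 1) →
  (X ℕ.≤ n) × (x ℕ.≤ n) × (Y ℕ.≤ n) × (y ℕ.≤ 1 ℕ.+ n ℕ.* n)
solution-bounds {n} {X@(suc X₀)} {x@(suc x₀)} {Y@(suc Y₀)} {y@(suc y₀)} _ _ 1<x x<y eq =
  X≤n , x≤n , Y≤n , y≤
  where
  open ℕ-Solver.+-*-Solver
  eq′ : n ℕ.* (x ℕ.* y) ≡ X ℕ.* Y ℕ.* (x ℕ.* y) ℕ.+ (X ℕ.* x ℕ.+ Y ℕ.* y ℕ.+ 1)
  eq′ = trans eq (solve 4 (λ X x Y y → (X :* x :+ con 1) :* (Y :* y :+ con 1)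
          := X :* Y :* (x :* y) :+ (X :* x :+ Y :* y :+ con 1)) refl X x Y y)

  XY<n : X ℕ.* Y ℕ.< n
  XY<n = ℕₚ.*-cancelʳ-< (x ℕ.* y) (X ℕ.* Y) n (subst (X ℕ.* Y ℕ.* (x ℕ.* y) ℕ.<_) (sym eq′)
           (subst (ℕ._≤ X ℕ.* Y ℕ.* (x ℕ.* y) ℕ.+ (X ℕ.* x ℕ.+ Y ℕ.* y ℕ.+ 1))
             (ℕₚ.+-comm (X ℕ.* Y ℕ.* (x ℕ.* y)) 1)
             (ℕₚ.+-monoʳ-≤ (X ℕ.* Y ℕ.* (x ℕ.* y)) (ℕₚ.m≤n+m 1 (X ℕ.* x ℕ.+ Y ℕ.* y)))))

  X≤n : X ℕ.≤ n
  X≤n = ℕₚ.≤-trans (ℕₚ.m≤m*n X Y) (ℕₚ.<⇒≤ XY<n)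
  Y≤n : Y ℕ.≤ n
  Y≤n = ℕₚ.≤-trans (ℕₚ.m≤n*m Y X) (ℕₚ.<⇒≤ XY<n)

  d : ℕ
  d = n ℕ.∸ X ℕ.* Y
  instance
    d≢0 : ℕ.NonZero d
    d≢0 = ℕ.>-nonZero (ℕₚ.m<n⇒0<n∸m XY<n)

  dxy : d ℕ.* (x ℕ.* y) ≡ X ℕ.* x ℕ.+ Y ℕ.* y ℕ.+ 1
  dxy = ℕₚ.+-cancelˡ-≡ (X ℕ.* Y ℕ.* (x ℕ.* y)) _ _ (trans
    (sym (ℕₚ.*-distribʳ-+ (x ℕ.* y) (X ℕ.* Y) d))
    (trans (cong (ℕ._* (x ℕ.* y)) (ℕₚ.m+[n∸m]≡n (ℕₚ.<⇒≤ XY<n))) eq′))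

  Xx<Xy : X ℕ.* x ℕ.+ 1 ℕ.≤ X ℕ.* y
  Xx<Xy = subst (ℕ._≤ X ℕ.* y) (ℕₚ.+-comm 1 (X ℕ.* x)) (ℕₚ.*-monoʳ-< X x<y)

  x≤X+Y : x ℕ.≤ X ℕ.+ Y
  x≤X+Y = ℕₚ.*-cancelʳ-≤ x (X ℕ.+ Y) y (begin
    x ℕ.* y                          ≤⟨ ℕₚ.m≤n*m (x ℕ.* y) d ⟩
    d ℕ.* (x ℕ.* y)                  ≡⟨ dxy ⟩
    X ℕ.* x ℕ.+ Y ℕ.* y ℕ.+ 1        ≡⟨ solve 2 (λ a b → a :+ b :+ con 1 := (a :+ con 1) :+ b) refl (X ℕ.* x) (Y ℕ.* y) ⟩
    (X ℕ.* x ℕ.+ 1) ℕ.+ Y ℕ.* y      ≤⟨ ℕₚ.+-monoˡ-≤ (Y ℕ.* y) Xx<Xy ⟩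
    X ℕ.* y ℕ.+ Y ℕ.* y              ≡⟨ sym (ℕₚ.*-distribʳ-+ y X Y) ⟩
    (X ℕ.+ Y) ℕ.* y                  ∎)
    where open ℕₚ.≤-Reasoning

  x≤n : x ℕ.≤ n
  x≤n = begin
    x                        ≤⟨ x≤X+Y ⟩
    X ℕ.+ Y                  ≤⟨ ℕₚ.m≤m+n (X ℕ.+ Y) (X₀ ℕ.* Y₀) ⟩
    X ℕ.+ Y ℕ.+ X₀ ℕ.* Y₀    ≡⟨ solve 2 (λ a b → (con 1 :+ a) :+ (con 1 :+ b) :+ a :* b := con 1 :+ (con 1 :+ a) :* (con 1 :+ b)) refl X₀ Y₀ ⟩
    suc (X ℕ.* Y)            ≤⟨ XY<n ⟩
    n                        ∎
    where open ℕₚ.≤-Reasoning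

  y∣Xx+1 : y ∣ 1 ℕ.+ X ℕ.* x
  y∣Xx+1 = divides (d ℕ.* x ℕ.∸ Y) (sym (trans (ℕₚ.*-distribʳ-∸ y (d ℕ.* x) Y)
    (trans (cong (ℕ._∸ Y ℕ.* y) (trans (ℕₚ.*-assoc d x y) (trans dxy
      (solve 2 (λ a b → a :+ b :+ con 1 := con 1 :+ a :+ b) refl (X ℕ.* x) (Y ℕ.* y)))))
      (ℕₚ.m+n∸n≡m (1 ℕ.+ X ℕ.* x) (Y ℕ.* y)))))

  y≤ : y ℕ.≤ 1 ℕ.+ n ℕ.* n
  y≤ = ℕₚ.≤-trans (∣⇒≤ y∣Xx+1) (s≤s (ℕₚ.*-mono-≤ X≤n x≤n))

∈-box : ∀ {n X x Y y} → (X ℕ.≤ n) × (x ℕ.≤ n) × (Y ℕ.≤ n) × (y ℕ.≤ 1 ℕ.+ n ℕ.* n) →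
  (X , x , Y , y) ∈ box n
∈-box (X≤n , x≤n , Y≤n , y≤) =
  ∈-cartesianProduct⁺ (∈-upTo⁺ (s≤s X≤n)) (∈-cartesianProduct⁺ (∈-upTo⁺ (s≤s x≤n))
    (∈-cartesianProduct⁺ (∈-upTo⁺ (s≤s Y≤n)) (∈-upTo⁺ (s≤s y≤))))

∈-solutions⁺ : ∀ {n q} → IsSolution n q → q ∈ solutions n
∈-solutions⁺ {n} {X , x , Y , y} (1≤X , 1≤Y , 1<x , x<y , eq) =
  ∈-filter⁺ (isSolution? n)
    (∈-box (solution-bounds {n} 1≤X 1≤Y 1<x x<y (clear-denominators {n} {X} {x} {Y} {y} 1<x x<y eq)))
    (1≤X , 1≤Y , 1<x , x<y , eq)

∈-solutions⁻ : ∀ {n q} → q ∈ solutions n → IsSolution n q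
∈-solutions⁻ {n} q∈ = proj₂ (∈-filter⁻ (isSolution? n) {xs = box n} q∈)

solutions-unique : ∀ n → Unique (solutions n)
solutions-unique n = Uniqueₚ.filter⁺ (isSolution? n)
  (Uniqueₚ.cartesianProduct⁺ {xs = ≤n} (Uniqueₚ.upTo⁺ (suc n))
    (Uniqueₚ.cartesianProduct⁺ {xs = ≤n} (Uniqueₚ.upTo⁺ (suc n))
      (Uniqueₚ.cartesianProduct⁺ {xs = ≤n} (Uniqueₚ.upTo⁺ (suc n))
        (Uniqueₚ.upTo⁺ (2 ℕ.+ n ℕ.* n)))))
  where
  ≤n : List ℕ
  ≤n = upTo (suc n)

IsCauchy : (ℕ → ℚ) → Set
IsCauchy s = ∀ ε → 0ℚ < ε →
  ∃[ N ] (∀ m n → N ℕ.≤ m → N ℕ.≤ n → ∣ s m - s n ∣ ≤ ε)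

record ℝ : Set where
  constructor mkℝ
  field
    seq    : ℕ → ℚ
    cauchy : IsCauchy seq

open ℝ public

infix 4 _<ℝ_ _≤ℝ_

_<ℝ_ : ℝ → ℝ → Set
x <ℝ y = ∃[ ε ] (0ℚ < ε × ∃[ N ] (∀ n → N ℕ.≤ n → seq x n + ε ≤ seq y n))

_≤ℝ_ : ℝ → ℝ → Set
x ≤ℝ y = ∀ ε → 0ℚ < ε → ∃[ N ] (∀ n → N ℕ.≤ n → seq x n ≤ seq y n + ε)

fromℚ : ℚ → ℝ
fromℚ p = mkℝ (λ _ → p) λ ε 0<ε → 0 , λ _ _ _ _ →
  subst (_≤ ε) (sym (cong ∣_∣ (+-inverseʳ p))) (<⇒≤ 0<ε)

fromℕ : ℕ → ℝ
fromℕ n = fromℚ (ι n)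

0ℝ 1ℝ : ℝ
0ℝ = fromℚ 0ℚ
1ℝ = fromℚ 1ℚ

IsCauchy-scale : ∀ {s} K → 0ℚ < K →
  (∀ ε → 0ℚ < ε → ∃[ N ] (∀ m n → N ℕ.≤ m → N ℕ.≤ n → ∣ s m - s n ∣ ≤ K * ε)) →
  IsCauchy s
IsCauchy-scale {s} K 0<K h ε 0<ε with h (K ⁻¹ * ε) (0<* (0<p⁻¹ 0<K) 0<ε)
... | N , bound = N , λ m n N≤m N≤n → subst (∣ s m - s n ∣ ≤_) K*K⁻¹ε≡ε (bound m n N≤m N≤n)
  where
  K*K⁻¹ε≡ε : K * (K ⁻¹ * ε) ≡ ε
  K*K⁻¹ε≡ε = trans (sym (*-assoc K (K ⁻¹) ε))
    (trans (cong (_* ε) (p*p⁻¹≡1 0<K)) (*-identityˡ ε))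

eventually-bounded : ∀ x → ∃[ B ] (0ℚ < B × ∃[ N ] (∀ n → N ℕ.≤ n → ∣ seq x n ∣ ≤ B))
eventually-bounded x with cauchy x 1ℚ (positive⁻¹ 1ℚ)
... | N , close = 1ℚ + ∣ xN ∣ , 0<B , N , bound
  where
  xN : ℚ
  xN = seq x N
  0<B : 0ℚ < 1ℚ + ∣ xN ∣
  0<B = +-mono-<-≤ (positive⁻¹ 1ℚ) (0≤∣p∣ xN)
  bound : ∀ n → N ℕ.≤ n → ∣ seq x n ∣ ≤ 1ℚ + ∣ xN ∣
  bound n N≤n = begin
    ∣ seq x n ∣                    ≡⟨ cong ∣_∣ (solve 2 (λ a b → a := (a :- b) :+ b) refl (seq x n) xN) ⟩
    ∣ (seq x n - xN) + xN ∣        ≤⟨ ∣p+q∣≤∣p∣+∣q∣ (seq x n - xN) xN ⟩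
    ∣ seq x n - xN ∣ + ∣ xN ∣      ≤⟨ +-monoˡ-≤ ∣ xN ∣ (close n N N≤n ℕₚ.≤-refl) ⟩
    1ℚ + ∣ xN ∣                    ∎
    where open ≤-Reasoning ; open +-*-Solver

*-close : ∀ a a′ b b′ {B B′ ε} → ∣ a ∣ ≤ B → ∣ b′ ∣ ≤ B′ → ∣ a - a′ ∣ ≤ ε → ∣ b - b′ ∣ ≤ ε →
  ∣ a * b - a′ * b′ ∣ ≤ (B + B′) * ε
*-close a a′ b b′ {B} {B′} {ε} a≤B b′≤B′ aε bε = begin
  ∣ a * b - a′ * b′ ∣                      ≡⟨ cong ∣_∣ (solve 4 (λ a a′ b b′ → a :* b :- a′ :* b′ := a :* (b :- b′) :+ b′ :* (a :- a′)) refl a a′ b b′) ⟩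
  ∣ a * (b - b′) + b′ * (a - a′) ∣         ≤⟨ ∣p+q∣≤∣p∣+∣q∣ (a * (b - b′)) (b′ * (a - a′)) ⟩
  ∣ a * (b - b′) ∣ + ∣ b′ * (a - a′) ∣     ≡⟨ cong₂ _+_ (∣p*q∣≡∣p∣*∣q∣ a (b - b′)) (∣p*q∣≡∣p∣*∣q∣ b′ (a - a′)) ⟩
  ∣ a ∣ * ∣ b - b′ ∣ + ∣ b′ ∣ * ∣ a - a′ ∣ ≤⟨ +-mono-≤
      (*-mono (0≤∣p∣ a) (≤-trans (0≤∣p∣ (b - b′)) bε) a≤B bε)
      (*-mono (0≤∣p∣ b′) (≤-trans (0≤∣p∣ (a - a′)) aε) b′≤B′ aε) ⟩
  B * ε + B′ * ε                           ≡⟨ sym (*-distribʳ-+ ε B B′) ⟩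
  (B + B′) * ε                             ∎
  where open ≤-Reasoning ; open +-*-Solver

*-cauchy : ∀ x y → IsCauchy (λ n → seq x n * seq y n)
*-cauchy x y = combine (eventually-bounded x) (eventually-bounded y)
  where
  combine :
    ∃[ B ] (0ℚ < B × ∃[ N ] (∀ n → N ℕ.≤ n → ∣ seq x n ∣ ≤ B)) →
    ∃[ B ] (0ℚ < B × ∃[ N ] (∀ n → N ℕ.≤ n → ∣ seq y n ∣ ≤ B)) →
    IsCauchy (λ n → seq x n * seq y n)
  combine (B , 0<B , N₁ , x≤B) (B′ , 0<B′ , N₂ , y≤B′) =
    IsCauchy-scale {λ n → seq x n * seq y n} (B + B′) (+-mono-< 0<B 0<B′)
      λ ε 0<ε → close ε (cauchy x ε 0<ε) (cauchy y ε 0<ε)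
    where
    close : ∀ ε →
      ∃[ N ] (∀ m n → N ℕ.≤ m → N ℕ.≤ n → ∣ seq x m - seq x n ∣ ≤ ε) →
      ∃[ N ] (∀ m n → N ℕ.≤ m → N ℕ.≤ n → ∣ seq y m - seq y n ∣ ≤ ε) →
      ∃[ N ] (∀ m n → N ℕ.≤ m → N ℕ.≤ n →
        ∣ seq x m * seq y m - seq x n * seq y n ∣ ≤ (B + B′) * ε)
    close ε (N₃ , xε) (N₄ , yε) = (N₁ ℕ.⊔ N₂) ℕ.⊔ (N₃ ℕ.⊔ N₄) , λ m n N≤m N≤n →
      *-close (seq x m) (seq x n) (seq y m) (seq y n)
        (x≤B m (ℕₚ.m⊔n≤o⇒m≤o N₁ N₂ (L N≤m))) (y≤B′ n (ℕₚ.m⊔n≤o⇒n≤o N₁ N₂ (L N≤n)))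
        (xε m n (ℕₚ.m⊔n≤o⇒m≤o N₃ N₄ (R N≤m)) (ℕₚ.m⊔n≤o⇒m≤o N₃ N₄ (R N≤n)))
        (yε m n (ℕₚ.m⊔n≤o⇒n≤o N₃ N₄ (R N≤m)) (ℕₚ.m⊔n≤o⇒n≤o N₃ N₄ (R N≤n)))
      where
      L : ∀ {k} → (N₁ ℕ.⊔ N₂) ℕ.⊔ (N₃ ℕ.⊔ N₄) ℕ.≤ k → N₁ ℕ.⊔ N₂ ℕ.≤ k
      L = ℕₚ.m⊔n≤o⇒m≤o (N₁ ℕ.⊔ N₂) (N₃ ℕ.⊔ N₄)
      R : ∀ {k} → (N₁ ℕ.⊔ N₂) ℕ.⊔ (N₃ ℕ.⊔ N₄) ℕ.≤ k → N₃ ℕ.⊔ N₄ ℕ.≤ k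
      R = ℕₚ.m⊔n≤o⇒n≤o (N₁ ℕ.⊔ N₂) (N₃ ℕ.⊔ N₄)

infixl 7 _*ℝ_

_*ℝ_ : ℝ → ℝ → ℝ
x *ℝ y = mkℝ (λ n → seq x n * seq y n) (*-cauchy x y)

infixr 8 _^ℝ_

_^ℝ_ : ℝ → ℕ → ℝ
x ^ℝ zero  = 1ℝ
x ^ℝ suc n = x *ℝ x ^ℝ n

⁻¹-close : ∀ {c} a b {ε} → 0ℚ < c → c ≤ a → c ≤ b → ∣ a - b ∣ ≤ ε →
  ∣ a ⁻¹ - b ⁻¹ ∣ ≤ c ⁻¹ * c ⁻¹ * ε
⁻¹-close {c} a b {ε} 0<c c≤a c≤b ∣a-b∣≤ε = begin
  ∣ a ⁻¹ - b ⁻¹ ∣                  ≡⟨ cong ∣_∣ (⁻¹-diff 0<a 0<b) ⟩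
  ∣ (b - a) * (a ⁻¹ * b ⁻¹) ∣      ≡⟨ ∣p*q∣≡∣p∣*∣q∣ (b - a) (a ⁻¹ * b ⁻¹) ⟩
  ∣ b - a ∣ * ∣ a ⁻¹ * b ⁻¹ ∣      ≡⟨ cong₂ _*_ (∣p-q∣≡∣q-p∣ b a) (0≤p⇒∣p∣≡p 0≤ab) ⟩
  ∣ a - b ∣ * (a ⁻¹ * b ⁻¹)        ≡⟨ *-comm ∣ a - b ∣ (a ⁻¹ * b ⁻¹) ⟩
  (a ⁻¹ * b ⁻¹) * ∣ a - b ∣        ≤⟨ *-mono 0≤ab (≤-trans (0≤∣p∣ (a - b)) ∣a-b∣≤ε) (⁻¹*⁻¹≤ 0<c c≤a c≤b) ∣a-b∣≤ε ⟩
  c ⁻¹ * c ⁻¹ * ε                  ∎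
  where
  open ≤-Reasoning
  0<a : 0ℚ < a
  0<a = <-≤-trans 0<c c≤a
  0<b : 0ℚ < b
  0<b = <-≤-trans 0<c c≤b
  0≤ab : 0ℚ ≤ a ⁻¹ * b ⁻¹
  0≤ab = <⇒≤ (0<* (0<p⁻¹ 0<a) (0<p⁻¹ 0<b))

recip-cauchy : ∀ x → 0ℝ <ℝ x → IsCauchy (λ n → seq x n ⁻¹)
recip-cauchy x (c , 0<c , N , c≤x) =
  IsCauchy-scale {λ n → seq x n ⁻¹} (c ⁻¹ * c ⁻¹) (0<* (0<p⁻¹ 0<c) (0<p⁻¹ 0<c))
    λ ε 0<ε → close ε (cauchy x ε 0<ε)
  where
  c≤ : ∀ {n} → N ℕ.≤ n → c ≤ seq x n
  c≤ {n} N≤n = subst (_≤ seq x n) (+-identityˡ c) (c≤x n N≤n)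
  close : ∀ ε →
    ∃[ M ] (∀ m n → M ℕ.≤ m → M ℕ.≤ n → ∣ seq x m - seq x n ∣ ≤ ε) →
    ∃[ M ] (∀ m n → M ℕ.≤ m → M ℕ.≤ n → ∣ seq x m ⁻¹ - seq x n ⁻¹ ∣ ≤ c ⁻¹ * c ⁻¹ * ε)
  close ε (M , xε) = N ℕ.⊔ M , λ m n le le′ →
    ⁻¹-close (seq x m) (seq x n) 0<c
      (c≤ (ℕₚ.m⊔n≤o⇒m≤o N M le)) (c≤ (ℕₚ.m⊔n≤o⇒m≤o N M le′))
      (xε m n (ℕₚ.m⊔n≤o⇒n≤o N M le) (ℕₚ.m⊔n≤o⇒n≤o N M le′))

recip : (x : ℝ) → 0ℝ <ℝ x → ℝ
recip x 0<x = mkℝ (λ n → seq x n ⁻¹) (recip-cauchy x 0<x)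

infixl 7 _÷ℝ_⟨_⟩

_÷ℝ_⟨_⟩ : ℝ → (y : ℝ) → 0ℝ <ℝ y → ℝ
x ÷ℝ y ⟨ 0<y ⟩ = x *ℝ recip y 0<y

-- riemann a w n is the left-endpoint Riemann sum of 1/t over [a, a + w]
-- for the subdivision into 2ⁿ equal pieces (w may be negative, giving
-- the oriented integral).
riemann : (a w : ℚ) → ℕ → ℚ
riemann a w zero    = w * a ⁻¹
riemann a w (suc n) = riemann a (½ * w) n + riemann (a + ½ * w) (½ * w) n

½^ : ℕ → ℚ
½^ zero    = 1ℚ
½^ (suc n) = ½ * ½^ n

0≤½^ : ∀ n → 0ℚ ≤ ½^ n
0≤½^ zero    = nonNegative⁻¹ 1ℚ
0≤½^ (suc n) = 0≤* (nonNegative⁻¹ ½) (0≤½^ n)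

½^≤1 : ∀ n → ½^ n ≤ 1ℚ
½^≤1 zero    = ≤-refl
½^≤1 (suc n) = ≤-trans (*-monoˡ-≤-nonNeg ½ (½^≤1 n)) (≤ᵇ⇒≤ {½ * 1ℚ} {1ℚ} _)

½^-anti : ∀ {m n} → m ℕ.≤ n → ½^ n ≤ ½^ m
½^-anti {n = n} z≤n = ½^≤1 n
½^-anti (s≤s m≤n)   = *-monoˡ-≤-nonNeg ½ (½^-anti m≤n)

½^*suc≤1 : ∀ n → ½^ n * ι (suc n) ≤ 1ℚ
½^*suc≤1 zero    = ≤-refl
½^*suc≤1 (suc n) = begin
  ½ * ½^ n * ι (suc (suc n))                   ≡⟨ cong (½ * ½^ n *_) (ι-+ 1 (suc n)) ⟩
  ½ * ½^ n * (1ℚ + ι (suc n))                  ≡⟨ solve 2 (λ h k → con ½ :* h :* (con 1ℚ :+ k) := con ½ :* h :+ con ½ :* (h :* k)) refl (½^ n) (ι (suc n)) ⟩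
  ½ * ½^ n + ½ * (½^ n * ι (suc n))            ≤⟨ +-mono-≤ (*-monoˡ-≤-nonNeg ½ (½^≤1 n)) (*-monoˡ-≤-nonNeg ½ (½^*suc≤1 n)) ⟩
  ½ * 1ℚ + ½ * 1ℚ                              ≡⟨⟩
  1ℚ                                           ∎
  where open ≤-Reasoning ; open +-*-Solver

½^-small : ∀ ε → 0ℚ < ε → ∃[ N ] (½^ N ≤ ε)
½^-small ε 0<ε with archimedean 0<ε
... | d , 1≤ = d , (begin
  ½^ d                         ≡⟨ sym (*-identityʳ (½^ d)) ⟩
  ½^ d * 1ℚ                    ≤⟨ *-monoˡ-≤-nonNeg (½^ d) {{nonNegative (0≤½^ d)}} 1≤ ⟩
  ½^ d * (ι (suc d) * ε)       ≡⟨ sym (*-assoc (½^ d) (ι (suc d)) ε) ⟩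
  ½^ d * ι (suc d) * ε         ≤⟨ *-monoʳ-≤-nonNeg ε {{nonNegative (<⇒≤ 0<ε)}} (½^*suc≤1 d) ⟩
  1ℚ * ε                       ≡⟨ *-identityˡ ε ⟩
  ε                            ∎)
  where open ≤-Reasoning

midpoint-≥ : ∀ {c a w} → c ≤ a → c ≤ a + w → c ≤ a + ½ * w
midpoint-≥ {c} {a} {w} c≤a c≤a+w = begin
  c                        ≡⟨ solve 1 (λ c → c := con ½ :* c :+ con ½ :* c) refl c ⟩
  ½ * c + ½ * c            ≤⟨ +-mono-≤ (*-monoˡ-≤-nonNeg ½ c≤a) (*-monoˡ-≤-nonNeg ½ c≤a+w) ⟩
  ½ * a + ½ * (a + w)      ≡⟨ solve 2 (λ a w → con ½ :* a :+ con ½ :* (a :+ w) := a :+ con ½ :* w) refl a w ⟩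
  a + ½ * w                ∎
  where open ≤-Reasoning ; open +-*-Solver

two-halves : ∀ a w → a + ½ * w + ½ * w ≡ a + w
two-halves = solve 2 (λ a w → a :+ con ½ :* w :+ con ½ :* w := a :+ w) refl
  where open +-*-Solver

module RiemannBounds {c : ℚ} (0<c : 0ℚ < c) where

  κ : ℚ
  κ = c ⁻¹ * c ⁻¹

  0<κ : 0ℚ < κ
  0<κ = 0<* (0<p⁻¹ 0<c) (0<p⁻¹ 0<c)

  private
    endpoint : ∀ a w → c ≤ a + w → c ≤ a + ½ * w + ½ * w
    endpoint a w = subst (c ≤_) (sym (two-halves a w))

    swap-differences : ∀ p q r s → (p + q) - (r + s) ≡ (p - r) + (q - s)
    swap-differences = solve 4 (λ p q r s → (p :+ q) :- (r :+ s) := (p :- r) :+ (q :- s)) refl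
      where open +-*-Solver

  riemann-crude : ∀ n a w → c ≤ a → c ≤ a + w → ∣ riemann a w n - w * a ⁻¹ ∣ ≤ w * w * κ
  riemann-crude zero a w _ _ =
    subst (_≤ w * w * κ) (sym (cong ∣_∣ (+-inverseʳ (w * a ⁻¹)))) (0≤* (0≤p*p w) (<⇒≤ 0<κ))
  riemann-crude (suc n) a w c≤a c≤b = begin
    ∣ A + B - w * a ⁻¹ ∣
      ≡⟨ cong ∣_∣ (solve 5 (λ A B w i j → A :+ B :- w :* i := (A :- (con ½ :* w) :* i) :+ ((B :- (con ½ :* w) :* j) :+ (con ½ :* w) :* (j :- i))) refl A B w (a ⁻¹) (m ⁻¹)) ⟩
    ∣ (A - h * a ⁻¹) + ((B - h * m ⁻¹) + h * (m ⁻¹ - a ⁻¹)) ∣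
      ≤⟨ ≤-trans (∣p+q∣≤∣p∣+∣q∣ (A - h * a ⁻¹) ((B - h * m ⁻¹) + h * (m ⁻¹ - a ⁻¹)))
         (+-monoʳ-≤ ∣ A - h * a ⁻¹ ∣ (∣p+q∣≤∣p∣+∣q∣ (B - h * m ⁻¹) (h * (m ⁻¹ - a ⁻¹)))) ⟩
    ∣ A - h * a ⁻¹ ∣ + (∣ B - h * m ⁻¹ ∣ + ∣ h * (m ⁻¹ - a ⁻¹) ∣)
      ≤⟨ +-mono-≤ (riemann-crude n a h c≤a c≤m) (+-mono-≤ (riemann-crude n m h c≤m (endpoint a w c≤b)) third) ⟩
    h * h * κ + (h * h * κ + h * h * κ)
      ≤⟨ +-monoʳ-≤ (h * h * κ) (+-monoʳ-≤ (h * h * κ) (subst (_≤ h * h * κ + h * h * κ) (+-identityʳ (h * h * κ)) (+-monoʳ-≤ (h * h * κ) 0≤hhκ))) ⟩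
    h * h * κ + (h * h * κ + (h * h * κ + h * h * κ))
      ≡⟨ solve 2 (λ w κ → let t = (con ½ :* w) :* (con ½ :* w) :* κ in t :+ (t :+ (t :+ t)) := w :* w :* κ) refl w κ ⟩
    w * w * κ ∎
    where
    open ≤-Reasoning
    open +-*-Solver
    h m A B : ℚ
    h = ½ * w
    m = a + h
    A = riemann a h n
    B = riemann m h n
    c≤m : c ≤ m
    c≤m = midpoint-≥ {c} {a} {w} c≤a c≤b
    0≤hhκ : 0ℚ ≤ h * h * κ
    0≤hhκ = 0≤* (0≤p*p h) (<⇒≤ 0<κ)
    0<a : 0ℚ < a
    0<a = <-≤-trans 0<c c≤a
    0<m : 0ℚ < m
    0<m = <-≤-trans 0<c c≤m
    0≤ma : 0ℚ ≤ m ⁻¹ * a ⁻¹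
    0≤ma = <⇒≤ (0<* (0<p⁻¹ 0<m) (0<p⁻¹ 0<a))
    third : ∣ h * (m ⁻¹ - a ⁻¹) ∣ ≤ h * h * κ
    third = begin
      ∣ h * (m ⁻¹ - a ⁻¹) ∣                ≡⟨ cong (λ t → ∣ h * t ∣) (⁻¹-diff 0<m 0<a) ⟩
      ∣ h * ((a - (a + h)) * (m ⁻¹ * a ⁻¹)) ∣  ≡⟨ cong ∣_∣ (solve 3 (λ a h u → h :* ((a :- (a :+ h)) :* u) := :- (h :* h :* u)) refl a h (m ⁻¹ * a ⁻¹)) ⟩
      ∣ - (h * h * (m ⁻¹ * a ⁻¹)) ∣        ≡⟨ ∣-p∣≡∣p∣ (h * h * (m ⁻¹ * a ⁻¹)) ⟩
      ∣ h * h * (m ⁻¹ * a ⁻¹) ∣            ≡⟨ 0≤p⇒∣p∣≡p (0≤* (0≤p*p h) 0≤ma) ⟩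
      h * h * (m ⁻¹ * a ⁻¹)                ≤⟨ *-monoˡ-≤-nonNeg (h * h) {{nonNegative (0≤p*p h)}} (⁻¹*⁻¹≤ 0<c c≤m c≤a) ⟩
      h * h * κ                            ∎

  riemann-refine : ∀ N {n} → N ℕ.≤ n → ∀ a w → c ≤ a → c ≤ a + w →
    ∣ riemann a w n - riemann a w N ∣ ≤ w * w * κ * ½^ N
  riemann-refine zero {n} _ a w c≤a c≤b =
    subst (∣ riemann a w n - w * a ⁻¹ ∣ ≤_) (sym (*-identityʳ (w * w * κ))) (riemann-crude n a w c≤a c≤b)
  riemann-refine (suc N) {suc n} (s≤s N≤n) a w c≤a c≤b = begin
    ∣ (A + B) - (A′ + B′) ∣          ≡⟨ cong ∣_∣ (swap-differences A B A′ B′) ⟩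
    ∣ (A - A′) + (B - B′) ∣          ≤⟨ ∣p+q∣≤∣p∣+∣q∣ (A - A′) (B - B′) ⟩
    ∣ A - A′ ∣ + ∣ B - B′ ∣          ≤⟨ +-mono-≤ (riemann-refine N N≤n a h c≤a c≤m) (riemann-refine N N≤n m h c≤m (endpoint a w c≤b)) ⟩
    h * h * κ * ½^ N + h * h * κ * ½^ N
      ≡⟨ solve 3 (λ w κ e → let t = (con ½ :* w) :* (con ½ :* w) :* κ :* e in t :+ t := w :* w :* κ :* (con ½ :* e)) refl w κ (½^ N) ⟩
    w * w * κ * ½^ (suc N)           ∎
    where
    open ≤-Reasoning
    open +-*-Solver
    h m A A′ B B′ : ℚ
    h = ½ * w
    m = a + h
    A = riemann a h n
    A′ = riemann a h N
    B = riemann m h n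
    B′ = riemann m h N
    c≤m : c ≤ m
    c≤m = midpoint-≥ {c} {a} {w} c≤a c≤b

  -- a = 1 + t w and a′ = 1 + t w′ are left ends of corresponding pieces (of
  -- widths w and w′) of two subdivisions starting at 1.
  riemann-lipschitz : ∀ n {t a a′ w w′} → a ≡ 1ℚ + t * w → a′ ≡ 1ℚ + t * w′ →
    c ≤ a → c ≤ a + w → c ≤ a′ → c ≤ a′ + w′ →
    ∣ riemann a w n - riemann a′ w′ n ∣ ≤ ∣ w - w′ ∣ * κ
  riemann-lipschitz zero {t} {a} {a′} {w} {w′} a≡ a′≡ c≤a _ c≤a′ _ = begin
    ∣ w * i - w′ * i′ ∣                    ≡⟨ cong ∣_∣ (cong₂ _-_ (sym (*-identityʳ (w * i))) (sym (*-identityʳ (w′ * i′)))) ⟩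
    ∣ w * i * 1ℚ - w′ * i′ * 1ℚ ∣          ≡⟨ cong ∣_∣ (cong₂ (λ u v → w * i * u - w′ * i′ * v) (sym (p*p⁻¹≡1 0<a′)) (sym (p*p⁻¹≡1 0<a))) ⟩
    ∣ w * i * (a′ * i′) - w′ * i′ * (a * i) ∣
      ≡⟨ cong ∣_∣ (cong₂ (λ u v → w * i * (u * i′) - w′ * i′ * (v * i)) a′≡ a≡) ⟩
    ∣ w * i * ((1ℚ + t * w′) * i′) - w′ * i′ * ((1ℚ + t * w) * i) ∣
      ≡⟨ cong ∣_∣ (solve 5 (λ t w w′ i i′ → w :* i :* ((con 1ℚ :+ t :* w′) :* i′) :- w′ :* i′ :* ((con 1ℚ :+ t :* w) :* i) := (w :- w′) :* (i :* i′)) refl t w w′ i i′) ⟩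
    ∣ (w - w′) * (i * i′) ∣                ≡⟨ ∣p*q∣≡∣p∣*∣q∣ (w - w′) (i * i′) ⟩
    ∣ w - w′ ∣ * ∣ i * i′ ∣                ≡⟨ cong (∣ w - w′ ∣ *_) (0≤p⇒∣p∣≡p (<⇒≤ (0<* (0<p⁻¹ 0<a) (0<p⁻¹ 0<a′)))) ⟩
    ∣ w - w′ ∣ * (i * i′)                  ≤⟨ *-monoˡ-≤-nonNeg ∣ w - w′ ∣ {{nonNegative (0≤∣p∣ (w - w′))}} (⁻¹*⁻¹≤ 0<c c≤a c≤a′) ⟩
    ∣ w - w′ ∣ * κ                         ∎
    where
    open ≤-Reasoning
    open +-*-Solver
    i i′ : ℚ
    i = a ⁻¹
    i′ = a′ ⁻¹
    0<a : 0ℚ < a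
    0<a = <-≤-trans 0<c c≤a
    0<a′ : 0ℚ < a′
    0<a′ = <-≤-trans 0<c c≤a′
  riemann-lipschitz (suc n) {t} {a} {a′} {w} {w′} a≡ a′≡ c≤a c≤b c≤a′ c≤b′ = begin
    ∣ (A + B) - (A′ + B′) ∣          ≡⟨ cong ∣_∣ (swap-differences A B A′ B′) ⟩
    ∣ (A - A′) + (B - B′) ∣          ≤⟨ ∣p+q∣≤∣p∣+∣q∣ (A - A′) (B - B′) ⟩
    ∣ A - A′ ∣ + ∣ B - B′ ∣          ≤⟨ +-mono-≤
        (riemann-lipschitz n {t + t} (trans a≡ (left t w)) (trans a′≡ (left t w′)) c≤a c≤m c≤a′ c≤m′)
        (riemann-lipschitz n {t + t + 1ℚ} (trans (cong (_+ ½ * w) a≡) (right t w)) (trans (cong (_+ ½ * w′) a′≡) (right t w′))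
          c≤m (endpoint a w c≤b) c≤m′ (endpoint a′ w′ c≤b′)) ⟩
    ∣ ½ * w - ½ * w′ ∣ * κ + ∣ ½ * w - ½ * w′ ∣ * κ
      ≡⟨ cong (λ u → u * κ + u * κ) (trans (cong ∣_∣ (solve 2 (λ w w′ → con ½ :* w :- con ½ :* w′ := con ½ :* (w :- w′)) refl w w′)) (∣p*q∣≡∣p∣*∣q∣ ½ (w - w′))) ⟩
    ½ * ∣ w - w′ ∣ * κ + ½ * ∣ w - w′ ∣ * κ
      ≡⟨ solve 2 (λ u κ → con ½ :* u :* κ :+ con ½ :* u :* κ := u :* κ) refl ∣ w - w′ ∣ κ ⟩
    ∣ w - w′ ∣ * κ                   ∎
    where
    open ≤-Reasoning
    open +-*-Solver
    A A′ B B′ : ℚ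
    A = riemann a (½ * w) n
    A′ = riemann a′ (½ * w′) n
    B = riemann (a + ½ * w) (½ * w) n
    B′ = riemann (a′ + ½ * w′) (½ * w′) n
    c≤m : c ≤ a + ½ * w
    c≤m = midpoint-≥ {c} {a} {w} c≤a c≤b
    c≤m′ : c ≤ a′ + ½ * w′
    c≤m′ = midpoint-≥ {c} {a′} {w′} c≤a′ c≤b′
    left : ∀ t w → 1ℚ + t * w ≡ 1ℚ + (t + t) * (½ * w)
    left = solve 2 (λ t w → con 1ℚ :+ t :* w := con 1ℚ :+ (t :+ t) :* (con ½ :* w)) refl
    right : ∀ t w → 1ℚ + t * w + ½ * w ≡ 1ℚ + (t + t + 1ℚ) * (½ * w)
    right = solve 2 (λ t w → con 1ℚ :+ t :* w :+ con ½ :* w := con 1ℚ :+ (t :+ t :+ con 1ℚ) :* (con ½ :* w)) refl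

-- log x = ∫₁ˣ dt/t: the n-th term is the Riemann sum on 2ⁿ pieces over
-- the segment from 1 to the n-th approximation of x.
logSeq : ℝ → ℕ → ℚ
logSeq x n = riemann 1ℚ (seq x n - 1ℚ) n

1+[p-1]≡p : ∀ p → 1ℚ + (p - 1ℚ) ≡ p
1+[p-1]≡p = solve 1 (λ p → con 1ℚ :+ (p :- con 1ℚ) := p) refl
  where open +-*-Solver

log-close : ∀ {c} p q {B ε M m n} (0<c : 0ℚ < c) → c ≤ 1ℚ → c ≤ p → c ≤ q →
  ∣ p ∣ ≤ B → ∣ q ∣ ≤ B → ∣ p - q ∣ ≤ ε → ½^ M ≤ ε → M ℕ.≤ m → M ℕ.≤ n →
  let κ = c ⁻¹ * c ⁻¹ ; D = (B + 1ℚ) * (B + 1ℚ) * κ in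
  ∣ riemann 1ℚ (p - 1ℚ) m - riemann 1ℚ (q - 1ℚ) n ∣ ≤ (D + κ + D) * ε
log-close {c} p q {B} {ε} {M} {m} {n} 0<c c≤1 c≤p c≤q p≤B q≤B pq≤ε small M≤m M≤n = begin
  ∣ s p m - s q n ∣                                          ≤⟨ triangle (s p m) (s q M) (s q n) ⟩
  ∣ s p m - s q M ∣ + ∣ s q M - s q n ∣                      ≤⟨ +-monoˡ-≤ ∣ s q M - s q n ∣ (triangle (s p m) (s p M) (s q M)) ⟩
  ∣ s p m - s p M ∣ + ∣ s p M - s q M ∣ + ∣ s q M - s q n ∣  ≤⟨ +-mono-≤ (+-mono-≤ (refine p c≤p p≤B M≤m) lipschitz)
                                                                  (subst (_≤ D * ε) (∣p-q∣≡∣q-p∣ (s q n) (s q M)) (refine q c≤q q≤B M≤n)) ⟩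
  D * ε + κ * ε + D * ε                                      ≡⟨ solve 3 (λ d k e → d :* e :+ k :* e :+ d :* e := (d :+ k :+ d) :* e) refl D κ ε ⟩
  (D + κ + D) * ε                                            ∎
  where
  open ≤-Reasoning
  open +-*-Solver
  open RiemannBounds 0<c
  D : ℚ
  D = (B + 1ℚ) * (B + 1ℚ) * κ
  s : ℚ → ℕ → ℚ
  s r k = riemann 1ℚ (r - 1ℚ) k
  c≤end : ∀ r → c ≤ r → c ≤ 1ℚ + (r - 1ℚ)
  c≤end r = subst (c ≤_) (sym (1+[p-1]≡p r))
  0≤κ : 0ℚ ≤ κ
  0≤κ = <⇒≤ 0<κ
  0≤ε : 0ℚ ≤ ε
  0≤ε = ≤-trans (0≤∣p∣ (p - q)) pq≤ε
  0≤B+1 : 0ℚ ≤ B + 1ℚ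
  0≤B+1 = +-mono-≤ (≤-trans (0≤∣p∣ p) p≤B) (nonNegative⁻¹ 1ℚ)

  refine : ∀ r {k} → c ≤ r → ∣ r ∣ ≤ B → M ℕ.≤ k → ∣ s r k - s r M ∣ ≤ D * ε
  refine r c≤r r≤B M≤k = ≤-trans
    (riemann-refine M M≤k 1ℚ (r - 1ℚ) c≤1 (c≤end r c≤r))
    (*-mono (0≤* (0≤p*p (r - 1ℚ)) 0≤κ) 0≤ε (*-monoʳ-≤-nonNeg κ {{nonNegative 0≤κ}} width²) small)
    where
    width : ∣ r - 1ℚ ∣ ≤ B + 1ℚ
    width = ≤-trans (∣p-q∣≤∣p∣+∣q∣ r 1ℚ) (+-monoˡ-≤ 1ℚ r≤B)
    width² : (r - 1ℚ) * (r - 1ℚ) ≤ (B + 1ℚ) * (B + 1ℚ)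
    width² = subst (_≤ (B + 1ℚ) * (B + 1ℚ)) (∣p∣∣p∣≡pp (r - 1ℚ))
      (*-mono (0≤∣p∣ (r - 1ℚ)) 0≤B+1 width width)

  lipschitz : ∣ s p M - s q M ∣ ≤ κ * ε
  lipschitz = begin
    ∣ s p M - s q M ∣                  ≤⟨ riemann-lipschitz M {0ℚ} (at-1 (p - 1ℚ)) (at-1 (q - 1ℚ)) c≤1 (c≤end p c≤p) c≤1 (c≤end q c≤q) ⟩
    ∣ (p - 1ℚ) - (q - 1ℚ) ∣ * κ        ≡⟨ cong (λ u → ∣ u ∣ * κ) (solve 2 (λ p q → (p :- con 1ℚ) :- (q :- con 1ℚ) := p :- q) refl p q) ⟩
    ∣ p - q ∣ * κ                      ≤⟨ *-monoʳ-≤-nonNeg κ {{nonNegative 0≤κ}} pq≤ε ⟩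
    ε * κ                              ≡⟨ *-comm ε κ ⟩
    κ * ε                              ∎
    where
    at-1 : ∀ w → 1ℚ ≡ 1ℚ + 0ℚ * w
    at-1 w = sym (trans (cong (λ v → 1ℚ + v) (*-zeroˡ w)) (+-identityʳ 1ℚ))

0<⊓1 : ∀ {c} → 0ℚ < c → 0ℚ < c ⊓ 1ℚ
0<⊓1 {c} 0<c with ⊓-sel c 1ℚ
... | inj₁ eq = subst (0ℚ <_) (sym eq) 0<c
... | inj₂ eq = subst (0ℚ <_) (sym eq) (positive⁻¹ 1ℚ)

log-cauchy : ∀ x → 0ℝ <ℝ x → IsCauchy (logSeq x)
log-cauchy x (c₀ , 0<c₀ , N₀ , c₀≤x) = combine (eventually-bounded x)
  where
  c κ : ℚ
  c = c₀ ⊓ 1ℚ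
  κ = c ⁻¹ * c ⁻¹
  0<c : 0ℚ < c
  0<c = 0<⊓1 0<c₀
  0<κ : 0ℚ < κ
  0<κ = 0<* (0<p⁻¹ 0<c) (0<p⁻¹ 0<c)
  c≤ : ∀ {n} → N₀ ℕ.≤ n → c ≤ seq x n
  c≤ {n} N₀≤n = ≤-trans (p⊓q≤p c₀ 1ℚ) (subst (_≤ seq x n) (+-identityˡ c₀) (c₀≤x n N₀≤n))

  combine : ∃[ B ] (0ℚ < B × ∃[ N ] (∀ n → N ℕ.≤ n → ∣ seq x n ∣ ≤ B)) → IsCauchy (logSeq x)
  combine (B , 0<B , N₁ , x≤B) =
    IsCauchy-scale {logSeq x} (D + κ + D) (+-mono-< (+-mono-< 0<D 0<κ) 0<D)
      λ ε 0<ε → close ε (cauchy x ε 0<ε) (½^-small ε 0<ε)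
    where
    D : ℚ
    D = (B + 1ℚ) * (B + 1ℚ) * κ
    0<B+1 : 0ℚ < B + 1ℚ
    0<B+1 = +-mono-< 0<B (positive⁻¹ 1ℚ)
    0<D : 0ℚ < D
    0<D = 0<* (0<* 0<B+1 0<B+1) 0<κ

    close : ∀ ε →
      ∃[ N ] (∀ m n → N ℕ.≤ m → N ℕ.≤ n → ∣ seq x m - seq x n ∣ ≤ ε) →
      ∃[ N ] (½^ N ≤ ε) →
      ∃[ N ] (∀ m n → N ℕ.≤ m → N ℕ.≤ n → ∣ logSeq x m - logSeq x n ∣ ≤ (D + κ + D) * ε)
    close ε (N₂ , xε) (N₃ , small) = M , λ m n M≤m M≤n →
      log-close (seq x m) (seq x n) {M = M} 0<c (p⊓q≤q c₀ 1ℚ)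
        (c≤ (ℕₚ.≤-trans le₀ M≤m)) (c≤ (ℕₚ.≤-trans le₀ M≤n))
        (x≤B m (ℕₚ.≤-trans le₁ M≤m)) (x≤B n (ℕₚ.≤-trans le₁ M≤n))
        (xε m n (ℕₚ.≤-trans le₂ M≤m) (ℕₚ.≤-trans le₂ M≤n))
        (≤-trans (½^-anti le₃) small) M≤m M≤n
      where
      M : ℕ
      M = (N₀ ℕ.⊔ N₁) ℕ.⊔ (N₂ ℕ.⊔ N₃)
      le₀ : N₀ ℕ.≤ M
      le₀ = ℕₚ.≤-trans (ℕₚ.m≤m⊔n N₀ N₁) (ℕₚ.m≤m⊔n (N₀ ℕ.⊔ N₁) (N₂ ℕ.⊔ N₃))
      le₁ : N₁ ℕ.≤ M
      le₁ = ℕₚ.≤-trans (ℕₚ.m≤n⊔m N₀ N₁) (ℕₚ.m≤m⊔n (N₀ ℕ.⊔ N₁) (N₂ ℕ.⊔ N₃))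
      le₂ : N₂ ℕ.≤ M
      le₂ = ℕₚ.≤-trans (ℕₚ.m≤m⊔n N₂ N₃) (ℕₚ.m≤n⊔m (N₀ ℕ.⊔ N₁) (N₂ ℕ.⊔ N₃))
      le₃ : N₃ ℕ.≤ M
      le₃ = ℕₚ.≤-trans (ℕₚ.m≤n⊔m N₂ N₃) (ℕₚ.m≤n⊔m (N₀ ℕ.⊔ N₁) (N₂ ℕ.⊔ N₃))

log : (x : ℝ) → 0ℝ <ℝ x → ℝ
log x 0<x = mkℝ (logSeq x) (log-cauchy x 0<x)

*ℝ-pos : ∀ {x y} → 0ℝ <ℝ x → 0ℝ <ℝ y → 0ℝ <ℝ x *ℝ y
*ℝ-pos {x} {y} (c , 0<c , N , c≤x) (d , 0<d , M , d≤y) =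
  c * d , 0<* 0<c 0<d , N ℕ.⊔ M , λ n le → subst (_≤ seq x n * seq y n) (sym (+-identityˡ (c * d)))
    (let c≤ = subst (_≤ seq x n) (+-identityˡ c) (c≤x n (ℕₚ.m⊔n≤o⇒m≤o N M le))
         d≤ = subst (_≤ seq y n) (+-identityˡ d) (d≤y n (ℕₚ.m⊔n≤o⇒n≤o N M le))
     in *-mono (<⇒≤ 0<c) (≤-trans (<⇒≤ 0<d) d≤) c≤ d≤)

^ℝ-pos : ∀ {x} → 0ℝ <ℝ x → ∀ n → 0ℝ <ℝ x ^ℝ n
^ℝ-pos 0<x zero    = 1ℚ , positive⁻¹ 1ℚ , 0 , λ _ _ → ≤-refl
^ℝ-pos {x} 0<x (suc n) = *ℝ-pos {x} {x ^ℝ n} 0<x (^ℝ-pos {x} 0<x n)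

3/2 : ℚ
3/2 = + 3 / 2

2≤⇒eventually-3/2≤ : ∀ {x} → fromℕ 2 ≤ℝ x → ∃[ N ] (∀ n → N ℕ.≤ n → 3/2 ≤ seq x n)
2≤⇒eventually-3/2≤ {x} 2≤x = shift (2≤x ½ (positive⁻¹ ½))
  where
  open +-*-Solver
  shift : ∃[ N ] (∀ n → N ℕ.≤ n → ι 2 ≤ seq x n + ½) → ∃[ N ] (∀ n → N ℕ.≤ n → 3/2 ≤ seq x n)
  shift (N , le) = N , λ n N≤n → subst (3/2 ≤_)
    (solve 1 (λ p → p :+ con ½ :- con ½ := p) refl (seq x n))
    (+-monoˡ-≤ (- ½) (le n N≤n))

2≤⇒pos : ∀ {x} → fromℕ 2 ≤ℝ x → 0ℝ <ℝ x
2≤⇒pos {x} 2≤x = 3/2 , positive⁻¹ 3/2 , proj₁ eventually , proj₂ eventually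
  where
  eventually : ∃[ N ] (∀ n → N ℕ.≤ n → 3/2 ≤ seq x n)
  eventually = 2≤⇒eventually-3/2≤ {x} 2≤x

riemann-lower : ∀ n {a w b} → 0ℚ < a → 0ℚ ≤ w → a + w ≤ b → w * b ⁻¹ ≤ riemann a w n
riemann-lower zero {a} {w} {b} 0<a 0≤w a+w≤b =
  *-monoˡ-≤-nonNeg w {{nonNegative 0≤w}} (⁻¹-anti 0<a
    (≤-trans (subst (_≤ a + w) (+-identityʳ a) (+-monoʳ-≤ a 0≤w)) a+w≤b))
riemann-lower (suc n) {a} {w} {b} 0<a 0≤w a+w≤b = begin
  w * b ⁻¹                          ≡⟨ solve 2 (λ w i → w :* i := (con ½ :* w) :* i :+ (con ½ :* w) :* i) refl w (b ⁻¹) ⟩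
  ½ * w * b ⁻¹ + ½ * w * b ⁻¹       ≤⟨ +-mono-≤ (riemann-lower n 0<a 0≤h (≤-trans mid≤ end≤)) (riemann-lower n (<-≤-trans 0<a a≤mid) 0≤h end≤) ⟩
  riemann a (½ * w) n + riemann (a + ½ * w) (½ * w) n ∎
  where
  open ≤-Reasoning
  open +-*-Solver
  0≤h : 0ℚ ≤ ½ * w
  0≤h = 0≤* (nonNegative⁻¹ ½) 0≤w
  grow : ∀ p → p ≤ p + ½ * w
  grow p = subst (_≤ p + ½ * w) (+-identityʳ p) (+-monoʳ-≤ p 0≤h)
  a≤mid : a ≤ a + ½ * w
  a≤mid = grow a
  mid≤ : a + ½ * w ≤ a + ½ * w + ½ * w
  mid≤ = grow (a + ½ * w)
  end≤ : a + ½ * w + ½ * w ≤ b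
  end≤ = subst (_≤ b) (sym (two-halves a w)) a+w≤b

log-lower : ∀ n {p} → 3/2 ≤ p → 1ℚ - 3/2 ⁻¹ ≤ riemann 1ℚ (p - 1ℚ) n
log-lower n {p} 3/2≤p = begin
  1ℚ - 3/2 ⁻¹                ≤⟨ +-monoʳ-≤ 1ℚ (neg-antimono-≤ (⁻¹-anti (positive⁻¹ 3/2) 3/2≤p)) ⟩
  1ℚ - p ⁻¹                  ≡⟨ cong (_- p ⁻¹) (sym (p*p⁻¹≡1 0<p)) ⟩
  p * p ⁻¹ - p ⁻¹            ≡⟨ solve 2 (λ p i → p :* i :- i := (p :- con 1ℚ) :* i) refl p (p ⁻¹) ⟩
  (p - 1ℚ) * p ⁻¹            ≤⟨ riemann-lower n (positive⁻¹ 1ℚ) 0≤p-1 (≤-reflexive (1+[p-1]≡p p)) ⟩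
  riemann 1ℚ (p - 1ℚ) n      ∎
  where
  open ≤-Reasoning
  open +-*-Solver
  0<p : 0ℚ < p
  0<p = <-≤-trans (positive⁻¹ 3/2) 3/2≤p
  0≤p-1 : 0ℚ ≤ p - 1ℚ
  0≤p-1 = ≤-trans (≤ᵇ⇒≤ {0ℚ} {3/2 - 1ℚ} _) (+-monoˡ-≤ (- 1ℚ) 3/2≤p)

2≤⇒log-pos : ∀ {x} → fromℕ 2 ≤ℝ x → (0<x : 0ℝ <ℝ x) → 0ℝ <ℝ log x 0<x
2≤⇒log-pos {x} 2≤x 0<x = δ , positive⁻¹ δ , proj₁ eventually , λ n N≤n →
  subst (_≤ logSeq x n) (sym (+-identityˡ δ)) (log-lower n (proj₂ eventually n N≤n))
  where
  δ : ℚ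
  δ = 1ℚ - 3/2 ⁻¹
  eventually : ∃[ N ] (∀ n → N ℕ.≤ n → 3/2 ≤ seq x n)
  eventually = 2≤⇒eventually-3/2≤ {x} 2≤x

T·log³T-pos : ∀ {T} (2≤T : fromℕ 2 ≤ℝ T) →
  0ℝ <ℝ T *ℝ log T (2≤⇒pos {T} 2≤T) ^ℝ 3
T·log³T-pos {T} 2≤T = *ℝ-pos {T} {L ^ℝ 3} 0<T (^ℝ-pos {L} (2≤⇒log-pos {T} 2≤T 0<T) 3)
  where
  0<T : 0ℝ <ℝ T
  0<T = 2≤⇒pos {T} 2≤T
  L : ℝ
  L = log T 0<T

{-# OPTIONS --safe #-}

-- Clearing denominators, a solution for n amounts to a factorisation n = a b
-- with a y = X x + 1 and b x = Y y + 1.  Given coprime x < y, this says that a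
-- and b lie in fixed residue classes modulo x and y.  The solutions with n ≤ N
-- embed, in each of five regimes, into the quadruples of product at most N, of
-- which there are O(N log³ N): each solution is recovered from suitable moduli
-- and quotients.  Conversely, coprime 1 < x < y and i, j ≥ 1 with x y i j ≤ N
-- give a solution with a ≤ x i and b ≤ y j, and taking x, y, i in blocks between
-- consecutive powers of 8 produces at least c N log³ N of these, since a positive
-- proportion of the pairs in a block is coprime.

module Submission where

open import Defs
open import Data.Nat.Base using (ℕ; suc)
open import Data.Nat.ListAction using (sum)
open import Data.List.Base using (map; applyUpTo)
open import Data.Product.Base using (_×_; ∃-syntax)

open import Data.Empty using (⊥-elim)
import Data.Integer.Base as ℤ
open import Data.List.Base using (List; []; _∷_; [_]; _++_; length; concatMap; upTo; cartesianProduct; filter)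
open import Data.List.Properties using (length-++; length-map; map-++; applyUpTo-∷ʳ; length-applyUpTo; length-upTo)
open import Data.List.Membership.Propositional using (_∈_)
open import Data.List.Membership.Propositional.Properties
open import Data.List.Relation.Unary.Any using (here; there)
import Data.List.Relation.Unary.All as Listᴬ
open import Data.List.Relation.Unary.AllPairs using ([]; _∷_)
open import Data.List.Relation.Unary.Unique.Propositional using (Unique)
import Data.List.Relation.Unary.Unique.Propositional.Properties as Uniqueₚ
import Data.Nat.Base as ℕ
open import Data.Nat.Base using (zero; z≤n; s≤s; s≤s⁻¹)
open import Data.Nat.Coprimality using (Coprime; coprime?; coprime-Bézout; coprime-divisor; gcd≡1⇒coprime)
open import Data.Nat.Divisibility using (_∣_; divides; ∣1⇒≡1; 0∣⇒≡0; >⇒∤; ∣⇒≤; ∣m+n∣m⇒∣n; ∣m⇒∣m*n; ∣n⇒∣m*n; n∣m*n; m∣m*n)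
open import Data.Nat.GCD using (gcd; gcd[m,n]∣m; gcd[m,n]∣n; module Bézout)
open import Data.Nat.ListAction.Properties using (sum-++)
import Data.Nat.Properties as ℕₚ
import Data.Nat.Solver as ℕ-Solver
open import Data.Product.Base using (_,_; proj₁; proj₂)
import Data.Rational.Base as ℚ
import Data.Rational.Properties as ℚₚ
import Data.Rational.Solver as ℚ-Solver
open import Data.Sum.Base using (inj₁; inj₂)
open import Data.Vec.Base using (Vec; []; _∷_)
open import Data.Vec.Relation.Unary.All using (All; []; _∷_)
open import Relation.Binary.PropositionalEquality
  using (_≡_; refl; sym; trans; cong; cong₂; subst; subst₂; module ≡-Reasoning)
open import Relation.Nullary using (¬_; yes; no)
open import Relation.Nullary.Decidable using (_×-dec_)
open import Relation.Unary using (Decidable)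

-- The quadruple `x`, `y`, `a div x`, `b div y` has product at most a b and determines the solution,
-- since x and y fix the residues. It fails once a < x or b < y: a quotient is then 0, and the
-- product no longer bounds the other entries. The remaining regimes therefore search the same two
-- equations for congruences whose unknown does exceed its modulus. When both a and b are small, the
-- equations force x = Y + a, y = b + X and a b = X Y + 1, and three numbers suffice.
--
-- The logarithm matters only up to constant factors. With 8^(4 M) ≤ N < 8^(4 K) and K = M + 1, the
-- integer K stands in for log T: the number of solutions is compared with N K³, and so is every
-- late approximation of T log³ T.

module NaturalNumbers where

  open import Data.Nat.Base using (_+_; _*_; _∸_; _^_; _≤_; _<_)
  open import Data.Nat.DivMod hiding (_div_)
  open ℕₚ
  open ℕ-Solver.+-*-Solver

  private
    variable
      A B : Set

  -- Counting by injections

  -- The graph R of a partial map from B onto xs.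
  length-≤ : (R : A → B → Set) {xs : List A} {ys : List B} → Unique xs →
    (∀ {x} → x ∈ xs → ∃[ y ] (y ∈ ys × R x y)) →
    (∀ {x x′ y} → R x y → R x′ y → x ≡ x′) →
    length xs ≤ length ys
  length-≤ R {[]} _ _ _ = z≤n
  length-≤ {A} {B} R {x ∷ xs} {ys} (x≢xs ∷ unique) total functional with total (here refl)
  ... | y , y∈ys , Rxy with ∈-∃++ y∈ys
  ... | before , after , refl = begin
    suc (length xs)                     ≤⟨ s≤s (length-≤ R unique total′ functional) ⟩
    suc (length (before ++ after))      ≡⟨ cong suc (length-++ before) ⟩
    suc (length before + length after)  ≡⟨ sym (+-suc (length before) (length after)) ⟩
    length before + suc (length after)  ≡⟨ sym (length-++ before) ⟩
    length (before ++ y ∷ after)        ∎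
    where
    open ≤-Reasoning
    total′ : ∀ {z} → z ∈ xs → ∃[ w ] (w ∈ before ++ after × R z w)
    total′ {z} z∈xs with total (there z∈xs)
    ... | w , w∈ys , Rzw with ∈-++⁻ before w∈ys
    ... | inj₁ w∈before = w , ∈-++⁺ˡ w∈before , Rzw
    ... | inj₂ (there w∈after) = w , ∈-++⁺ʳ before w∈after , Rzw
    ... | inj₂ (here refl) = ⊥-elim (Listᴬ.lookup x≢xs z∈xs (functional Rxy Rzw))

  -- The disjoint union of the lists `F x`: the index kept in the first component separates the
  -- fibres, so uniqueness passes from the fibres to the whole.
  tagged : List A → (A → List B) → List (A × B)
  tagged xs F = concatMap (λ x → map (x ,_) (F x)) xs

  ∈-tagged⁺ : ∀ {xs : List A} {F : A → List B} {x y} → x ∈ xs → y ∈ F x → (x , y) ∈ tagged xs F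
  ∈-tagged⁺ {F = F} x∈xs y∈Fx = ∈-concat⁺′ (∈-map⁺ (_ ,_) y∈Fx) (∈-map⁺ (λ x → map (x ,_) (F x)) x∈xs)

  ∈-tagged⁻ : ∀ (xs : List A) (F : A → List B) {x y} → (x , y) ∈ tagged xs F → x ∈ xs × y ∈ F x
  ∈-tagged⁻ (x ∷ xs) F xy∈ with ∈-++⁻ (map (x ,_) (F x)) xy∈
  ... | inj₂ xy∈′ with ∈-tagged⁻ xs F xy∈′
  ...   | x∈ , y∈ = there x∈ , y∈
  ∈-tagged⁻ (x ∷ xs) F xy∈ | inj₁ xy∈′ with ∈-map⁻ (x ,_) xy∈′
  ...   | _ , y∈ , refl = here refl , y∈

  tagged-unique : ∀ {xs : List A} {F : A → List B} → Unique xs → (∀ x → Unique (F x)) → Unique (tagged xs F)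
  tagged-unique {xs = []} _ _ = []
  tagged-unique {xs = x ∷ xs} {F} (x≢xs ∷ unique) uniqueF =
    Uniqueₚ.++⁺ (Uniqueₚ.map⁺ (λ { refl → refl }) (uniqueF x)) (tagged-unique unique uniqueF) disjoint
    where
    disjoint : ∀ {p} → ¬ (p ∈ map (x ,_) (F x) × p ∈ tagged xs F)
    disjoint (p∈ , p∈′) with ∈-map⁻ (x ,_) p∈
    ... | _ , _ , refl = Listᴬ.lookup x≢xs (proj₁ (∈-tagged⁻ xs F p∈′)) refl

  length-concatMap : ∀ (F : A → List B) xs → length (concatMap F xs) ≡ sum (map (λ x → length (F x)) xs)
  length-concatMap F [] = refl
  length-concatMap F (x ∷ xs) = trans (length-++ (F x)) (cong (length (F x) +_) (length-concatMap F xs))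

  length-tagged : ∀ (xs : List A) (F : A → List B) → length (tagged xs F) ≡ sum (map (λ x → length (F x)) xs)
  length-tagged [] F = refl
  length-tagged (x ∷ xs) F =
    trans (length-++ (map (x ,_) (F x))) (cong₂ _+_ (length-map (x ,_) (F x)) (length-tagged xs F))

  sum-≥ : ∀ (g : A → ℕ) {c} xs → (∀ {x} → x ∈ xs → c ≤ g x) → length xs * c ≤ sum (map g xs)
  sum-≥ g [] _ = z≤n
  sum-≥ g (x ∷ xs) c≤ = +-mono-≤ (c≤ (here refl)) (sum-≥ g xs (λ x∈ → c≤ (there x∈)))

  -- Finite sums and total division

  [1⋯_] : ℕ → List ℕ
  [1⋯ n ] = applyUpTo suc n

  ∈-[1⋯] : ∀ {k n} → 0 < k → k ≤ n → k ∈ [1⋯ n ]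
  ∈-[1⋯] {suc k} _ k<n = ∈-applyUpTo⁺ suc k<n

  [1⋯]-∈ : ∀ {k n} → k ∈ [1⋯ n ] → 0 < k × k ≤ n
  [1⋯]-∈ k∈ with ∈-applyUpTo⁻ suc k∈
  ... | i , i<n , refl = s≤s z≤n , i<n

  [1⋯]-unique : ∀ n → Unique [1⋯ n ]
  [1⋯]-unique n = Uniqueₚ.applyUpTo⁺₁ suc n (λ i<j _ eq → <⇒≢ i<j (suc-injective eq))

  ∑ : ℕ → (ℕ → ℕ) → ℕ
  ∑ n g = sum (map g [1⋯ n ])

  ∑-suc : ∀ n g → ∑ (suc n) g ≡ ∑ n g + g (suc n)
  ∑-suc n g = trans (cong (λ ks → sum (map g ks)) (sym (applyUpTo-∷ʳ suc n)))
    (trans (cong sum (map-++ g [1⋯ n ] [ suc n ]))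
    (trans (sum-++ (map g [1⋯ n ]) [ g (suc n) ]) (cong (∑ n g +_) (+-identityʳ (g (suc n))))))

  ∑-mono : ∀ n {g h} → (∀ k → g (suc k) ≤ h (suc k)) → ∑ n g ≤ ∑ n h
  ∑-mono zero g≤h = z≤n
  ∑-mono (suc n) {g} {h} g≤h = subst₂ _≤_ (sym (∑-suc n g)) (sym (∑-suc n h)) (+-mono-≤ (∑-mono n g≤h) (g≤h n))

  ∑-tail-≤ : ∀ m n {g c} → (∀ k → m ≤ k → g (suc k) ≤ c) → ∑ (n + m) g ≤ n * c + ∑ m g
  ∑-tail-≤ m zero g≤c = ≤-refl
  ∑-tail-≤ m (suc n) {g} {c} g≤c = begin
    ∑ (suc n + m) g                  ≡⟨ ∑-suc (n + m) g ⟩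
    ∑ (n + m) g + g (suc (n + m))    ≤⟨ +-mono-≤ (∑-tail-≤ m n g≤c) (g≤c (n + m) (m≤n+m m n)) ⟩
    n * c + ∑ m g + c                ≡⟨ +-comm (n * c + ∑ m g) c ⟩
    c + (n * c + ∑ m g)              ≡⟨ sym (+-assoc c (n * c) (∑ m g)) ⟩
    suc n * c + ∑ m g                ∎
    where
    open ≤-Reasoning

  ∑-*ʳ : ∀ n g c → ∑ n (λ k → g k * c) ≡ ∑ n g * c
  ∑-*ʳ zero g c = refl
  ∑-*ʳ (suc n) g c = trans (∑-suc n (λ k → g k * c)) (trans (cong (_+ g (suc n) * c) (∑-*ʳ n g c))
    (trans (sym (*-distribʳ-+ c (∑ n g) (g (suc n)))) (cong (_* c) (sym (∑-suc n g)))))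

  -- Total division; the divisor 0 only occurs outside the ranges of summation.
  infixl 7 _div_

  _div_ : ℕ → ℕ → ℕ
  m div zero  = 0
  m div suc d = m / suc d

  div-* : ∀ m d → d * (m div d) ≤ m
  div-* m zero = z≤n
  div-* m (suc d) = subst (_≤ m) (*-comm (m / suc d) (suc d)) (m/n*n≤m m (suc d))

  div-< : ∀ m {d} → 0 < d → m < suc (m div d) * d
  div-< m {suc d} _ = subst (_< suc (m / suc d) * suc d) (sym (m≡m%n+[m/n]*n m (suc d)))
    (+-monoˡ-< (m / suc d * suc d) (m%n<n m (suc d)))

  div-≤ : ∀ m d → m div d ≤ m
  div-≤ m zero = z≤n
  div-≤ m (suc d) = m/n≤m m (suc d)

  div-greatest : ∀ {m k d} → 0 < d → d * k ≤ m → k ≤ m div d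
  div-greatest {m} {k} {suc d} _ dk≤m = subst (_≤ m / suc d) (m*n/n≡m k (suc d)) (/-monoˡ-≤ (suc d) (subst (_≤ m) (*-comm (suc d) k) dk≤m))

  div-antiʳ : ∀ m {d e} → 0 < d → d ≤ e → m div e ≤ m div d
  div-antiʳ m {suc d} {suc e} _ d≤e = /-monoʳ-≤ m d≤e

  div-positive : ∀ {m d} → 0 < d → d ≤ m → 0 < m div d
  div-positive {m} {d} 0<d d≤m = div-greatest 0<d (subst (_≤ m) (sym (*-identityʳ d)) d≤m)

  ∑-monoˡ : ∀ m n g → ∑ m g ≤ ∑ (n + m) g
  ∑-monoˡ m zero g = ≤-refl
  ∑-monoˡ m (suc n) g = ≤-trans (∑-monoˡ m n g) (subst (∑ (n + m) g ≤_) (sym (∑-suc (n + m) g)) (m≤m+n _ _))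

  ∑-mono-range : ∀ {m n} g → m ≤ n → ∑ m g ≤ ∑ n g
  ∑-mono-range {m} {n} g m≤n = subst (λ k → ∑ m g ≤ ∑ k g) (m∸n+n≡m m≤n) (∑-monoˡ m (n ∸ m) g)

  -- Each dyadic block contributes at most N.
  ∑-div-≤ : ∀ N m → ∑ (2 ^ m ∸ 1) (N div_) ≤ m * N
  ∑-div-≤ N zero = z≤n
  ∑-div-≤ N (suc m) = begin
    ∑ (2 ^ suc m ∸ 1) (N div_)                        ≡⟨ cong (λ k → ∑ k (N div_)) split ⟩
    ∑ (2 ^ m + (2 ^ m ∸ 1)) (N div_)                  ≤⟨ ∑-tail-≤ (2 ^ m ∸ 1) (2 ^ m) tail ⟩
    2 ^ m * (N div 2 ^ m) + ∑ (2 ^ m ∸ 1) (N div_)    ≤⟨ +-mono-≤ (div-* N (2 ^ m)) (∑-div-≤ N m) ⟩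
    N + m * N                                         ∎
    where
    open ≤-Reasoning
    split : 2 ^ suc m ∸ 1 ≡ 2 ^ m + (2 ^ m ∸ 1)
    split = trans (cong (_∸ 1) (cong (2 ^ m +_) (+-identityʳ (2 ^ m)))) (+-∸-assoc (2 ^ m) (m^n>0 2 m))
    tail : ∀ k → 2 ^ m ∸ 1 ≤ k → N div suc k ≤ N div 2 ^ m
    tail k le = div-antiʳ N (m^n>0 2 m) (subst (_≤ suc k) (m+[n∸m]≡n (m^n>0 2 m)) (s≤s le))

  -- The harmonic estimate, with `m` in the role of log₂ N. Every logarithm of the upper bound
  -- enters here.
  ∑-div-log : ∀ {N m} → N < 2 ^ m → ∑ N (N div_) ≤ m * N
  ∑-div-log {N} {m} N<2^m = ≤-trans (∑-mono-range (N div_) (m+n≤o⇒m≤o∸n N (subst (_≤ 2 ^ m) (+-comm 1 N) N<2^m))) (∑-div-≤ N m)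

  length-cartesianProduct : ∀ (xs : List A) (ys : List B) → length (cartesianProduct xs ys) ≡ length xs * length ys
  length-cartesianProduct []       ys = refl
  length-cartesianProduct (x ∷ xs) ys =
    trans (length-++ (map (x ,_) ys)) (cong₂ _+_ (length-map (x ,_) ys) (length-cartesianProduct xs ys))

  -- The upper bound

  ∏ : ∀ {k} → Vec ℕ k → ℕ
  ∏ []      = 1
  ∏ (p ∷ v) = p * ∏ v

  ∏-positive : ∀ {k} {v : Vec ℕ k} → All (0 <_) v → 0 < ∏ v
  ∏-positive []       = s≤s z≤n
  ∏-positive (0<p ∷ ps) = *-mono-≤ 0<p (∏-positive ps)

  tuples : ∀ k → ℕ → List (Vec ℕ (suc k))
  tuples zero    N = map (_∷ []) [1⋯ N ]
  tuples (suc k) N = concatMap (λ p → map (p ∷_) (tuples k (N div p))) [1⋯ N ]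

  ∈-tuples : ∀ k {N} {v : Vec ℕ (suc k)} → All (0 <_) v → ∏ v ≤ N → v ∈ tuples k N
  ∈-tuples zero {N} {p ∷ []} (0<p ∷ []) ≤N = ∈-map⁺ (_∷ []) (∈-[1⋯] 0<p (subst (_≤ N) (*-identityʳ p) ≤N))
  ∈-tuples (suc k) {N} {p ∷ v} (0<p ∷ 0<v) ≤N =
    ∈-concat⁺′ (∈-map⁺ (p ∷_) (∈-tuples k 0<v (div-greatest 0<p ≤N)))
      (∈-map⁺ (λ p → map (p ∷_) (tuples k (N div p)))
        (∈-[1⋯] 0<p (≤-trans (m≤m*n p (∏ v) {{ℕ.>-nonZero (∏-positive 0<v)}}) ≤N)))

  -- Fixing the first entry p leaves tuples of product at most `N div p`, so each entry except the
  -- last costs one harmonic sum, that is one factor `m`. Quadruples thus give the third power.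
  length-tuples : ∀ k {N m} → N < 2 ^ m → length (tuples k N) ≤ N * m ^ k
  length-tuples zero {N} _ = ≤-reflexive
    (trans (length-map (_∷ []) [1⋯ N ]) (trans (length-applyUpTo suc N) (sym (*-identityʳ N))))
  length-tuples (suc k) {N} {m} N<2^m = begin
    length (tuples (suc k) N)                                              ≡⟨ length-concatMap _ [1⋯ N ] ⟩
    ∑ N (λ p → length (map (Vec._∷_ p) (tuples k (N div p))))              ≤⟨ ∑-mono N step ⟩
    ∑ N (λ p → N div p * m ^ k)                                            ≡⟨ ∑-*ʳ N (N div_) (m ^ k) ⟩
    ∑ N (N div_) * m ^ k                                                   ≤⟨ *-monoˡ-≤ (m ^ k) (∑-div-log {N} {m} N<2^m) ⟩
    m * N * m ^ k                                                          ≡⟨ solve 3 (λ m N c → m :* N :* c := N :* (m :* c)) refl m N (m ^ k) ⟩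
    N * m ^ suc k                                                          ∎
    where
    open ≤-Reasoning
    step : ∀ i → length (map (Vec._∷_ (suc i)) (tuples k (N div suc i))) ≤ N div suc i * m ^ k
    step i = subst (_≤ N div suc i * m ^ k) (sym (length-map _ (tuples k (N div suc i))))
      (length-tuples k (≤-<-trans (div-≤ N (suc i)) N<2^m))

  -- Inverses to a modulus

  ≡1-coprime : ∀ {m a x X} → m * a ≡ X * x + 1 → Coprime x m
  ≡1-coprime {m} {a} {x} {X} ma≡ {d} (d∣x , d∣m) =
    ∣1⇒≡1 (∣m+n∣m⇒∣n (subst (d ∣_) ma≡ (∣m⇒∣m*n a d∣m)) (∣n⇒∣m*n X d∣x))

  -- x divides m (a′ - a) and is coprime to m, so it divides a′ - a. Equal quotients put a and a′
  -- into the same interval of length x, which leaves only the difference 0.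
  inverse-≤ : ∀ {m a a′ x X X′} → 0 < x → m * a ≡ X * x + 1 → m * a′ ≡ X′ * x + 1 →
    a div x ≡ a′ div x → a′ ≤ a
  inverse-≤ {m} {a} {a′} {x} {X} {X′} 0<x ma≡ ma′≡ q≡ with ≤-total a′ a
  ... | inj₁ a′≤a = a′≤a
  ... | inj₂ a≤a′ = m∸n≡0⇒m≤n (n<m∧m∣n⇒n≡0 d<x x∣d)
    where
    n<m∧m∣n⇒n≡0 : ∀ {m n} → n < m → m ∣ n → n ≡ 0
    n<m∧m∣n⇒n≡0 {n = zero}  _   _   = refl
    n<m∧m∣n⇒n≡0 {n = suc n} n<m m∣n = ⊥-elim (>⇒∤ n<m m∣n)
    x∣d : x ∣ a′ ∸ a
    x∣d = coprime-divisor (≡1-coprime {m} {a} {x} {X} ma≡) (divides (X′ ∸ X)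
      (trans (*-distribˡ-∸ m a′ a) (trans (cong₂ _∸_ ma′≡ ma≡)
        (trans (cong₂ _∸_ (+-comm (X′ * x) 1) (+-comm (X * x) 1)) (sym (*-distribʳ-∸ x X′ X))))))
    d<x : a′ ∸ a < x
    d<x = +-cancelʳ-< a (a′ ∸ a) x (begin-strict
      a′ ∸ a + a               ≡⟨ m∸n+n≡m a≤a′ ⟩
      a′                       <⟨ div-< a′ 0<x ⟩
      x + a′ div x * x         ≡⟨ cong (λ q → x + q * x) (sym q≡) ⟩
      x + a div x * x          ≡⟨ cong (x +_) (*-comm (a div x) x) ⟩
      x + x * (a div x)        ≤⟨ +-monoʳ-≤ x (div-* a x) ⟩
      x + a                    ∎)
      where
      open ≤-Reasoning

  -- a is determined by its residue, the inverse of m modulo x, and its quotient.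
  inverse-unique : ∀ {m a a′ x X X′} → 0 < x → m * a ≡ X * x + 1 → m * a′ ≡ X′ * x + 1 →
    a div x ≡ a′ div x → a ≡ a′
  inverse-unique {m} {a} {a′} {x} {X} {X′} 0<x ma≡ ma′≡ q≡ with ≤-total a a′
  ... | inj₂ a′≤a = sym (≤-antisym a′≤a (inverse-≤ {m} {a′} {a} {x} {X′} {X} 0<x ma′≡ ma≡ (sym q≡)))
  ... | inj₁ a≤a′ = ≤-antisym a≤a′ (inverse-≤ {m} {a} {a′} {x} {X} {X′} 0<x ma≡ ma′≡ q≡)

  -- The factors a = (X x + 1) / y and b = (Y y + 1) / x of n = a b are integers.
  record Configuration (X x Y y a b : ℕ) : Set where
    constructor configuration
    field
      1≤X : 1 ≤ X
      1≤Y : 1 ≤ Y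
      1<x : 1 < x
      x<y : x < y
      ay≡ : a * y ≡ X * x + 1
      bx≡ : b * x ≡ Y * y + 1

    0<x : 0 < x
    0<x = <-trans (s≤s z≤n) 1<x
    0<y : 0 < y
    0<y = <-trans 0<x x<y
    ya≡ : y * a ≡ X * x + 1
    ya≡ = trans (*-comm y a) ay≡
    xb≡ : x * b ≡ Y * y + 1
    xb≡ = trans (*-comm x b) bx≡
    0<a : 0 < a
    0<a = n≢0⇒n>0 λ { refl → m+1+n≢0 (X * x) (sym ay≡) }
    0<b : 0 < b
    0<b = n≢0⇒n>0 λ { refl → m+1+n≢0 (Y * y) (sym bx≡) }

  -- Modulo y the cleared equation n x y = (X x + 1) (Y y + 1) says that X x + 1 vanishes, as the
  -- other factor is 1; modulo x it is the other way round. Cancelling x y then gives n = a b.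
  configure : ∀ {n X x Y y} → IsSolution n (X , x , Y , y) →
    ∃[ a ] ∃[ b ] (Configuration X x Y y a b × n ≡ a * b)
  configure {n} {X} {x} {Y} {y} (1≤X , 1≤Y , 1<x , x<y , eq) =
    let divides a Xx+1≡ay = y∣Xx+1
        divides b Yy+1≡bx = x∣Yy+1
        0<x = <-trans (s≤s z≤n) 1<x
        0<xy = *-mono-≤ 0<x (<-trans 0<x x<y)
    in a , b , configuration 1≤X 1≤Y 1<x x<y (sym Xx+1≡ay) (sym Yy+1≡bx) ,
       *-cancelʳ-≡ n (a * b) (x * y) {{ℕ.>-nonZero 0<xy}}
         (trans cleared (trans (cong₂ _*_ Xx+1≡ay Yy+1≡bx)
           (solve 4 (λ a b x y → a :* y :* (b :* x) := a :* b :* (x :* y)) refl a b x y)))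
    where
    cleared : n * (x * y) ≡ (X * x + 1) * (Y * y + 1)
    cleared = clear-denominators {n} {X} {x} {Y} {y} 1<x x<y eq
    y∣Xx+1 : y ∣ X * x + 1
    y∣Xx+1 = ∣m+n∣m⇒∣n (subst (y ∣_) (trans cleared
      (solve 2 (λ u v → u :* (v :+ con 1) := u :* v :+ u) refl (X * x + 1) (Y * y)))
      (∣n⇒∣m*n n (n∣m*n x))) (∣n⇒∣m*n (X * x + 1) (n∣m*n Y))
    x∣Yy+1 : x ∣ Y * y + 1
    x∣Yy+1 = ∣m+n∣m⇒∣n (subst (x ∣_) (trans cleared
      (solve 2 (λ u v → (u :+ con 1) :* v := u :* v :+ v) refl (X * x) (Y * y + 1)))
      (∣n⇒∣m*n n (m∣m*n y))) (∣m⇒∣m*n (Y * y + 1) (n∣m*n X))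

  -- The five regimes in which a solution is recovered from four numbers of
  -- product at most a b: the congruences a y ≡ 1 (mod x), b x ≡ 1 (mod y),
  -- b x ≡ 1 (mod Y) and a b ≡ 1 (mod X or Y) recover a number that exceeds
  -- its modulus from its quotient.  In the third regime Y² stands for the
  -- two moduli, which leaves room to store the residue r of x.
  data Code (X x Y y a b : ℕ) : ℕ × Vec ℕ 4 → Set where
    a≥x∧b≥y : ∀ {p q} → p ≡ a div x → q ≡ b div y →
      Code X x Y y a b (0 , x ∷ y ∷ p ∷ q ∷ [])
    a<x∧b≥y : ∀ {p q} → p ≡ y div x → q ≡ b div y →
      Code X x Y y a b (1 , a ∷ x ∷ p ∷ q ∷ [])
    a≥x∧b<y : ∀ {p q s} r {w} → r < Y → w + r ≡ Y * Y →
      x ≡ r + Y * p → q ≡ b div Y → s ≡ a div x →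
      Code X x Y y a b (2 , w ∷ p ∷ q ∷ s ∷ [])
    a<x∧b<y∧b≥X : ∀ {p} → Y + a ≡ x → b + X ≡ y → a * b ≡ Y * X + 1 → p ≡ b div X →
      Code X x Y y a b (3 , a ∷ X ∷ p ∷ 1 ∷ [])
    a<x∧b<y∧b<X : ∀ {p} → Y + a ≡ x → b + X ≡ y → b * a ≡ X * Y + 1 → p ≡ a div Y →
      Code X x Y y a b (4 , b ∷ Y ∷ p ∷ 1 ∷ [])

  -- The numbers Y² - r with 0 ≤ r < Y fill the interval (Y² - Y, Y²], and these intervals are
  -- disjoint for different Y. Hence a single number of size at most Y² stores both Y and r.
  square-code-≤ : ∀ {Y Y′ r r′ w} → r < Y → r′ < Y′ → w + r ≡ Y * Y → w + r′ ≡ Y′ * Y′ → Y′ ≤ Y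
  square-code-≤ {Y} {Y′} {r} {r′} {w} r<Y r′<Y′ w+r≡ w+r′≡ with Y′ ≤? Y
  ... | yes Y′≤Y = Y′≤Y
  ... | no  Y′≰Y = ⊥-elim (<-irrefl refl (begin-strict
    w + r′              <⟨ +-mono-≤-< (m≤m+n w r) r′<Y′ ⟩
    w + r + Y′          ≡⟨ cong (_+ Y′) w+r≡ ⟩
    Y * Y + Y′          ≤⟨ +-monoˡ-≤ Y′ (*-monoʳ-≤ Y (<⇒≤ (≰⇒> Y′≰Y))) ⟩
    Y * Y′ + Y′         ≡⟨ +-comm (Y * Y′) Y′ ⟩
    suc Y * Y′          ≤⟨ *-monoˡ-≤ Y′ (≰⇒> Y′≰Y) ⟩
    Y′ * Y′             ≡⟨ sym w+r′≡ ⟩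
    w + r′              ∎))
    where
    open ≤-Reasoning

  square-code-injective : ∀ {Y Y′ r r′ w} → r < Y → r′ < Y′ → w + r ≡ Y * Y → w + r′ ≡ Y′ * Y′ →
    Y ≡ Y′ × r ≡ r′
  square-code-injective {Y} {Y′} {r} {r′} {w} r<Y r′<Y′ w+r≡ w+r′≡
    with ≤-antisym (square-code-≤ r′<Y′ r<Y w+r′≡ w+r≡) (square-code-≤ r<Y r′<Y′ w+r≡ w+r′≡)
  ... | refl = refl , +-cancelˡ-≡ w r r′ (trans w+r≡ (sym w+r′≡))

  +1*-cancelʳ : ∀ {m n k} → 0 < k → m * k + 1 ≡ n * k + 1 → m ≡ n
  +1*-cancelʳ {m} {n} {k} 0<k eq = *-cancelʳ-≡ m n k {{ℕ.>-nonZero 0<k}} (+-cancelʳ-≡ 1 (m * k) (n * k) eq)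

  module _ where

    open Configuration

    configuration-determined : ∀ {X X′ x Y Y′ y a b} →
      Configuration X x Y y a b → Configuration X′ x Y′ y a b → X ≡ X′ × Y ≡ Y′
    configuration-determined C C′ =
      +1*-cancelʳ (0<x C) (trans (sym (ay≡ C)) (ay≡ C′)) , +1*-cancelʳ (0<y C) (trans (sym (bx≡ C)) (bx≡ C′))

    -- The order of recovery matters, since every inverse needs its modulus first. Second regime: y
    -- from a modulo x, then b from x modulo y. Third: Y and r from w, then x, then b from x modulo
    -- Y, then y from b x = Y y + 1, then a from y modulo x. Fourth: b from a modulo X, then Y from
    -- a b = Y X + 1, and x, y as sums; the fifth is its mirror image.
    decode : ∀ {X X′ x x′ Y Y′ y y′ a a′ b b′ c} →
      Configuration X x Y y a b → Configuration X′ x′ Y′ y′ a′ b′ →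
      Code X x Y y a b c → Code X′ x′ Y′ y′ a′ b′ c →
      (x , y , a , b) ≡ (x′ , y′ , a′ , b′)
    decode {X} {X′} {x} {Y = Y} {Y′} {y} {a = a} {a′} {b} {b′} C C′ (a≥x∧b≥y p≡ q≡) (a≥x∧b≥y p≡′ q≡′)
      with inverse-unique {y} {a} {a′} {x} {X} {X′} (0<x C) (ya≡ C) (ya≡ C′) (trans (sym p≡) p≡′)
         | inverse-unique {x} {b} {b′} {y} {Y} {Y′} (0<y C) (xb≡ C) (xb≡ C′) (trans (sym q≡) q≡′)
    ... | refl | refl = refl
    decode {X} {X′} {x} {Y = Y} {Y′} {y} {y′} {a} {b = b} {b′} C C′ (a<x∧b≥y p≡ q≡) (a<x∧b≥y p≡′ q≡′)
      with inverse-unique {a} {y} {y′} {x} {X} {X′} (0<x C) (ay≡ C) (ay≡ C′) (trans (sym p≡) p≡′)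
    ... | refl with inverse-unique {x} {b} {b′} {y} {Y} {Y′} (0<y C) (xb≡ C) (xb≡ C′) (trans (sym q≡) q≡′)
    ... | refl = refl
    decode {X} {X′} {x} {x′} {Y} {Y′} {y} {y′} {a} {a′} {b} {b′} C C′
      (a≥x∧b<y r r<Y w+r≡ x≡ q≡ s≡) (a≥x∧b<y r′ r′<Y′ w+r′≡ x≡′ q≡′ s≡′)
      with square-code-injective r<Y r′<Y′ w+r≡ w+r′≡
    ... | refl , refl with trans x≡ (sym x≡′)
    ... | refl with inverse-unique {x} {b} {b′} {Y} {y} {y′} (1≤Y C)
        (trans (xb≡ C) (cong (_+ 1) (*-comm Y y))) (trans (xb≡ C′) (cong (_+ 1) (*-comm Y y′))) (trans (sym q≡) q≡′)
    ... | refl with +1*-cancelʳ {y} {y′} (1≤Y C)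
        (trans (cong (_+ 1) (*-comm y Y)) (trans (sym (bx≡ C)) (trans (bx≡ C′) (cong (_+ 1) (*-comm Y y′)))))
    ... | refl with inverse-unique {y} {a} {a′} {x} {X} {X′} (0<x C) (ya≡ C) (ya≡ C′) (trans (sym s≡) s≡′)
    ... | refl = refl
    decode {X} {Y = Y} {Y′} {a = a} {b = b} {b′} C C′ (a<x∧b<y∧b≥X x≡ y≡ ab≡ p≡) (a<x∧b<y∧b≥X x≡′ y≡′ ab≡′ p≡′)
      with inverse-unique {a} {b} {b′} {X} {Y} {Y′} (1≤X C) ab≡ ab≡′ (trans (sym p≡) p≡′)
    ... | refl with +1*-cancelʳ {Y} {Y′} {X} (1≤X C) (trans (sym ab≡) ab≡′)
    ... | refl with x≡ | x≡′ | y≡ | y≡′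
    ... | refl | refl | refl | refl = refl
    decode {X} {X′} {Y = Y} {a = a} {a′} {b = b} C C′ (a<x∧b<y∧b<X x≡ y≡ ba≡ p≡) (a<x∧b<y∧b<X x≡′ y≡′ ba≡′ p≡′)
      with inverse-unique {b} {a} {a′} {Y} {X} {X′} (1≤Y C) ba≡ ba≡′ (trans (sym p≡) p≡′)
    ... | refl with +1*-cancelʳ {X} {X′} {Y} (1≤Y C) (trans (sym ba≡) ba≡′)
    ... | refl with x≡ | x≡′ | y≡ | y≡′
    ... | refl | refl | refl | refl = refl

    -- Makes `x div Y` positive in the third regime, and keeps Y + a below 2 x when a and b are both
    -- small.
    b<y⇒Y<x : ∀ {X x Y y a b} → Configuration X x Y y a b → b < y → Y < x
    b<y⇒Y<x {X} {x} {Y} {y} {a} {b} C b<y = *-cancelʳ-< y Y x (begin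
      suc (Y * y)    ≡⟨ +-comm 1 (Y * y) ⟩
      Y * y + 1      ≡⟨ sym (bx≡ C) ⟩
      b * x          ≤⟨ *-monoˡ-≤ x (<⇒≤ b<y) ⟩
      y * x          ≡⟨ *-comm y x ⟩
      x * y          ∎)
      where open ≤-Reasoning

    Y<b : ∀ {X x Y y a b} → Configuration X x Y y a b → Y < b
    Y<b {X} {x} {Y} {y} {a} {b} C = *-cancelʳ-< y Y b (begin
      suc (Y * y)    ≡⟨ +-comm 1 (Y * y) ⟩
      Y * y + 1      ≡⟨ sym (bx≡ C) ⟩
      b * x          ≤⟨ *-monoʳ-≤ b (<⇒≤ (x<y C)) ⟩
      b * y          ∎)
      where open ≤-Reasoning

  -- x y divides a y + b x − 1 = x y (Y + a) / x, which lies strictly between 0 and 2 x y.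
  both-small : ∀ {X x Y y a b} → Configuration X x Y y a b → a < x → b < y →
    Y + a ≡ x × b + X ≡ y × a * b ≡ Y * X + 1
  both-small {X} {x} {Y} {y} {a} {b} C a<x b<y = Y+a≡x , b+X≡y , ab≡
    where
    open Configuration C
    cross : (Y + a) * y ≡ (b + X) * x
    cross = +-cancelʳ-≡ 1 _ _ (begin
      (Y + a) * y + 1            ≡⟨ solve 3 (λ Y a y → (Y :+ a) :* y :+ con 1 := (Y :* y :+ con 1) :+ a :* y) refl Y a y ⟩
      (Y * y + 1) + a * y        ≡⟨ cong₂ _+_ (sym bx≡) ay≡ ⟩
      b * x + (X * x + 1)        ≡⟨ solve 3 (λ b X x → b :* x :+ (X :* x :+ con 1) := (b :+ X) :* x :+ con 1) refl b X x ⟩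
      (b + X) * x + 1            ∎)
      where
      open ≡-Reasoning
    x∣Y+a : x ∣ Y + a
    x∣Y+a = coprime-divisor (≡1-coprime {y} {a} {x} {X} ya≡)
      (divides (b + X) (trans (*-comm y (Y + a)) cross))
    once : ∀ {k} → Y + a ≡ k * x → Y + a ≡ x
    once {zero}        eq = ⊥-elim (<⇒≢ (<-≤-trans 0<a (m≤n+m a Y)) (sym eq))
    once {suc zero}    eq = trans eq (+-identityʳ x)
    once {suc (suc k)} eq = ⊥-elim (<⇒≱ (+-mono-< (b<y⇒Y<x C b<y) a<x)
      (subst (x + x ≤_) (sym eq) (+-monoʳ-≤ x (m≤m+n x (k * x)))))
    Y+a≡x : Y + a ≡ x
    Y+a≡x with divides k eq ← x∣Y+a = once {k} eq
    b+X≡y : b + X ≡ y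
    b+X≡y = *-cancelʳ-≡ (b + X) y x {{ℕ.>-nonZero 0<x}}
      (trans (sym cross) (trans (cong (_* y) Y+a≡x) (*-comm x y)))
    ab≡ : a * b ≡ Y * X + 1
    ab≡ = +-cancelʳ-≡ (a * X) _ _ (begin
      a * b + a * X          ≡⟨ sym (*-distribˡ-+ a b X) ⟩
      a * (b + X)            ≡⟨ cong (a *_) b+X≡y ⟩
      a * y                  ≡⟨ ay≡ ⟩
      X * x + 1              ≡⟨ cong (λ x → X * x + 1) (sym Y+a≡x) ⟩
      X * (Y + a) + 1        ≡⟨ solve 3 (λ X Y a → X :* (Y :+ a) :+ con 1 := Y :* X :+ con 1 :+ a :* X) refl X Y a ⟩
      Y * X + 1 + a * X      ∎)
      where
      open ≡-Reasoning

  -- Each case split ensures that every dividend reaches its modulus, so the stored quotients are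
  -- positive; a modulus times its quotient is at most the dividend, and the product telescopes down
  -- to a b.
  encode : ∀ {X x Y y a b} → Configuration X x Y y a b →
    ∃[ t ] ∃[ v ] (t < 5 × All (0 <_) v × ∏ v ≤ a * b × Code X x Y y a b (t , v))
  encode {X} {x} {Y} {y} {a} {b} C with x ≤? a | y ≤? b
  ... | yes x≤a | yes y≤b = 0 , _ , s≤s z≤n ,
    0<x ∷ 0<y ∷ div-positive 0<x x≤a ∷ div-positive 0<y y≤b ∷ [] ,
    (begin
      x * (y * (a div x * (b div y * 1)))   ≡⟨ solve 4 (λ x y p q → x :* (y :* (p :* (q :* con 1))) := (x :* p) :* (y :* q)) refl x y (a div x) (b div y) ⟩
      x * (a div x) * (y * (b div y))       ≤⟨ *-mono-≤ (div-* a x) (div-* b y) ⟩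
      a * b                                 ∎) ,
    a≥x∧b≥y refl refl
    where
    open ≤-Reasoning
    open Configuration C
  ... | no x≰a | yes y≤b = 1 , _ , s≤s (s≤s z≤n) ,
    0<a ∷ 0<x ∷ div-positive 0<x (<⇒≤ x<y) ∷ div-positive 0<y y≤b ∷ [] ,
    (begin
      a * (x * (y div x * (b div y * 1)))   ≡⟨ solve 4 (λ a x p q → a :* (x :* (p :* (q :* con 1))) := a :* ((x :* p) :* q)) refl a x (y div x) (b div y) ⟩
      a * (x * (y div x) * (b div y))       ≤⟨ *-monoʳ-≤ a (*-monoˡ-≤ (b div y) (div-* y x)) ⟩
      a * (y * (b div y))                   ≤⟨ *-monoʳ-≤ a (div-* b y) ⟩
      a * b                                 ∎) ,
    a<x∧b≥y refl refl
    where
    open ≤-Reasoning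
    open Configuration C
  ... | yes x≤a | no y≰b = 2 , _ , s≤s (s≤s (s≤s z≤n)) ,
    0<w ∷ div-positive 1≤Y (<⇒≤ Y<x) ∷ div-positive 1≤Y (<⇒≤ (Y<b C)) ∷ div-positive 0<x x≤a ∷ [] ,
    (begin
      -- Lowering Y² by r can only lower the product. One factor Y then goes with `p` to make up x,
      -- the other with `q` to make up b.
      (Y * Y ∸ r) * (p * (q * (s * 1)))     ≤⟨ *-monoˡ-≤ (p * (q * (s * 1))) (m∸n≤m (Y * Y) r) ⟩
      Y * Y * (p * (q * (s * 1)))           ≡⟨ solve 4 (λ Y p q s → Y :* Y :* (p :* (q :* (s :* con 1))) := (Y :* p) :* s :* (Y :* q)) refl Y p q s ⟩
      Y * p * s * (Y * q)                   ≤⟨ *-mono-≤ (*-monoˡ-≤ s (div-* x Y)) (div-* b Y) ⟩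
      x * s * b                             ≤⟨ *-monoˡ-≤ b (div-* a x) ⟩
      a * b                                 ∎) ,
    a≥x∧b<y r r<Y (m∸n+n≡m r≤Y²) (sym (m∸n+n≡m (div-* x Y))) refl refl
    where
    open ≤-Reasoning
    open Configuration C
    Y<x : Y < x
    Y<x = b<y⇒Y<x C (≰⇒> y≰b)
    p q s r : ℕ
    p = x div Y
    q = b div Y
    s = a div x
    r = x ∸ Y * p
    r<Y : r < Y
    r<Y = +-cancelʳ-< (Y * p) r Y (subst₂ _<_ (sym (m∸n+n≡m (div-* x Y))) (cong (Y +_) (*-comm p Y)) (div-< x 1≤Y))
    r≤Y² : r ≤ Y * Y
    r≤Y² = ≤-trans (<⇒≤ r<Y) (m≤m*n Y Y {{ℕ.>-nonZero 1≤Y}})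
    0<w : 0 < Y * Y ∸ r
    0<w = m<n⇒0<n∸m (<-≤-trans r<Y (m≤m*n Y Y {{ℕ.>-nonZero 1≤Y}}))
  ... | no x≰a | no y≰b with both-small C (≰⇒> x≰a) (≰⇒> y≰b) | X ≤? b
  ... | x≡ , y≡ , ab≡ | yes X≤b = 3 , _ , s≤s (s≤s (s≤s (s≤s z≤n))) ,
    0<a ∷ 1≤X ∷ div-positive 1≤X X≤b ∷ s≤s z≤n ∷ [] ,
    *-monoʳ-≤ a (subst (λ p → X * p ≤ b) (sym (*-identityʳ (b div X))) (div-* b X)) ,
    a<x∧b<y∧b≥X x≡ y≡ ab≡ refl
    where
    open Configuration C
  ... | x≡ , y≡ , ab≡ | no X≰b = 4 , _ , ≤-refl ,
    0<b ∷ 1≤Y ∷ div-positive 1≤Y Y≤a ∷ s≤s z≤n ∷ [] ,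
    subst (b * (Y * (a div Y * 1)) ≤_) (*-comm b a)
      (*-monoʳ-≤ b (subst (λ p → Y * p ≤ a) (sym (*-identityʳ (a div Y))) (div-* a Y))) ,
    a<x∧b<y∧b<X x≡ y≡ (trans (*-comm b a) (trans ab≡ (cong (_+ 1) (*-comm Y X)))) refl
    where
    open Configuration C
    open ≤-Reasoning
    -- As a b = Y X + 1 exceeds Y X, the inequalities a < Y and b < X cannot both hold, so one of
    -- the last two regimes always applies.
    Y≤a : Y ≤ a
    Y≤a = ≮⇒≥ λ a<Y → <-irrefl refl (begin-strict
      a * b          ≤⟨ *-mono-≤ (<⇒≤ a<Y) (<⇒≤ (≰⇒> X≰b)) ⟩
      Y * X          <⟨ n<1+n (Y * X) ⟩
      suc (Y * X)    ≡⟨ +-comm 1 (Y * X) ⟩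
      Y * X + 1      ≡⟨ sym ab≡ ⟩
      a * b          ∎)

  -- Counting the codes

  solutions≤ : ℕ → List (ℕ × Quadruple)
  solutions≤ N = tagged [1⋯ N ] solutions

  codes : ℕ → List (ℕ × Vec ℕ 4)
  codes N = cartesianProduct (upTo 5) (tuples 3 N)

  -- The factors a and b are not part of the solution; `decode` shows that the code determines them,
  -- and with them n.
  Encoded : ℕ × Quadruple → ℕ × Vec ℕ 4 → Set
  Encoded (n , X , x , Y , y) c =
    ∃[ a ] ∃[ b ] (n ≡ a * b × Configuration X x Y y a b × Code X x Y y a b c)

  ∑f≡length : ∀ N → ∑ N f ≡ length (solutions≤ N)
  ∑f≡length N = sym (length-tagged [1⋯ N ] solutions)

  encode-solution : ∀ {N n X x Y y} → n ≤ N → ∃[ a ] ∃[ b ] (Configuration X x Y y a b × n ≡ a * b) →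
    ∃[ c ] (c ∈ codes N × Encoded (n , X , x , Y , y) c)
  encode-solution n≤N (a , b , C , n≡ab) with encode C
  ... | t , v , t<5 , 0<v , ∏v≤ab , code = (t , v) ,
    ∈-cartesianProduct⁺ (∈-upTo⁺ t<5) (∈-tuples 3 0<v (≤-trans ∏v≤ab (subst (_≤ _) n≡ab n≤N))) ,
    a , b , n≡ab , C , code

  Encoded-functional : ∀ {s s′ c} → Encoded s c → Encoded s′ c → s ≡ s′
  Encoded-functional (a , b , n≡ , C , code) (a′ , b′ , n≡′ , C′ , code′) with decode C C′ code code′
  ... | refl with configuration-determined C C′
  ... | refl , refl with trans n≡ (sym n≡′)
  ... | refl = refl

  ∑f-upper : ∀ {N m} → N < 2 ^ m → ∑ N f ≤ 5 * (N * m ^ 3)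
  ∑f-upper {N} {m} N<2^m = begin
    ∑ N f                              ≡⟨ ∑f≡length N ⟩
    length (solutions≤ N)              ≤⟨ length-≤ Encoded (tagged-unique ([1⋯]-unique N) solutions-unique) total Encoded-functional ⟩
    length (codes N)                   ≡⟨ length-cartesianProduct (upTo 5) (tuples 3 N) ⟩
    5 * length (tuples 3 N)            ≤⟨ *-monoʳ-≤ 5 (length-tuples 3 {N} {m} N<2^m) ⟩
    5 * (N * m ^ 3)                    ∎
    where
    open ≤-Reasoning
    total : ∀ {s} → s ∈ solutions≤ N → ∃[ c ] (c ∈ codes N × Encoded s c)
    total {n , X , x , Y , y} s∈ =
      let n∈ , q∈ = ∈-tagged⁻ [1⋯ N ] solutions s∈
      in encode-solution (proj₂ ([1⋯]-∈ n∈)) (configure {n} (∈-solutions⁻ {n} q∈))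

  -- The lower bound

  -- Since 1 / d² ≤ 1 / (d − ½) − 1 / (d + ½), the sum over 2 ≤ d ≤ D + 1 is
  -- at most 2/3 − 1 / (D + 3/2) = 4 D / (3 (2 D + 3)).
  ∑-squares-telescope : ∀ P Q D →
    3 * (2 * D + 3) * ∑ D (λ d → P div suc d * (Q div suc d)) ≤ 4 * D * (P * Q)
  ∑-squares-telescope P Q zero = z≤n
  ∑-squares-telescope P Q (suc D) = *-cancelˡ-≤ (2 * D + 3) {{ℕ.>-nonZero (≤-trans (s≤s z≤n) (m≤n+m 3 (2 * D)))}} (begin
    (2 * D + 3) * (3 * (2 * suc D + 3) * ∑ (suc D) g)
      ≡⟨ cong (λ σ → (2 * D + 3) * (3 * (2 * suc D + 3) * σ)) (∑-suc D g) ⟩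
    (2 * D + 3) * (3 * (2 * suc D + 3) * (∑ D g + t))
      ≡⟨ solve 3 (λ D σ t → (con 2 :* D :+ con 3) :* (con 3 :* (con 2 :* (con 1 :+ D) :+ con 3) :* (σ :+ t))
           := (con 2 :* D :+ con 5) :* (con 3 :* (con 2 :* D :+ con 3) :* σ) :+ con 3 :* ((con 4 :* D :* D :+ con 16 :* D :+ con 15) :* t)) refl D (∑ D g) t ⟩
    (2 * D + 5) * (3 * (2 * D + 3) * ∑ D g) + 3 * ((4 * D * D + 16 * D + 15) * t)
      -- 4 D² + 16 D + 15 = (2 D + 3) (2 D + 5) = 4 d² - 1. Rounding it up to 4 d² lets each factor
      -- d combine with a floor: d (P div d) ≤ P and d (Q div d) ≤ Q.
      ≤⟨ +-mono-≤ (*-monoʳ-≤ (2 * D + 5) (∑-squares-telescope P Q D))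
           (*-monoʳ-≤ 3 (*-monoˡ-≤ t (+-monoʳ-≤ (4 * D * D + 16 * D) (n≤1+n 15)))) ⟩
    (2 * D + 5) * (4 * D * (P * Q)) + 3 * ((4 * D * D + 16 * D + 16) * t)
      ≡⟨ cong (λ k → (2 * D + 5) * (4 * D * (P * Q)) + 3 * k)
           (solve 3 (λ D p q → (con 4 :* D :* D :+ con 16 :* D :+ con 16) :* (p :* q)
              := con 4 :* (((con 2 :+ D) :* p) :* ((con 2 :+ D) :* q))) refl D (P div d) (Q div d)) ⟩
    (2 * D + 5) * (4 * D * (P * Q)) + 3 * (4 * ((d * (P div d)) * (d * (Q div d))))
      ≤⟨ +-monoʳ-≤ ((2 * D + 5) * (4 * D * (P * Q))) (*-monoʳ-≤ 3 (*-monoʳ-≤ 4 (*-mono-≤ (div-* P d) (div-* Q d)))) ⟩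
    (2 * D + 5) * (4 * D * (P * Q)) + 3 * (4 * (P * Q))
      ≡⟨ solve 2 (λ D z → (con 2 :* D :+ con 5) :* (con 4 :* D :* z) :+ con 3 :* (con 4 :* z)
           := (con 2 :* D :+ con 3) :* (con 4 :* (con 1 :+ D) :* z)) refl D (P * Q) ⟩
    (2 * D + 3) * (4 * suc D * (P * Q)) ∎)
    where
    open ≤-Reasoning
    g : ℕ → ℕ
    g d = P div suc d * (Q div suc d)
    d t : ℕ
    d = suc (suc D)
    t = P div d * (Q div d)

  -- Summing over all common divisors d ≥ 2, not only primes, is affordable: ζ(2) - 1 ≈ 0.645 is
  -- below 2/3. So at least a third of the pairs is coprime.
  ∑-squares-≤ : ∀ P Q D → 3 * ∑ D (λ d → P div suc d * (Q div suc d)) ≤ 2 * (P * Q)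
  ∑-squares-≤ P Q D = *-cancelˡ-≤ (2 * D + 3) {{ℕ.>-nonZero (≤-trans (s≤s z≤n) (m≤n+m 3 (2 * D)))}} (begin
    (2 * D + 3) * (3 * σ)              ≡⟨ solve 2 (λ k σ → k :* (con 3 :* σ) := con 3 :* k :* σ) refl (2 * D + 3) σ ⟩
    3 * (2 * D + 3) * σ                ≤⟨ ∑-squares-telescope P Q D ⟩
    4 * D * (P * Q)                    ≤⟨ m≤m+n _ (6 * (P * Q)) ⟩
    4 * D * (P * Q) + 6 * (P * Q)      ≡⟨ solve 2 (λ D z → con 4 :* D :* z :+ con 6 :* z := (con 2 :* D :+ con 3) :* (con 2 :* z)) refl D (P * Q) ⟩
    (2 * D + 3) * (2 * (P * Q))        ∎)
    where
    open ≤-Reasoning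
    σ : ℕ
    σ = ∑ D (λ d → P div suc d * (Q div suc d))

  -- Density of coprime pairs

  CoprimeAbove : ℕ → ℕ → ℕ × ℕ → Set
  CoprimeAbove A B (x , y) = A < x × B < y × Coprime x y

  coprimeAbove? : ∀ A B → Decidable (CoprimeAbove A B)
  coprimeAbove? A B (x , y) = (A <? x) ×-dec (B <? y) ×-dec coprime? x y

  pairs : ℕ → ℕ → List (ℕ × ℕ)
  pairs P Q = cartesianProduct [1⋯ P ] [1⋯ Q ]

  length-pairs : ∀ P Q → length (pairs P Q) ≡ P * Q
  length-pairs P Q = trans (length-cartesianProduct [1⋯ P ] [1⋯ Q ])
    (cong₂ _*_ (length-applyUpTo suc P) (length-applyUpTo suc Q))

  multiples : ℕ → ℕ → ℕ → List (ℕ × ℕ)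
  multiples P Q d = map (λ (k , l) → d * k , d * l) (pairs (P div d) (Q div d))

  coprimePairs : (A B P Q : ℕ) → List (ℕ × ℕ)
  coprimePairs A B P Q = filter (coprimeAbove? A B) (pairs P Q)

  multiple-∈ : ∀ {g P x} → 0 < g → 0 < x → x ≤ P → g ∣ x → ∃[ k ] (g * k ≡ x × k ∈ [1⋯ P div g ])
  multiple-∈ {g} {P} {x} 0<g 0<x x≤P (divides k x≡kg) = k , sym x≡gk ,
    ∈-[1⋯] (n≢0⇒n>0 λ { refl → <⇒≢ 0<x (sym x≡kg) }) (div-greatest 0<g (≤-trans (≤-reflexive (sym x≡gk)) x≤P))
    where
    x≡gk : x ≡ g * k
    x≡gk = trans x≡kg (*-comm k g)

  -- A union bound: a pair that fails has x ≤ A, or y ≤ B, or is a multiple of its gcd d ≥ 2. The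
  -- covering list may repeat pairs, which only weakens the estimate.
  coprimePairs-count : ∀ A B P Q → P * Q ≤
    length (coprimePairs A B P Q) + (A * Q + (P * B + ∑ P (λ d → P div suc d * (Q div suc d))))
  coprimePairs-count A B P Q = begin
    P * Q                          ≡⟨ sym (length-pairs P Q) ⟩
    length (pairs P Q)             ≤⟨ length-≤ _≡_ (Uniqueₚ.cartesianProduct⁺ ([1⋯]-unique P) ([1⋯]-unique Q)) cover (λ { refl refl → refl }) ⟩
    length (good ++ (pairs A Q ++ (pairs P B ++ bad)))
      ≡⟨ trans (length-++ good) (cong (length good +_) (trans (length-++ (pairs A Q)) (cong₂ _+_ (length-pairs A Q)
           (trans (length-++ (pairs P B)) (cong₂ _+_ (length-pairs P B) refl))))) ⟩
    length good + (A * Q + (P * B + length bad))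
      ≡⟨ cong (λ l → length good + (A * Q + (P * B + l))) (length-concatMap (λ d → multiples P Q (suc d)) [1⋯ P ]) ⟩
    length good + (A * Q + (P * B + ∑ P (λ d → length (multiples P Q (suc d)))))
      ≤⟨ +-monoʳ-≤ (length good) (+-monoʳ-≤ (A * Q) (+-monoʳ-≤ (P * B) (∑-mono P λ k → ≤-reflexive
           (trans (length-map _ (pairs (P div suc (suc k)) (Q div suc (suc k)))) (length-pairs (P div suc (suc k)) (Q div suc (suc k))))))) ⟩
    length good + (A * Q + (P * B + ∑ P (λ d → P div suc d * (Q div suc d)))) ∎
    where
    open ≤-Reasoning
    good bad : List (ℕ × ℕ)
    good = coprimePairs A B P Q
    -- `suc d` runs over 2, ..., P + 1, which excludes the divisor 1; the last value contributes
    -- nothing, as P div (P + 1) = 0.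
    bad = concatMap (λ d → multiples P Q (suc d)) [1⋯ P ]

    common : ∀ {x y} g → g ≡ gcd x y → ¬ (g ≡ 1) → 0 < x → x ≤ P → 0 < y → y ≤ Q → (x , y) ∈ bad
    common {x} {y} g g≡ g≢1 0<x x≤P 0<y y≤Q = split g g≢1 (subst (_∣ x) (sym g≡) (gcd[m,n]∣m x y)) (subst (_∣ y) (sym g≡) (gcd[m,n]∣n x y))
      where
      split : ∀ g → ¬ (g ≡ 1) → g ∣ x → g ∣ y → (x , y) ∈ bad
      split 0 _ 0∣x _ = ⊥-elim (<⇒≢ 0<x (sym (0∣⇒≡0 0∣x)))
      split 1 1≢1 _ _ = ⊥-elim (1≢1 refl)
      split g@(suc (suc d)) _ g∣x g∣y =
        let k , gk≡x , k∈ = multiple-∈ (s≤s z≤n) 0<x x≤P g∣x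
            l , gl≡y , l∈ = multiple-∈ (s≤s z≤n) 0<y y≤Q g∣y
        in ∈-concat⁺′ (subst₂ (λ x y → (x , y) ∈ multiples P Q g) gk≡x gl≡y
               (∈-map⁺ (λ (k , l) → g * k , g * l) (∈-cartesianProduct⁺ k∈ l∈)))
             (∈-map⁺ (λ d → multiples P Q (suc d))
               (∈-[1⋯] (s≤s z≤n) (≤-trans (n≤1+n (suc d)) (≤-trans (∣⇒≤ {{ℕ.>-nonZero 0<x}} g∣x) x≤P))))

    place : ∀ {x y} → x ∈ [1⋯ P ] → y ∈ [1⋯ Q ] → (x , y) ∈ good ++ (pairs A Q ++ (pairs P B ++ bad))
    place {x} {y} x∈ y∈ with A <? x | B <? y | gcd x y ≟ 1
    ... | no A≮x | _ | _ = ∈-++⁺ʳ good (∈-++⁺ˡ (∈-cartesianProduct⁺ (∈-[1⋯] (proj₁ ([1⋯]-∈ x∈)) (≮⇒≥ A≮x)) y∈))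
    ... | yes _ | no B≮y | _ = ∈-++⁺ʳ good (∈-++⁺ʳ (pairs A Q) (∈-++⁺ˡ
            (∈-cartesianProduct⁺ x∈ (∈-[1⋯] (proj₁ ([1⋯]-∈ y∈)) (≮⇒≥ B≮y)))))
    ... | yes A<x | yes B<y | yes gcd≡1 =
            ∈-++⁺ˡ (∈-filter⁺ (coprimeAbove? A B) (∈-cartesianProduct⁺ x∈ y∈) (A<x , B<y , gcd≡1⇒coprime gcd≡1))
    ... | yes _ | yes _ | no gcd≢1 = let 0<x , x≤P = [1⋯]-∈ x∈ ; 0<y , y≤Q = [1⋯]-∈ y∈ in
            ∈-++⁺ʳ good (∈-++⁺ʳ (pairs A Q) (∈-++⁺ʳ (pairs P B) (common (gcd x y) refl gcd≢1 0<x x≤P 0<y y≤Q)))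

    cover : ∀ {p} → p ∈ pairs P Q → ∃[ q ] (q ∈ good ++ (pairs A Q ++ (pairs P B ++ bad)) × p ≡ q)
    cover {x , y} p∈ = let x∈ , y∈ = ∈-cartesianProduct⁻ [1⋯ P ] [1⋯ Q ] p∈ in (x , y) , place x∈ y∈ , refl

  -- Of 64 A B pairs, 8 A B are lost to x ≤ A, 8 A B to y ≤ B and at most 2/3 of all to common
  -- divisors, which leaves 16/3 A B. For blocks of ratio q the balance is q²/3 - 2 q, and 8 is the
  -- least power of two that makes it positive.
  coprimePairs-dense : ∀ A B → A * B ≤ length (coprimePairs A B (8 * A) (8 * B))
  coprimePairs-dense A B = *-cancelˡ-≤ 3 (≤-trans
    (*-monoˡ-≤ (A * B) {3} {16} (s≤s (s≤s (s≤s z≤n))))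
    (+-cancelʳ-≤ (176 * (A * B)) (16 * (A * B)) (3 * g) (begin
      16 * (A * B) + 176 * (A * B)         ≡⟨ solve 2 (λ A B → con 16 :* (A :* B) :+ con 176 :* (A :* B) := con 3 :* (con 8 :* A :* (con 8 :* B))) refl A B ⟩
      3 * (8 * A * (8 * B))                ≤⟨ *-monoʳ-≤ 3 (coprimePairs-count A B (8 * A) (8 * B)) ⟩
      3 * (g + (A * (8 * B) + (8 * A * B + σ)))
        ≡⟨ solve 4 (λ A B g σ → con 3 :* (g :+ (A :* (con 8 :* B) :+ (con 8 :* A :* B :+ σ))) := con 3 :* g :+ con 48 :* (A :* B) :+ con 3 :* σ) refl A B g σ ⟩
      3 * g + 48 * (A * B) + 3 * σ         ≤⟨ +-monoʳ-≤ (3 * g + 48 * (A * B)) (∑-squares-≤ (8 * A) (8 * B) (8 * A)) ⟩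
      3 * g + 48 * (A * B) + 2 * (8 * A * (8 * B))
        ≡⟨ solve 3 (λ A B g → con 3 :* g :+ con 48 :* (A :* B) :+ con 2 :* (con 8 :* A :* (con 8 :* B)) := con 3 :* g :+ con 176 :* (A :* B)) refl A B g ⟩
      3 * g + 176 * (A * B)                ∎)))
    where
    open ≤-Reasoning
    g σ : ℕ
    g = length (coprimePairs A B (8 * A) (8 * B))
    σ = ∑ (8 * A) (λ d → 8 * A div suc d * (8 * B div suc d))

  -- Solutions from a coprime pair

  inverse-%-1 : ∀ {x y} w .{{_ : ℕ.NonZero x}} → (w * y) % x ≡ 1 → ∃[ a ] ∃[ X ] (a < x × a * y ≡ X * x + 1)
  inverse-%-1 {x} {y} w wy%x≡1 = w % x , (w % x * y) / x , m%n<n w x ,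
    trans (m≡m%n+[m/n]*n (w % x * y) x) (trans (cong (_+ (w % x * y) / x * x) ay%x≡1) (+-comm 1 _))
    where
    ay%x≡1 : (w % x * y) % x ≡ 1
    ay%x≡1 = trans (%-distribˡ-* (w % x) y x) (trans (cong (λ r → (r * (y % x)) % x) (m%n%n≡m%n w x))
      (trans (sym (%-distribˡ-* w y x)) wy%x≡1))

  inverse : ∀ {x y} → 1 < x → Coprime x y → ∃[ a ] ∃[ X ] (a < x × a * y ≡ X * x + 1)
  inverse {x@(suc x₁)} {y} 1<x c with coprime-Bézout c
  ... | Bézout.-+ u v 1+ux≡vy = inverse-%-1 v (trans (cong (_% x) (sym 1+ux≡vy))
          (trans ([m+kn]%n≡m%n 1 u x) (m<n⇒m%n≡m 1<x)))
  -- Here v y ≡ -1 modulo x, and `x₁` = x - 1 represents -1, so `v * x₁` is an inverse of y.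
  ... | Bézout.+- u v 1+vy≡ux = inverse-%-1 (v * x₁) (trans (sym ([m+n]%n≡m%n (v * x₁ * y) x))
          (trans (cong (_% x) shifted) (trans ([m+kn]%n≡m%n 1 (u * x₁) x) (m<n⇒m%n≡m 1<x))))
    where
    shifted : v * x₁ * y + x ≡ 1 + u * x₁ * x
    shifted = trans (solve 3 (λ v x₁ y → v :* x₁ :* y :+ (con 1 :+ x₁) := con 1 :+ (con 1 :+ v :* y) :* x₁) refl v x₁ y)
      (cong suc (trans (cong (_* x₁) 1+vy≡ux) (solve 3 (λ u x x₁ → u :* x :* x₁ := u :* x₁ :* x) refl u x x₁)))

  div-unique : ∀ {r d} q → r < d → (r + d * q) div d ≡ q
  div-unique {r} {d} q r<d = ≤-antisym
    (s≤s⁻¹ (*-cancelˡ-< d _ _ (begin-strict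
      d * ((r + d * q) div d)    ≤⟨ div-* (r + d * q) d ⟩
      r + d * q                  <⟨ +-monoˡ-< (d * q) r<d ⟩
      d + d * q                  ≡⟨ sym (*-suc d q) ⟩
      d * suc q                  ∎)))
    (div-greatest (≤-<-trans z≤n r<d) (m≤n+m (d * q) r))
    where
    open ≤-Reasoning

  -- The two factors are a y / x and b x / y, so x and y cancel in their product.
  configuration-solves : ∀ {X x Y y a b} → Configuration X x Y y a b → IsSolution (a * b) (X , x , Y , y)
  configuration-solves {X} {x} {Y} {y} {a} {b} C = 1≤X , 1≤Y , 1<x , x<y , sym (begin
    (ι X ℚ.+ ι x ⁻¹) ℚ.* (ι Y ℚ.+ ι y ⁻¹)
      ≡⟨ cong₂ ℚ._*_ (factor a y X 0<x ay≡) (factor b x Y 0<y bx≡) ⟩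
    ι a ℚ.* ι y ℚ.* ι x ⁻¹ ℚ.* (ι b ℚ.* ι x ℚ.* ι y ⁻¹)
      ≡⟨ ℚsolve 6 (λ a y i b x j → a ℚ:* y ℚ:* i ℚ:* (b ℚ:* x ℚ:* j) ℚ:= a ℚ:* b ℚ:* (x ℚ:* i) ℚ:* (y ℚ:* j)) refl (ι a) (ι y) (ι x ⁻¹) (ι b) (ι x) (ι y ⁻¹) ⟩
    ι a ℚ.* ι b ℚ.* (ι x ℚ.* ι x ⁻¹) ℚ.* (ι y ℚ.* ι y ⁻¹)
      ≡⟨ cong₂ (λ u v → ι a ℚ.* ι b ℚ.* u ℚ.* v) (p*p⁻¹≡1 (0<ι 0<x)) (p*p⁻¹≡1 (0<ι 0<y)) ⟩
    ι a ℚ.* ι b ℚ.* ℚ.1ℚ ℚ.* ℚ.1ℚ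
      ≡⟨ trans (ℚₚ.*-identityʳ _) (ℚₚ.*-identityʳ _) ⟩
    ι a ℚ.* ι b
      ≡⟨ sym (ι-* a b) ⟩
    ι (a * b) ∎)
    where
    open ≡-Reasoning
    open Configuration C
    open ℚ-Solver.+-*-Solver using () renaming (solve to ℚsolve; _:*_ to _ℚ:*_; _:+_ to _ℚ:+_; _:=_ to _ℚ:=_)
    factor : ∀ {z} c w Z → 0 < z → c * w ≡ Z * z + 1 → ι Z ℚ.+ ι z ⁻¹ ≡ ι c ℚ.* ι w ℚ.* ι z ⁻¹
    factor {z} c w Z 0<z cw≡ = sym (begin
      ι c ℚ.* ι w ℚ.* ι z ⁻¹                              ≡⟨ cong (ℚ._* ι z ⁻¹) (sym (ι-* c w)) ⟩
      ι (c * w) ℚ.* ι z ⁻¹                                ≡⟨ cong (λ k → ι k ℚ.* ι z ⁻¹) cw≡ ⟩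
      ι (Z * z + 1) ℚ.* ι z ⁻¹                            ≡⟨ cong (ℚ._* ι z ⁻¹) (trans (ι-+ (Z * z) 1) (cong (ℚ._+ ℚ.1ℚ) (ι-* Z z))) ⟩
      (ι Z ℚ.* ι z ℚ.+ ℚ.1ℚ) ℚ.* ι z ⁻¹                   ≡⟨ ℚₚ.*-distribʳ-+ (ι z ⁻¹) (ι Z ℚ.* ι z) ℚ.1ℚ ⟩
      ι Z ℚ.* ι z ℚ.* ι z ⁻¹ ℚ.+ ℚ.1ℚ ℚ.* ι z ⁻¹          ≡⟨ cong₂ ℚ._+_ (trans (ℚₚ.*-assoc (ι Z) (ι z) (ι z ⁻¹))
                                                               (trans (cong (ι Z ℚ.*_) (p*p⁻¹≡1 (0<ι 0<z))) (ℚₚ.*-identityʳ (ι Z)))) (ℚₚ.*-identityˡ (ι z ⁻¹)) ⟩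
      ι Z ℚ.+ ι z ⁻¹                                      ∎)

  -- `inverse` gives a₀ < x with a₀ y = X₀ x + 1, whence X₀ < y. Then b₀ = y - X₀ and Y₀ = x - a₀
  -- solve the other equation, because (y - X₀) x and (x - a₀) y + 1 both equal x y - X₀ x. Adding x
  -- i to a and y i to X, and y j to b and x j to Y, preserves both equations; since X₀ < y and Y₀ <
  -- x, the quotients of X and Y return i and j.
  coprime-configuration : ∀ {x y} → 1 < x → x < y → Coprime x y → ∀ i j →
    ∃[ a ] ∃[ b ] ∃[ X ] ∃[ Y ] (Configuration X x Y y a b ×
      a ≤ x * suc i × b ≤ y * suc j × X div y ≡ i × Y div x ≡ j)
  coprime-configuration {x} {y} 1<x x<y c i j with inverse 1<x c
  ... | a₀ , X₀ , a₀<x , a₀y≡ = a₀ + x * i , b₀ + y * j , X₀ + y * i , Y₀ + x * j ,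
    configuration 1≤X 1≤Y 1<x x<y ay≡ bx≡ ,
    ≤-trans (+-monoˡ-≤ (x * i) (<⇒≤ a₀<x)) (≤-reflexive (sym (*-suc x i))) ,
    ≤-trans (+-monoˡ-≤ (y * j) (m∸n≤m y X₀)) (≤-reflexive (sym (*-suc y j))) ,
    div-unique i X₀<y , div-unique j Y₀<x
    where
    open ≤-Reasoning
    0<x : 0 < x
    0<x = <-trans (s≤s z≤n) 1<x
    0<a₀ : 0 < a₀
    0<a₀ = n≢0⇒n>0 λ { refl → m+1+n≢0 (X₀ * x) (sym a₀y≡) }
    X₀<y : X₀ < y
    X₀<y = *-cancelʳ-< x X₀ y (begin
      suc (X₀ * x)    ≡⟨ +-comm 1 (X₀ * x) ⟩
      X₀ * x + 1      ≡⟨ sym a₀y≡ ⟩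
      a₀ * y          ≤⟨ *-monoˡ-≤ y (<⇒≤ a₀<x) ⟩
      x * y           ≡⟨ *-comm x y ⟩
      y * x           ∎)
    b₀ Y₀ : ℕ
    b₀ = y ∸ X₀
    Y₀ = x ∸ a₀
    b₀+X₀ : b₀ + X₀ ≡ y
    b₀+X₀ = m∸n+n≡m (<⇒≤ X₀<y)
    Y₀+a₀ : Y₀ + a₀ ≡ x
    Y₀+a₀ = m∸n+n≡m (<⇒≤ a₀<x)
    Y₀<x : Y₀ < x
    Y₀<x = subst (Y₀ <_) Y₀+a₀ (m<m+n Y₀ 0<a₀)
    b₀x≡ : b₀ * x ≡ Y₀ * y + 1
    b₀x≡ = +-cancelʳ-≡ (X₀ * x + a₀ * y) _ _ (begin-equality
      b₀ * x + (X₀ * x + a₀ * y)      ≡⟨ solve 4 (λ b x X s → b :* x :+ (X :* x :+ s) := (b :+ X) :* x :+ s) refl b₀ x X₀ (a₀ * y) ⟩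
      (b₀ + X₀) * x + a₀ * y          ≡⟨ cong₂ _+_ (cong (_* x) b₀+X₀) a₀y≡ ⟩
      y * x + (X₀ * x + 1)            ≡⟨ cong (λ k → y * k + (X₀ * x + 1)) (sym Y₀+a₀) ⟩
      y * (Y₀ + a₀) + (X₀ * x + 1)    ≡⟨ solve 4 (λ y Y a s → y :* (Y :+ a) :+ (s :+ con 1) := Y :* y :+ con 1 :+ (s :+ a :* y)) refl y Y₀ a₀ (X₀ * x) ⟩
      Y₀ * y + 1 + (X₀ * x + a₀ * y)  ∎)
    ay≡ : (a₀ + x * i) * y ≡ (X₀ + y * i) * x + 1
    ay≡ = begin-equality
      (a₀ + x * i) * y              ≡⟨ *-distribʳ-+ y a₀ (x * i) ⟩
      a₀ * y + x * i * y            ≡⟨ cong (_+ x * i * y) a₀y≡ ⟩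
      X₀ * x + 1 + x * i * y        ≡⟨ solve 4 (λ X x i y → X :* x :+ con 1 :+ x :* i :* y := (X :+ y :* i) :* x :+ con 1) refl X₀ x i y ⟩
      (X₀ + y * i) * x + 1          ∎
    bx≡ : (b₀ + y * j) * x ≡ (Y₀ + x * j) * y + 1
    bx≡ = begin-equality
      (b₀ + y * j) * x              ≡⟨ *-distribʳ-+ x b₀ (y * j) ⟩
      b₀ * x + y * j * x            ≡⟨ cong (_+ y * j * x) b₀x≡ ⟩
      Y₀ * y + 1 + y * j * x        ≡⟨ solve 4 (λ Y y j x → Y :* y :+ con 1 :+ y :* j :* x := (Y :+ x :* j) :* y :+ con 1) refl Y₀ y j x ⟩
      (Y₀ + x * j) * y + 1          ∎
    positive : ∀ {Z z w} c → 1 < w → c * w ≡ Z * z + 1 → 1 ≤ Z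
    positive {zero} {w = w} c 1<w cw≡1 = ⊥-elim (<⇒≢ 1<w (sym (m*n≡1⇒n≡1 c w cw≡1)))
    positive {suc Z} _ _ _ = s≤s z≤n
    1≤X : 1 ≤ X₀ + y * i
    1≤X = positive (a₀ + x * i) (<-trans 1<x x<y) ay≡
    1≤Y : 1 ≤ Y₀ + x * j
    1≤Y = positive (b₀ + y * j) 1<x bx≡

  -- Sampling solutions in blocks of powers of 8

  InBlock : ℕ → ℕ → Set
  InBlock s x = 8 ^ s < x × x ≤ 8 ^ suc s

  InBlock-≤ : ∀ {s t x} → InBlock s x → InBlock t x → s ≤ t
  InBlock-≤ {s} {t} (8^s<x , _) (_ , x≤8^1+t) = ≮⇒≥ λ t<s →
    <⇒≱ 8^s<x (≤-trans x≤8^1+t (^-monoʳ-≤ 8 t<s))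

  InBlock-unique : ∀ {s t x} → InBlock s x → InBlock t x → s ≡ t
  InBlock-unique {s} {t} x∈s x∈t = ≤-antisym (InBlock-≤ {s} {t} x∈s x∈t) (InBlock-≤ {t} {s} x∈t x∈s)

  module Samples (m : ℕ) where

    -- `E` is the largest value of s + (M + t) + u for s, t, u ≤ m, so the exponent `rest` left for
    -- j is a true difference and the four exponents always add up to `E`. The shift by `M` keeps
    -- every x-block below every y-block, which gives x < y.
    M E : ℕ
    M = suc m
    E = 4 * m + 1

    Tag Sample : Set
    Tag = ℕ × ℕ × ℕ
    Sample = (ℕ × ℕ) × (ℕ × ℕ)

    tags : List Tag
    tags = cartesianProduct (upTo M) (cartesianProduct (upTo M) (upTo M))

    rest : Tag → ℕ
    rest (s , t , u) = E ∸ (s + (M + t) + u)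

    -- i is confined to (8^u, 2 · 8^u], which has exactly 8^u elements and lies within block u. j
    -- ranges freely up to its bound, since the tag already fixes its exponent.
    block : Tag → List Sample
    block (s , t , u) = cartesianProduct
      (coprimePairs (8 ^ s) (8 ^ (M + t)) (8 ^ suc s) (8 ^ suc (M + t)))
      (cartesianProduct (map (8 ^ u +_) [1⋯ 8 ^ u ]) [1⋯ 8 ^ rest (s , t , u) ])

    samples : List (Tag × Sample)
    samples = tagged tags block

    ∈-tags⁻ : ∀ {s t u} → (s , t , u) ∈ tags → s ≤ m × t ≤ m × u ≤ m
    ∈-tags⁻ stu∈ with ∈-cartesianProduct⁻ (upTo M) (cartesianProduct (upTo M) (upTo M)) stu∈
    ... | s∈ , tu∈ with ∈-cartesianProduct⁻ (upTo M) (upTo M) tu∈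
    ... | t∈ , u∈ = s≤s⁻¹ (∈-upTo⁻ s∈) , s≤s⁻¹ (∈-upTo⁻ t∈) , s≤s⁻¹ (∈-upTo⁻ u∈)

    exponents : ∀ {s t u} → (s , t , u) ∈ tags → s + (M + t) + u + rest (s , t , u) ≡ E
    exponents {s} {t} {u} stu∈ with ∈-tags⁻ stu∈
    ... | s≤m , t≤m , u≤m = m+[n∸m]≡n (≤-trans
      (+-mono-≤ (+-mono-≤ s≤m (+-monoʳ-≤ M t≤m)) u≤m)
      (≤-reflexive (solve 1 (λ m → m :+ (con 1 :+ m :+ m) :+ m := con 4 :* m :+ con 1) refl m)))

    powers : ∀ {s t u} → (s , t , u) ∈ tags →
      8 ^ s * 8 ^ (M + t) * (8 ^ u * 8 ^ rest (s , t , u)) ≡ 8 ^ E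
    powers {s} {t} {u} stu∈ = begin
      8 ^ s * 8 ^ (M + t) * (8 ^ u * 8 ^ J)   ≡⟨ sym (*-assoc (8 ^ s * 8 ^ (M + t)) (8 ^ u) (8 ^ J)) ⟩
      8 ^ s * 8 ^ (M + t) * 8 ^ u * 8 ^ J     ≡⟨ cong (λ k → k * 8 ^ u * 8 ^ J) (sym (^-distribˡ-+-* 8 s (M + t))) ⟩
      8 ^ (s + (M + t)) * 8 ^ u * 8 ^ J       ≡⟨ cong (_* 8 ^ J) (sym (^-distribˡ-+-* 8 (s + (M + t)) u)) ⟩
      8 ^ (s + (M + t) + u) * 8 ^ J           ≡⟨ sym (^-distribˡ-+-* 8 (s + (M + t) + u) J) ⟩
      8 ^ (s + (M + t) + u + J)               ≡⟨ cong (8 ^_) (exponents stu∈) ⟩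
      8 ^ E                                   ∎
      where
      open ≡-Reasoning
      J : ℕ
      J = rest (s , t , u)

    block-large : ∀ {tag} → tag ∈ tags → 8 ^ E ≤ length (block tag)
    block-large {s , t , u} tag∈ = begin
      8 ^ E                                                 ≡⟨ sym (powers tag∈) ⟩
      8 ^ s * 8 ^ (M + t) * (8 ^ u * 8 ^ J)                 ≤⟨ *-monoˡ-≤ (8 ^ u * 8 ^ J) (coprimePairs-dense (8 ^ s) (8 ^ (M + t))) ⟩
      length ps * (8 ^ u * 8 ^ J)                           ≡⟨ cong (length ps *_) (sym (cong₂ _*_
                                                                 (trans (length-map (8 ^ u +_) [1⋯ 8 ^ u ]) (length-applyUpTo suc (8 ^ u)))
                                                                 (length-applyUpTo suc (8 ^ J)))) ⟩
      length ps * (length is * length [1⋯ 8 ^ J ])          ≡⟨ cong (length ps *_) (sym (length-cartesianProduct is [1⋯ 8 ^ J ])) ⟩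
      length ps * length (cartesianProduct is [1⋯ 8 ^ J ])  ≡⟨ sym (length-cartesianProduct ps (cartesianProduct is [1⋯ 8 ^ J ])) ⟩
      length (block (s , t , u))                            ∎
      where
      open ≤-Reasoning
      J : ℕ
      J = rest (s , t , u)
      ps : List (ℕ × ℕ)
      ps = coprimePairs (8 ^ s) (8 ^ (M + t)) (8 ^ suc s) (8 ^ suc (M + t))
      is : List ℕ
      is = map (8 ^ u +_) [1⋯ 8 ^ u ]

    samples-unique : Unique samples
    samples-unique = tagged-unique {xs = tags} {F = block}
      (Uniqueₚ.cartesianProduct⁺ (Uniqueₚ.upTo⁺ M) (Uniqueₚ.cartesianProduct⁺ (Uniqueₚ.upTo⁺ M) (Uniqueₚ.upTo⁺ M)))
      λ (s , t , u) → Uniqueₚ.cartesianProduct⁺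
        (Uniqueₚ.filter⁺ (coprimeAbove? (8 ^ s) (8 ^ (M + t)))
          (Uniqueₚ.cartesianProduct⁺ ([1⋯]-unique (8 ^ suc s)) ([1⋯]-unique (8 ^ suc (M + t)))))
        (Uniqueₚ.cartesianProduct⁺
          (Uniqueₚ.map⁺ (λ {i} {i′} → +-cancelˡ-≡ (8 ^ u) i i′) ([1⋯]-unique (8 ^ u)))
          ([1⋯]-unique (8 ^ rest (s , t , u))))

    samples-many : M * (M * M) * 8 ^ E ≤ length samples
    samples-many = begin
      M * (M * M) * 8 ^ E                                ≡⟨ cong (_* 8 ^ E) (sym size) ⟩
      length tags * 8 ^ E                                ≤⟨ sum-≥ (λ tag → length (block tag)) tags block-large ⟩
      _                                                  ≡⟨ sym (length-tagged tags block) ⟩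
      length samples                                     ∎
      where
      open ≤-Reasoning
      size : length tags ≡ M * (M * M)
      size = trans (length-cartesianProduct (upTo M) (cartesianProduct (upTo M) (upTo M)))
        (cong₂ _*_ (length-upTo M) (trans (length-cartesianProduct (upTo M) (upTo M)) (cong₂ _*_ (length-upTo M) (length-upTo M))))

    -- Distinct samples give distinct solutions: x and y are entries of the solution, i and j are
    -- read off as successors of quotients, and s, t, u are the indices of the blocks holding x, y,
    -- i.
    data Sampled : Tag × Sample → ℕ × Quadruple → Set where
      sampled : ∀ {s t u n X x Y y i j} → InBlock s x → InBlock (M + t) y → InBlock u i →
        i ≡ suc (X div y) → j ≡ suc (Y div x) →
        Sampled ((s , t , u) , (x , y) , (i , j)) (n , X , x , Y , y)

    Sampled-functional : ∀ {σ σ′ q} → Sampled σ q → Sampled σ′ q → σ ≡ σ′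
    Sampled-functional (sampled {s} {t} {u} x∈ y∈ i∈ refl refl) (sampled {s′} {t′} {u′} x∈′ y∈′ i∈′ refl refl)
      with InBlock-unique {s} {s′} x∈ x∈′ | +-cancelˡ-≡ M t t′ (InBlock-unique {M + t} {M + t′} y∈ y∈′) | InBlock-unique {u} {u′} i∈ i∈′
    ... | refl | refl | refl = refl

    Sampled-total : ∀ {N} → 8 ^ (3 + E) ≤ N → ∀ {σ} → σ ∈ samples → ∃[ q ] (q ∈ solutions≤ N × Sampled σ q)
    Sampled-total {N} 8^E≤N {(s , t , u) , (x , y) , (i , j)} σ∈ with ∈-tagged⁻ tags block σ∈
    ... | tag∈ , ∈block with ∈-cartesianProduct⁻
          (coprimePairs (8 ^ s) (8 ^ (M + t)) (8 ^ suc s) (8 ^ suc (M + t)))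
          (cartesianProduct (map (8 ^ u +_) [1⋯ 8 ^ u ]) [1⋯ 8 ^ rest (s , t , u) ]) ∈block
    ... | xy∈ , ij∈ with ∈-filter⁻ (coprimeAbove? (8 ^ s) (8 ^ (M + t))) {xs = pairs (8 ^ suc s) (8 ^ suc (M + t))} xy∈
                       | ∈-cartesianProduct⁻ (map (8 ^ u +_) [1⋯ 8 ^ u ]) [1⋯ 8 ^ rest (s , t , u) ] ij∈
    ... | xy∈′ , (s<x , t<y , coprime) | i∈ , j∈ with ∈-cartesianProduct⁻ [1⋯ 8 ^ suc s ] [1⋯ 8 ^ suc (M + t) ] xy∈′
                       | ∈-map⁻ (8 ^ u +_) i∈ | [1⋯]-∈ j∈
    ... | x∈ , y∈ | i′ , i′∈ , refl | 0<j , j≤ = construct {j = j} 0<j j≤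
      where
      0<i′ : 0 < i′
      0<i′ = proj₁ ([1⋯]-∈ i′∈)
      x-block : InBlock s x
      x-block = s<x , proj₂ ([1⋯]-∈ x∈)
      y-block : InBlock (M + t) y
      y-block = t<y , proj₂ ([1⋯]-∈ y∈)
      i-block : InBlock u (8 ^ u + i′)
      i-block = m<m+n (8 ^ u) 0<i′ , ≤-trans (+-monoʳ-≤ (8 ^ u) (proj₂ ([1⋯]-∈ i′∈)))
        (+-monoʳ-≤ (8 ^ u) (m≤m+n (8 ^ u) (6 * 8 ^ u)))
      1<x : 1 < x
      1<x = ≤-<-trans (m^n>0 8 s) s<x
      x<y : x < y
      x<y = ≤-<-trans (proj₂ x-block) (≤-<-trans (^-monoʳ-≤ 8 (s≤s (≤-trans (proj₁ (∈-tags⁻ tag∈)) (m≤m+n m t)))) t<y)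
      construct : ∀ {j} → 0 < j → j ≤ 8 ^ rest (s , t , u) →
        ∃[ q ] (q ∈ solutions≤ N × Sampled ((s , t , u) , (x , y) , (8 ^ u + i′ , j)) q)
      construct {suc j} _ j≤ = answer (coprime-configuration 1<x x<y coprime (ℕ.pred (8 ^ u + i′)) j)
        where
        J : ℕ
        J = rest (s , t , u)
        i≡ : suc (ℕ.pred (8 ^ u + i′)) ≡ 8 ^ u + i′
        i≡ = suc-pred (8 ^ u + i′) {{ℕ.>-nonZero (<-≤-trans 0<i′ (m≤n+m i′ (8 ^ u)))}}
        answer : ∃[ a ] ∃[ b ] ∃[ X ] ∃[ Y ] (Configuration X x Y y a b ×
            a ≤ x * suc (ℕ.pred (8 ^ u + i′)) × b ≤ y * suc j × X div y ≡ ℕ.pred (8 ^ u + i′) × Y div x ≡ j) →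
          ∃[ q ] (q ∈ solutions≤ N × Sampled ((s , t , u) , (x , y) , (8 ^ u + i′ , suc j)) q)
        answer (a , b , X , Y , C , a≤ , b≤ , X≡ , Y≡) =
          (a * b , X , x , Y , y) ,
          ∈-tagged⁺ {xs = [1⋯ N ]} {F = solutions} (∈-[1⋯] (*-mono-≤ (Configuration.0<a C) (Configuration.0<b C)) ab≤N)
            (∈-solutions⁺ {a * b} (configuration-solves C)) ,
          sampled x-block y-block i-block (trans (sym i≡) (cong suc (sym X≡))) (cong suc (sym Y≡))
          where
          open ≤-Reasoning
          ab≤N : a * b ≤ N
          ab≤N = begin
            a * b                                                ≤⟨ *-mono-≤ a≤ b≤ ⟩
            x * suc (ℕ.pred (8 ^ u + i′)) * (y * suc j)          ≡⟨ cong (λ i → x * i * (y * suc j)) i≡ ⟩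
            x * (8 ^ u + i′) * (y * suc j)                       ≤⟨ *-mono-≤ (*-mono-≤ (proj₂ x-block) (proj₂ i-block)) (*-mono-≤ (proj₂ y-block) j≤) ⟩
            8 ^ suc s * 8 ^ suc u * (8 ^ suc (M + t) * 8 ^ J)
              ≡⟨ solve 4 (λ A U B j → con 8 :* A :* (con 8 :* U) :* (con 8 :* B :* j) := con 8 :* (con 8 :* (con 8 :* (A :* B :* (U :* j))))) refl (8 ^ s) (8 ^ u) (8 ^ (M + t)) (8 ^ J) ⟩
            8 * (8 * (8 * (8 ^ s * 8 ^ (M + t) * (8 ^ u * 8 ^ J))))  ≡⟨ cong (λ k → 8 * (8 * (8 * k))) (powers tag∈) ⟩
            8 ^ (3 + E)                                          ≤⟨ 8^E≤N ⟩
            N                                                    ∎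

    ∑f-lower : ∀ {N} → 8 ^ (3 + E) ≤ N → M * (M * M) * 8 ^ E ≤ ∑ N f
    ∑f-lower {N} 8^E≤N = begin
      M * (M * M) * 8 ^ E     ≤⟨ samples-many ⟩
      length samples          ≤⟨ length-≤ Sampled samples-unique (Sampled-total 8^E≤N) Sampled-functional ⟩
      length (solutions≤ N)   ≡⟨ sym (∑f≡length N) ⟩
      ∑ N f                   ∎
      where
      open ≤-Reasoning

  -- Comparison of the count with N K³

  between-powers : ∀ N → 0 < N → ∃[ M ] (8 ^ (4 * M) ≤ N × N < 8 ^ (4 * suc M))
  between-powers (suc zero) _ = 0 , ≤-refl , s≤s (s≤s z≤n)
  between-powers (suc N@(suc _)) _ with between-powers N (s≤s z≤n)
  ... | M , lower , upper with suc N <? 8 ^ (4 * suc M)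
  ... | yes N+1< = M , m≤n⇒m≤1+n lower , N+1<
  ... | no  N+1≮ = suc M , ≮⇒≥ N+1≮ , ≤-<-trans upper (^-monoʳ-< 8 (s≤s (s≤s z≤n)) (*-monoʳ-< 4 (n<1+n (suc M))))

  ∑f-positive : ∀ {N} → 2 ≤ N → 1 ≤ ∑ N f
  ∑f-positive {N} 2≤N = subst (1 ≤_) (sym (∑f≡length N))
    (∈-length (∈-tagged⁺ {xs = [1⋯ N ]} {F = solutions} (∈-[1⋯] (s≤s z≤n) 2≤N)
      -- The solution 2 = (1 + 1/2) (1 + 1/3), with a = 1 and b = 2.
      (∈-solutions⁺ {2} (configuration-solves (configuration {1} {2} {1} {3} {1} {2}
        (s≤s z≤n) (s≤s z≤n) (s≤s (s≤s z≤n)) (s≤s (s≤s (s≤s z≤n))) refl refl)))))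

  ∑f-lower-K : ∀ {N} M → 2 ≤ N → 8 ^ (4 * M) ≤ N → N < 8 ^ (4 * suc M) →
    N * (suc M * (suc M * suc M)) ≤ 8 ^ 8 * ∑ N f
  ∑f-lower-K {N} zero 2≤N _ N<8⁴ = begin
    N * 1              ≡⟨ *-identityʳ N ⟩
    N                  ≤⟨ <⇒≤ N<8⁴ ⟩
    8 ^ 4              ≤⟨ ^-monoʳ-≤ 8 {4} {8} (s≤s (s≤s (s≤s (s≤s z≤n)))) ⟩
    8 ^ 8              ≡⟨ sym (*-identityʳ (8 ^ 8)) ⟩
    8 ^ 8 * 1          ≤⟨ *-monoʳ-≤ (8 ^ 8) (∑f-positive 2≤N) ⟩
    8 ^ 8 * ∑ N f      ∎
    where
    open ≤-Reasoning
  ∑f-lower-K {N} (suc m) 2≤N lower upper = begin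
    N * (K * (K * K))                           ≤⟨ *-mono-≤ (<⇒≤ upper) (*-mono-≤ K≤2M (*-mono-≤ K≤2M K≤2M)) ⟩
    8 ^ (4 * K) * (2 * M * (2 * M * (2 * M)))   ≡⟨ cong (_* (2 * M * (2 * M * (2 * M)))) (trans (cong (8 ^_) exponent) (^-distribˡ-+-* 8 7 E)) ⟩
    8 ^ 7 * 8 ^ E * (2 * M * (2 * M * (2 * M))) ≡⟨ solve 3 (λ c e M → c :* e :* (con 2 :* M :* (con 2 :* M :* (con 2 :* M))) := con 8 :* c :* (M :* (M :* M) :* e)) refl (8 ^ 7) (8 ^ E) M ⟩
    8 ^ 8 * (M * (M * M) * 8 ^ E)               ≤⟨ *-monoʳ-≤ (8 ^ 8) (∑f-lower (≤-trans (≤-reflexive (cong (8 ^_) lower-exponent)) lower)) ⟩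
    8 ^ 8 * ∑ N f                               ∎
    where
    open ≤-Reasoning
    open Samples m using (M; E; ∑f-lower)
    K : ℕ
    K = suc M
    K≤2M : K ≤ 2 * M
    K≤2M = subst (K ≤_) (solve 1 (λ m → (con 2 :+ m) :+ m := con 2 :* (con 1 :+ m)) refl m) (m≤m+n K m)
    exponent : 4 * K ≡ 7 + E
    exponent = solve 1 (λ m → con 4 :* (con 2 :+ m) := con 7 :+ (con 4 :* m :+ con 1)) refl m
    lower-exponent : 3 + E ≡ 4 * M
    lower-exponent = solve 1 (λ m → con 3 :+ (con 4 :* m :+ con 1) := con 4 :* (con 1 :+ m)) refl m

  8^≡2^ : ∀ k → 8 ^ k ≡ 2 ^ (3 * k)
  8^≡2^ k = ^-*-assoc 2 3 k

  -- 8^(4 K) = 2^(12 K), so the harmonic sums are taken with exponent 12 K, and 8640 = 5 · 12³.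
  ∑f-upper-K : ∀ {N} M → N < 8 ^ (4 * suc M) → ∑ N f ≤ 8640 * (N * (suc M * (suc M * suc M)))
  ∑f-upper-K {N} M N< = ≤-trans (∑f-upper {N} {3 * (4 * suc M)} (subst (N <_) (8^≡2^ (4 * suc M)) N<))
    (≤-reflexive (solve 2 (λ N K → con 5 :* (N :* ((con 3 :* (con 4 :* K)) :^ 3)) := con 8640 :* (N :* (K :* (K :* K)))) refl N (suc M)))

open NaturalNumbers

open import Data.Rational.Base using (ℚ; 0ℚ; 1ℚ; ½; nonNegative; _+_; _*_; _-_; -_; _≤_; _<_)
open ℚₚ
open ℚ-Solver.+-*-Solver

-- The logarithm

0≤ι : ∀ n → 0ℚ ≤ ι n
0≤ι zero    = ≤-refl
0≤ι (suc n) = <⇒≤ (0<ι {suc n} (s≤s z≤n))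

ι-mono : ∀ {m n} → m ℕ.≤ n → ι m ≤ ι n
ι-mono {m} {n} m≤n = subst₂ _≤_ (+-identityʳ (ι m))
  (trans (sym (ι-+ m (n ℕ.∸ m))) (cong ι (ℕₚ.m+[n∸m]≡n m≤n)))
  (+-monoʳ-≤ (ι m) (0≤ι (n ℕ.∸ m)))

ι-cancel-< : ∀ {m n} → ι m < ι n → m ℕ.< n
ι-cancel-< ιm<ιn = ℕₚ.≰⇒> λ n≤m → <-irrefl refl (<-≤-trans ιm<ιn (ι-mono n≤m))

0≤½* : ∀ {w} → 0ℚ ≤ w → 0ℚ ≤ ½ * w
0≤½* = 0≤* (nonNegative⁻¹ ½)

≤+ʳ : ∀ p {q} → 0ℚ ≤ q → p ≤ p + q
≤+ʳ p 0≤q = subst (_≤ p + _) (+-identityʳ p) (+-monoʳ-≤ p 0≤q)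

riemann-≤-left : ∀ n {a w} → 0ℚ < a → 0ℚ ≤ w → riemann a w n ≤ w * a ⁻¹
riemann-≤-left zero _ _ = ≤-refl
riemann-≤-left (suc n) {a} {w} 0<a 0≤w = begin
  riemann a h n + riemann (a + h) h n   ≤⟨ +-mono-≤ (riemann-≤-left n 0<a 0≤h) (riemann-≤-left n (<-≤-trans 0<a a≤a+h) 0≤h) ⟩
  h * a ⁻¹ + h * (a + h) ⁻¹             ≤⟨ +-monoʳ-≤ (h * a ⁻¹) (*-monoˡ-≤-nonNeg h {{nonNegative 0≤h}} (⁻¹-anti 0<a a≤a+h)) ⟩
  h * a ⁻¹ + h * a ⁻¹                   ≡⟨ solve 2 (λ w i → (con ½ :* w) :* i :+ (con ½ :* w) :* i := w :* i) refl w (a ⁻¹) ⟩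
  w * a ⁻¹                              ∎
  where
  open ≤-Reasoning
  h : ℚ
  h = ½ * w
  0≤h : 0ℚ ≤ h
  0≤h = 0≤½* 0≤w
  a≤a+h : a ≤ a + h
  a≤a+h = ≤+ʳ a 0≤h

*⁻¹-≤ : ∀ {p q c} → 0ℚ < q → p ≤ c * q → p * q ⁻¹ ≤ c
*⁻¹-≤ {p} {q} {c} 0<q p≤cq = begin
  p * q ⁻¹          ≤⟨ *-monoʳ-≤-nonNeg (q ⁻¹) {{nonNegative (<⇒≤ (0<p⁻¹ 0<q))}} p≤cq ⟩
  c * q * q ⁻¹      ≡⟨ *-assoc c q (q ⁻¹) ⟩
  c * (q * q ⁻¹)    ≡⟨ cong (c *_) (p*p⁻¹≡1 0<q) ⟩
  c * 1ℚ            ≡⟨ *-identityʳ c ⟩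
  c                 ∎
  where
  open ≤-Reasoning

≤-*⁻¹ : ∀ {p q c} → 0ℚ < q → q ≤ c * p → 1ℚ ≤ c * (p * q ⁻¹)
≤-*⁻¹ {p} {q} {c} 0<q q≤cp = begin
  1ℚ                ≡⟨ sym (p*p⁻¹≡1 0<q) ⟩
  q * q ⁻¹          ≤⟨ *-monoʳ-≤-nonNeg (q ⁻¹) {{nonNegative (<⇒≤ (0<p⁻¹ 0<q))}} q≤cp ⟩
  c * p * q ⁻¹      ≡⟨ *-assoc c p (q ⁻¹) ⟩
  c * (p * q ⁻¹)    ∎
  where
  open ≤-Reasoning

2*½* : ∀ w → ι 2 * (½ * w) ≡ w
2*½* = solve 1 (λ w → con (ι 2) :* (con ½ :* w) := w) refl

-- Each halving of the interval [1, 1 + w] splits off [1 + w/2, 1 + w], over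
-- which 1/t integrates to at most 1, and to at least 1/4 when w ≥ 1.
riemann-log-upper : ∀ m n {w} → 0ℚ ≤ w → w ≤ ι (2 ℕ.^ m) → riemann 1ℚ w (m ℕ.+ n) ≤ ι (suc m)
riemann-log-upper zero n {w} 0≤w w≤1 = ≤-trans (riemann-≤-left n (positive⁻¹ 1ℚ) 0≤w)
  (*⁻¹-≤ {w} {1ℚ} {1ℚ} (positive⁻¹ 1ℚ) w≤1)
riemann-log-upper (suc m) n {w} 0≤w w≤2^1+m = begin
  riemann 1ℚ h (m ℕ.+ n) + riemann (1ℚ + h) h (m ℕ.+ n)
    ≤⟨ +-mono-≤ (riemann-log-upper m n 0≤h h≤2^m)
         (≤-trans (riemann-≤-left (m ℕ.+ n) 0<1+h 0≤h) (*⁻¹-≤ {h} {1ℚ + h} {1ℚ} 0<1+h h≤1+h)) ⟩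
  ι (suc m) + 1ℚ        ≡⟨ trans (+-comm (ι (suc m)) 1ℚ) (sym (ι-+ 1 (suc m))) ⟩
  ι (suc (suc m))       ∎
  where
  open ≤-Reasoning
  h : ℚ
  h = ½ * w
  0≤h : 0ℚ ≤ h
  0≤h = 0≤½* 0≤w
  0<1+h : 0ℚ < 1ℚ + h
  0<1+h = +-mono-<-≤ (positive⁻¹ 1ℚ) 0≤h
  h≤1+h : h ≤ 1ℚ * (1ℚ + h)
  h≤1+h = subst (h ≤_) (trans (+-comm h 1ℚ) (sym (*-identityˡ (1ℚ + h)))) (≤+ʳ h (nonNegative⁻¹ 1ℚ))
  h≤2^m : h ≤ ι (2 ℕ.^ m)
  h≤2^m = begin
    ½ * w                       ≤⟨ *-monoˡ-≤-nonNeg ½ w≤2^1+m ⟩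
    ½ * ι (2 ℕ.^ suc m)         ≡⟨ cong (½ *_) (ι-* 2 (2 ℕ.^ m)) ⟩
    ½ * (ι 2 * ι (2 ℕ.^ m))     ≡⟨ solve 1 (λ z → con ½ :* (con (ι 2) :* z) := z) refl (ι (2 ℕ.^ m)) ⟩
    ι (2 ℕ.^ m)                 ∎

-- Comparing 2^m with 2 w instead of w admits w = 1/2 at m = 0, which is all that late
-- approximations of T ≥ 2 guarantee; there w / (1 + w) ≥ 1/3.
riemann-log-lower : ∀ m n {w} → 0ℚ ≤ w → ι (2 ℕ.^ m) ≤ ι 2 * w → ι (suc m) ≤ ι 4 * riemann 1ℚ w (m ℕ.+ n)
riemann-log-lower zero n {w} 0≤w 1≤2w = ≤-trans (≤-*⁻¹ {w} {1ℚ + w} {ι 4} 0<1+w 1+w≤4w)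
  (*-monoˡ-≤-nonNeg (ι 4) (riemann-lower n (positive⁻¹ 1ℚ) 0≤w ≤-refl))
  where
  open ≤-Reasoning
  0<1+w : 0ℚ < 1ℚ + w
  0<1+w = +-mono-<-≤ (positive⁻¹ 1ℚ) 0≤w
  1+w≤4w : 1ℚ + w ≤ ι 4 * w
  1+w≤4w = begin
    1ℚ + w                 ≤⟨ +-monoˡ-≤ w 1≤2w ⟩
    ι 2 * w + w            ≤⟨ ≤+ʳ (ι 2 * w + w) 0≤w ⟩
    ι 2 * w + w + w        ≡⟨ solve 1 (λ w → con (ι 2) :* w :+ w :+ w := con (ι 4) :* w) refl w ⟩
    ι 4 * w                ∎
riemann-log-lower (suc m) n {w} 0≤w 2^1+m≤2w = begin
  ι (suc (suc m))        ≡⟨ trans (ι-+ 1 (suc m)) (+-comm 1ℚ (ι (suc m))) ⟩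
  ι (suc m) + 1ℚ         ≤⟨ +-mono-≤ (riemann-log-lower m n 0≤h (subst (ι (2 ℕ.^ m) ≤_) (sym (2*½* w)) 2^m≤w))
                              (≤-trans (≤-*⁻¹ {h} {1ℚ + w} {ι 4} 0<1+w 1+w≤4h)
                                (*-monoˡ-≤-nonNeg (ι 4) (riemann-lower (m ℕ.+ n) 0<1+h 0≤h 1+h+h≤1+w))) ⟩
  ι 4 * A + ι 4 * B      ≡⟨ sym (*-distribˡ-+ (ι 4) A B) ⟩
  ι 4 * (A + B)          ∎
  where
  open ≤-Reasoning
  h A B : ℚ
  h = ½ * w
  A = riemann 1ℚ h (m ℕ.+ n)
  B = riemann (1ℚ + h) h (m ℕ.+ n)
  0≤h : 0ℚ ≤ h
  0≤h = 0≤½* 0≤w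
  0<1+h : 0ℚ < 1ℚ + h
  0<1+h = +-mono-<-≤ (positive⁻¹ 1ℚ) 0≤h
  0<1+w : 0ℚ < 1ℚ + w
  0<1+w = +-mono-<-≤ (positive⁻¹ 1ℚ) 0≤w
  1+h+h≤1+w : 1ℚ + h + h ≤ 1ℚ + w
  1+h+h≤1+w = ≤-reflexive (two-halves 1ℚ w)
  2^m≤w : ι (2 ℕ.^ m) ≤ w
  2^m≤w = *-cancelˡ-≤-pos (ι 2) (subst (_≤ ι 2 * w) (ι-* 2 (2 ℕ.^ m)) 2^1+m≤2w)
  1+w≤4h : 1ℚ + w ≤ ι 4 * h
  1+w≤4h = begin
    1ℚ + w               ≤⟨ +-monoˡ-≤ w (≤-trans (ι-mono (ℕₚ.m^n>0 2 m)) 2^m≤w) ⟩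
    w + w                ≡⟨ solve 1 (λ w → w :+ w := con (ι 4) :* (con ½ :* w)) refl w ⟩
    ι 4 * h              ∎

-- Approximations of T and of T log³ T

2≤N : ∀ {T N} → fromℕ 2 ≤ℝ T → T <ℝ fromℕ (suc N) → 2 ℕ.≤ N
-- T ≥ 2 holds up to any error and T < N + 1 with the margin ε; the error ε/2 still leaves 2 < N +
-- 1.
2≤N {T} {N} 2≤T (ε , 0<ε , n₁ , T+ε≤) with 2≤T (½ * ε) (0<* (positive⁻¹ ½) 0<ε)
... | n₂ , 2≤T+½ε = ℕ.s≤s⁻¹ (ι-cancel-< (begin-strict
  ι 2                       ≤⟨ 2≤T+½ε n (ℕₚ.m≤n⊔m n₁ n₂) ⟩
  seq T n + ½ * ε           <⟨ +-monoʳ-< (seq T n) (subst (½ * ε <_) (*-identityˡ ε) (*-monoˡ-<-pos ε {{ℚ.positive 0<ε}} {½} {1ℚ} ½<1)) ⟩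
  seq T n + ε               ≤⟨ T+ε≤ n (ℕₚ.m≤m⊔n n₁ n₂) ⟩
  ι (suc N)                 ∎))
  where
  open ≤-Reasoning
  n : ℕ
  n = n₁ ℕ.⊔ n₂
  ½<1 : ½ < 1ℚ
  ½<1 = ℚ.*<* (ℤ.+<+ (s≤s (s≤s z≤n)))

-- A term of the sequence of T log³ T, for p and l the terms of T and log T; the trailing `1ℚ` is
-- the zeroth power.
denominator : ℚ → ℚ → ℚ
denominator p l = p * (l * (l * (l * 1ℚ)))

scale : ℕ → ℕ → ℕ
scale N K = N ℕ.* (K ℕ.* (K ℕ.* K))

ι-scale : ∀ N K → ι (scale N K) ≡ ι N * (ι K * (ι K * ι K))
ι-scale N K = trans (ι-* N (K ℕ.* (K ℕ.* K))) (cong (ι N *_) (trans (ι-* K (K ℕ.* K)) (cong (ι K *_) (ι-* K K))))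

-- 4394 = 2 · 13³.
denominator-upper : ∀ {p l} N K → 0ℚ ≤ p → 0ℚ ≤ l → p ≤ ι 2 * ι N → l ≤ ι 13 * ι K →
  denominator p l ≤ ι 4394 * ι (scale N K)
denominator-upper {p} {l} N K 0≤p 0≤l p≤ l≤ = begin
  p * (l * (l * (l * 1ℚ)))                ≤⟨ *-mono 0≤p 0≤kkk p≤ (*-mono 0≤l (0≤* 0≤k (0≤* 0≤k 0≤1)) l≤ (*-mono 0≤l (0≤* 0≤k 0≤1) l≤ (*-mono 0≤l 0≤1 l≤ ≤-refl))) ⟩
  ι 2 * ι N * (k * (k * (k * 1ℚ)))        ≡⟨ solve 2 (λ N K → let k = con (ι 13) :* K in con (ι 2) :* N :* (k :* (k :* (k :* con 1ℚ))) := con (ι 4394) :* (N :* (K :* (K :* K)))) refl (ι N) (ι K) ⟩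
  ι 4394 * (ι N * (ι K * (ι K * ι K)))    ≡⟨ cong (ι 4394 *_) (sym (ι-scale N K)) ⟩
  ι 4394 * ι (scale N K)                  ∎
  where
  open ≤-Reasoning
  k : ℚ
  k = ι 13 * ι K
  0≤1 : 0ℚ ≤ 1ℚ
  0≤1 = nonNegative⁻¹ 1ℚ
  0≤k : 0ℚ ≤ k
  0≤k = 0≤* (0≤ι 13) (0≤ι K)
  0≤kkk : 0ℚ ≤ k * (k * (k * 1ℚ))
  0≤kkk = 0≤* 0≤k (0≤* 0≤k (0≤* 0≤k 0≤1))

-- 128 = 2 · 4³.
denominator-lower : ∀ {p l} N K → 0ℚ ≤ p → 0ℚ ≤ l → ι N ≤ ι 2 * p → ι K ≤ ι 4 * l →
  ι (scale N K) ≤ ι 128 * denominator p l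
denominator-lower {p} {l} N K 0≤p 0≤l N≤ K≤ = begin
  ι (scale N K)                                        ≡⟨ ι-scale N K ⟩
  ι N * (ι K * (ι K * ι K))                            ≤⟨ *-mono (0≤ι N) (0≤* 0≤k (0≤* 0≤k 0≤k)) N≤ (*-mono (0≤ι K) (0≤* 0≤k 0≤k) K≤ (*-mono (0≤ι K) 0≤k K≤ K≤)) ⟩
  ι 2 * p * (k * (k * k))                              ≡⟨ solve 2 (λ p l → let k = con (ι 4) :* l in con (ι 2) :* p :* (k :* (k :* k)) := con (ι 128) :* (p :* (l :* (l :* (l :* con 1ℚ))))) refl p l ⟩
  ι 128 * denominator p l                              ∎
  where
  open ≤-Reasoning
  k : ℚ
  k = ι 4 * l
  0≤k : 0ℚ ≤ k
  0≤k = 0≤* (0≤ι 4) 0≤l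

module Approximations {T : ℝ} (2≤T : fromℕ 2 ≤ℝ T) {N M : ℕ} (N≤T : fromℕ N ≤ℝ T) (T<N+1 : T <ℝ fromℕ (suc N))
  (lower : 8 ℕ.^ (4 ℕ.* M) ℕ.≤ N) (upper : N ℕ.< 8 ℕ.^ (4 ℕ.* suc M)) where

  open ≤-Reasoning

  K : ℕ
  K = suc M

  above-3/2 : ∃[ n ] (∀ k → n ℕ.≤ k → 3/2 ≤ seq T k)
  above-3/2 = 2≤⇒eventually-3/2≤ {T} 2≤T

  above-N : ∃[ n ] (∀ k → n ℕ.≤ k → ι N ≤ seq T k + ½)
  above-N = N≤T ½ (positive⁻¹ ½)

  -- Besides the indices from which the inequalities for T hold, n has to reach 12 K: the estimates
  -- of the logarithm halve the interval up to 12 K times, and each halving uses up one level of the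
  -- Riemann sum.
  onset : ℕ
  onset = (proj₁ above-3/2 ℕ.⊔ proj₁ above-N) ℕ.⊔ (proj₁ (proj₂ (proj₂ T<N+1)) ℕ.⊔ 3 ℕ.* (4 ℕ.* K))

  module _ n (onset≤n : onset ℕ.≤ n) where

    n₁ n₂ n₃ n₄ : ℕ
    n₁ = proj₁ above-3/2
    n₂ = proj₁ above-N
    n₃ = proj₁ (proj₂ (proj₂ T<N+1))
    n₄ = 3 ℕ.* (4 ℕ.* K)

    left≤ : n₁ ℕ.⊔ n₂ ℕ.≤ n
    left≤ = ℕₚ.m⊔n≤o⇒m≤o (n₁ ℕ.⊔ n₂) (n₃ ℕ.⊔ n₄) onset≤n
    right≤ : n₃ ℕ.⊔ n₄ ℕ.≤ n
    right≤ = ℕₚ.m⊔n≤o⇒n≤o (n₁ ℕ.⊔ n₂) (n₃ ℕ.⊔ n₄) onset≤n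

    p l w : ℚ
    p = seq T n
    l = logSeq T n
    w = p - 1ℚ

    3/2≤p : 3/2 ≤ p
    3/2≤p = proj₂ above-3/2 n (ℕₚ.m⊔n≤o⇒m≤o n₁ n₂ left≤)
    N≤p+½ : ι N ≤ p + ½
    N≤p+½ = proj₂ above-N n (ℕₚ.m⊔n≤o⇒n≤o n₁ n₂ left≤)
    p≤N+1 : p ≤ ι (suc N)
    p≤N+1 = ≤-trans (≤+ʳ p (<⇒≤ (proj₁ (proj₂ T<N+1)))) (proj₂ (proj₂ (proj₂ T<N+1)) n (ℕₚ.m⊔n≤o⇒m≤o n₃ n₄ right≤))
    n₄≤n : 3 ℕ.* (4 ℕ.* K) ℕ.≤ n
    n₄≤n = ℕₚ.m⊔n≤o⇒n≤o n₃ n₄ right≤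

    0<p : 0ℚ < p
    0<p = <-≤-trans (positive⁻¹ 3/2) 3/2≤p
    0<l : 0ℚ < l
    0<l = <-≤-trans (positive⁻¹ (1ℚ - 3/2 ⁻¹)) (log-lower n 3/2≤p)
    0≤w : 0ℚ ≤ w
    0≤w = ≤-trans (nonNegative⁻¹ (3/2 - 1ℚ)) (+-monoˡ-≤ (- 1ℚ) 3/2≤p)

    p≤2N : p ≤ ι 2 * ι N
    p≤2N = begin
      p              ≤⟨ p≤N+1 ⟩
      ι (suc N)      ≤⟨ ι-mono (ℕₚ.+-mono-≤ (ℕₚ.≤-trans (s≤s z≤n) (2≤N {T} {N} 2≤T T<N+1)) (ℕₚ.m≤m+n N 0)) ⟩
      ι (2 ℕ.* N)    ≡⟨ ι-* 2 N ⟩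
      ι 2 * ι N      ∎

    N≤2p : ι N ≤ ι 2 * p
    N≤2p = begin
      ι N            ≤⟨ N≤p+½ ⟩
      p + ½          ≤⟨ +-monoʳ-≤ p (≤-trans (≤ᵇ⇒≤ {½} {3/2} _) 3/2≤p) ⟩
      p + p          ≡⟨ solve 1 (λ p → p :+ p := con (ι 2) :* p) refl p ⟩
      ι 2 * p        ∎

    l≤13K : l ≤ ι 13 * ι K
    l≤13K = begin
      l                                     ≡⟨ cong (riemann 1ℚ w) (sym (ℕₚ.m+[n∸m]≡n n₄≤n)) ⟩
      riemann 1ℚ w (n₄ ℕ.+ (n ℕ.∸ n₄))      ≤⟨ riemann-log-upper n₄ (n ℕ.∸ n₄) 0≤w w≤ ⟩
      -- `suc n₄` is 12 K + 1, at most 13 K.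
      ι (suc n₄)                            ≤⟨ ι-mono (ℕₚ.≤-trans (ℕₚ.+-monoˡ-≤ n₄ (s≤s z≤n)) (ℕₚ.≤-reflexive K+12K≡13K)) ⟩
      ι (13 ℕ.* K)                          ≡⟨ ι-* 13 K ⟩
      ι 13 * ι K                            ∎
      where
      K+12K≡13K : K ℕ.+ n₄ ≡ 13 ℕ.* K
      K+12K≡13K = cong (K ℕ.+_) (sym (ℕₚ.*-assoc 3 4 K))
      w≤ : w ≤ ι (2 ℕ.^ n₄)
      w≤ = begin
        p - 1ℚ              ≤⟨ +-monoˡ-≤ (- 1ℚ) p≤N+1 ⟩
        ι (suc N) - 1ℚ      ≡⟨ trans (cong (_- 1ℚ) (ι-+ 1 N)) (solve 1 (λ N → con 1ℚ :+ N :- con 1ℚ := N) refl (ι N)) ⟩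
        ι N                 ≤⟨ ι-mono (ℕₚ.<⇒≤ (subst (N ℕ.<_) (8^≡2^ (4 ℕ.* K)) upper)) ⟩
        ι (2 ℕ.^ n₄)        ∎

    K≤4l : ι K ≤ ι 4 * l
    K≤4l = begin
      ι K                                         ≤⟨ ι-mono (s≤s (ℕₚ.≤-trans (ℕₚ.m≤n*m M 4) (ℕₚ.m≤n*m (4 ℕ.* M) 3))) ⟩
      ι (suc m)                                   ≤⟨ riemann-log-lower m (n ℕ.∸ m) 0≤w 2^m≤2w ⟩
      ι 4 * riemann 1ℚ w (m ℕ.+ (n ℕ.∸ m))        ≡⟨ cong (λ k → ι 4 * riemann 1ℚ w k) (ℕₚ.m+[n∸m]≡n m≤n) ⟩
      ι 4 * l                                     ∎
      where
      m : ℕ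
      m = 3 ℕ.* (4 ℕ.* M)
      m≤n : m ℕ.≤ n
      m≤n = ℕₚ.≤-trans (ℕₚ.*-monoʳ-≤ 3 (ℕₚ.*-monoʳ-≤ 4 (ℕₚ.n≤1+n M))) n₄≤n
      -- The 3 pays for passing from N to w: N ≤ p + 1/2 and w = p - 1 differ by 3/2, which is
      -- doubled. At M = 0 the claim is 1 + 3 ≤ 2 N, for which N ≥ 2 is just enough.
      2^m+3≤2N : 2 ℕ.^ m ℕ.+ 3 ℕ.≤ 2 ℕ.* N
      2^m+3≤2N = split M lower
        where
        split : ∀ M → 8 ℕ.^ (4 ℕ.* M) ℕ.≤ N → 2 ℕ.^ (3 ℕ.* (4 ℕ.* M)) ℕ.+ 3 ℕ.≤ 2 ℕ.* N
        split zero    _      = ℕₚ.*-monoʳ-≤ 2 (2≤N {T} {N} 2≤T T<N+1)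
        split (suc M) 8⁴ᴹ≤N = ℕₚ.+-mono-≤ 2^m≤N (ℕₚ.≤-trans 3≤N (ℕₚ.m≤m+n N 0))
          where
          2^m≤N : 2 ℕ.^ (3 ℕ.* (4 ℕ.* suc M)) ℕ.≤ N
          2^m≤N = subst (ℕ._≤ N) (8^≡2^ (4 ℕ.* suc M)) 8⁴ᴹ≤N
          3≤N : 3 ℕ.≤ N
          3≤N = ℕₚ.≤-trans (ℕₚ.≤-trans (s≤s (s≤s (s≤s z≤n))) (ℕₚ.^-monoʳ-≤ 8 (ℕₚ.*-monoʳ-≤ 4 (s≤s (z≤n {M}))))) 8⁴ᴹ≤N
      2^m≤2w : ι (2 ℕ.^ m) ≤ ι 2 * w
      2^m≤2w = begin
        ι (2 ℕ.^ m)                       ≡⟨ solve 2 (λ u v → u := u :+ v :- v) refl (ι (2 ℕ.^ m)) (ι 3) ⟩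
        ι (2 ℕ.^ m) + ι 3 - ι 3           ≡⟨ cong (_- ι 3) (sym (ι-+ (2 ℕ.^ m) 3)) ⟩
        ι (2 ℕ.^ m ℕ.+ 3) - ι 3           ≤⟨ +-monoˡ-≤ (- ι 3) (ι-mono 2^m+3≤2N) ⟩
        ι (2 ℕ.* N) - ι 3                 ≡⟨ cong (_- ι 3) (ι-* 2 N) ⟩
        ι 2 * ι N - ι 3                   ≤⟨ +-monoˡ-≤ (- ι 3) (*-monoˡ-≤-nonNeg (ι 2) N≤p+½) ⟩
        ι 2 * (p + ½) - ι 3               ≡⟨ solve 1 (λ p → con (ι 2) :* (p :+ con ½) :- con (ι 3) := con (ι 2) :* (p :- con 1ℚ)) refl p ⟩
        ι 2 * w                           ∎

-- The bounds for the ratio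

α-bound : ∀ {D} a {x s} → D ≤ ι 4394 * ι x → x ℕ.≤ a ℕ.* s → D ≤ ι 4394 * ι a * ι s
α-bound {D} a {x} {s} D≤ x≤ = begin
  D                        ≤⟨ D≤ ⟩
  ι 4394 * ι x             ≤⟨ *-monoˡ-≤-nonNeg (ι 4394) (ι-mono {x} {a ℕ.* s} x≤) ⟩
  ι 4394 * ι (a ℕ.* s)     ≡⟨ cong (ι 4394 *_) (ι-* a s) ⟩
  ι 4394 * (ι a * ι s)     ≡⟨ sym (*-assoc (ι 4394) (ι a) (ι s)) ⟩
  ι 4394 * ι a * ι s       ∎
  where
  open ≤-Reasoning

β-bound : ∀ {D} b {x s} → ι x ≤ ι 128 * D → s ℕ.≤ b ℕ.* x → ι s ≤ ι b * ι 128 * D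
β-bound {D} b {x} {s} x≤ s≤ = begin
  ι s                      ≤⟨ ι-mono {s} {b ℕ.* x} s≤ ⟩
  ι (b ℕ.* x)              ≡⟨ ι-* b x ⟩
  ι b * ι x                ≤⟨ *-monoˡ-≤-nonNeg (ι b) {{nonNegative (0≤ι b)}} x≤ ⟩
  ι b * (ι 128 * D)        ≡⟨ sym (*-assoc (ι b) (ι 128) D) ⟩
  ι b * ι 128 * D          ∎
  where
  open ≤-Reasoning

-- Kept abstract because the numerals would otherwise be computed with.
abstract
  α β : ℚ
  α = ι 4394 * ι (8 ℕ.^ 8)
  β = ι 8640 * ι 128

  0<α : 0ℚ < α
  0<α = 0<* (0<ι {4394} (s≤s z≤n)) (0<ι {8 ℕ.^ 8} (ℕₚ.m^n>0 8 8))

  0≤β : 0ℚ ≤ β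
  0≤β = 0≤* (0≤ι 8640) (0≤ι 128)

  D≤αS : ∀ {D} x s → D ≤ ι 4394 * ι x → x ℕ.≤ 8 ℕ.^ 8 ℕ.* s → D ≤ α * ι s
  D≤αS {D} x s = α-bound {D} (8 ℕ.^ 8) {x} {s}

  S≤βD : ∀ {D} x s → ι x ≤ ι 128 * D → s ℕ.≤ 8640 ℕ.* x → ι s ≤ β * D
  S≤βD {D} x s = β-bound {D} 8640 {x} {s}

-- Strict inequality of reals demands a fixed positive margin. Below, the bound 1/α is split evenly
-- into constant and margin; above, the constant is β + 1 with margin 1.
ratio-bounds : ∀ {S D} → 0ℚ < D → D ≤ α * S → S ≤ β * D →
  ½ * α ⁻¹ + ½ * α ⁻¹ ≤ S * D ⁻¹ × S * D ⁻¹ + 1ℚ ≤ β + 1ℚ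
ratio-bounds {S} {D} 0<D D≤ S≤ = below , +-monoˡ-≤ 1ℚ (*⁻¹-≤ {S} {D} {β} 0<D S≤)
  where
  open ≤-Reasoning
  below : ½ * α ⁻¹ + ½ * α ⁻¹ ≤ S * D ⁻¹
  below = begin
    ½ * α ⁻¹ + ½ * α ⁻¹          ≡⟨ solve 1 (λ i → con ½ :* i :+ con ½ :* i := i :* con 1ℚ) refl (α ⁻¹) ⟩
    α ⁻¹ * 1ℚ                    ≤⟨ *-monoˡ-≤-nonNeg (α ⁻¹) {{nonNegative (<⇒≤ (0<p⁻¹ 0<α))}} (≤-*⁻¹ {S} {D} {α} 0<D D≤) ⟩
    α ⁻¹ * (α * (S * D ⁻¹))      ≡⟨ solve 3 (λ i a r → i :* (a :* r) := (a :* i) :* r) refl (α ⁻¹) α (S * D ⁻¹) ⟩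
    α * α ⁻¹ * (S * D ⁻¹)        ≡⟨ cong (_* (S * D ⁻¹)) (p*p⁻¹≡1 0<α) ⟩
    1ℚ * (S * D ⁻¹)              ≡⟨ *-identityˡ (S * D ⁻¹) ⟩
    S * D ⁻¹                     ∎

eventual-bounds : ∀ T (2≤T : fromℕ 2 ≤ℝ T) N → fromℕ N ≤ℝ T → T <ℝ fromℕ (suc N) →
  ∃[ n₀ ] (∀ n → n₀ ℕ.≤ n → let R = ι (∑ N f) * denominator (seq T n) (logSeq T n) ⁻¹ in
    ½ * α ⁻¹ + ½ * α ⁻¹ ≤ R × R + 1ℚ ≤ β + 1ℚ)
eventual-bounds T 2≤T N N≤T T<N+1 =
  onset , λ n onset≤n → bound {n} (0<p n onset≤n) (0<l n onset≤n)
    (denominator-upper N (suc M) (<⇒≤ (0<p n onset≤n)) (<⇒≤ (0<l n onset≤n)) (p≤2N n onset≤n) (l≤13K n onset≤n))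
    (denominator-lower N (suc M) (<⇒≤ (0<p n onset≤n)) (<⇒≤ (0<l n onset≤n)) (N≤2p n onset≤n) (K≤4l n onset≤n))
  where
  2≤N′ : 2 ℕ.≤ N
  2≤N′ = 2≤N {T} {N} 2≤T T<N+1
  enclosure : ∃[ M ] (8 ℕ.^ (4 ℕ.* M) ℕ.≤ N × N ℕ.< 8 ℕ.^ (4 ℕ.* suc M))
  enclosure = between-powers N (ℕₚ.≤-trans (s≤s z≤n) 2≤N′)
  M : ℕ
  M = proj₁ enclosure
  lower : 8 ℕ.^ (4 ℕ.* M) ℕ.≤ N
  lower = proj₁ (proj₂ enclosure)
  upper : N ℕ.< 8 ℕ.^ (4 ℕ.* suc M)
  upper = proj₂ (proj₂ enclosure)
  open Approximations {T} 2≤T {N} {M} N≤T T<N+1 lower upper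
  bound : ∀ {n} → 0ℚ < seq T n → 0ℚ < logSeq T n →
    denominator (seq T n) (logSeq T n) ≤ ι 4394 * ι (scale N (suc M)) →
    ι (scale N (suc M)) ≤ ι 128 * denominator (seq T n) (logSeq T n) →
    let R = ι (∑ N f) * denominator (seq T n) (logSeq T n) ⁻¹ in
    ½ * α ⁻¹ + ½ * α ⁻¹ ≤ R × R + 1ℚ ≤ β + 1ℚ
  bound {n} 0<p 0<l D≤ scale≤ = ratio-bounds {ι (∑ N f)} {denominator (seq T n) (logSeq T n)}
    (0<* 0<p (0<* 0<l (0<* 0<l (0<* 0<l (positive⁻¹ 1ℚ)))))
    (D≤αS (scale N (suc M)) (∑ N f) D≤ (∑f-lower-K M 2≤N′ lower upper))
    (S≤βD (scale N (suc M)) (∑ N f) scale≤ (∑f-upper-K M upper))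

theorem4 : ∃[ C₁ ] ∃[ C₂ ] (0ℝ <ℝ C₁ × 0ℝ <ℝ C₂ ×
    (∀ (T : ℝ) (2≤T : fromℕ 2 ≤ℝ T) (N : ℕ) → fromℕ N ≤ℝ T → T <ℝ fromℕ (suc N) →
    let ratio = fromℕ (sum (map f (applyUpTo suc N)))
                  ÷ℝ (T *ℝ log T (2≤⇒pos {T} 2≤T) ^ℝ 3) ⟨ T·log³T-pos {T} 2≤T ⟩
    in C₁ <ℝ ratio × ratio <ℝ C₂))
theorem4 = fromℚ (½ * α ⁻¹) , fromℚ (β + 1ℚ) ,
  (½ * α ⁻¹ , 0<C₁ , 0 , λ _ _ → ≤-reflexive (+-identityˡ (½ * α ⁻¹))) ,
  (β + 1ℚ , 0<C₂ , 0 , λ _ _ → ≤-reflexive (+-identityˡ (β + 1ℚ))) ,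
  λ T 2≤T N N≤T T<N+1 → let n₀ , bounds = eventual-bounds T 2≤T N N≤T T<N+1 in
    (½ * α ⁻¹ , 0<C₁ , n₀ , λ n n₀≤n → proj₁ (bounds n n₀≤n)) ,
    (1ℚ , positive⁻¹ 1ℚ , n₀ , λ n n₀≤n → proj₂ (bounds n n₀≤n))
  where
  0<C₁ : 0ℚ < ½ * α ⁻¹
  0<C₁ = 0<* (positive⁻¹ ½) (0<p⁻¹ 0<α)
  0<C₂ : 0ℚ < β + 1ℚ
  0<C₂ = +-mono-≤-< (0≤β) (positive⁻¹ 1ℚ)
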